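{- Let $n\ge 2$ and $p\in(0,1/2]$, and let $\mathcal{F}$ be an odd-linear-dependency-intersecting family of subsets of $\mathbb{Z}_2^n$. Then $\mu_p(\mathcal{F})\le p^3$, with equality if and only if $\mathcal{F}$ is a Schur-umvirate. Moreover, for each $p\in(0,1/2]$ there exists a constant $c_p$, not depending on $n$, with $\sup_{p\in[\delta,1/2]}c_p<\infty$ for every fixed $\delta>0$, such that for any $\epsilon>0$, if $\mu_p(\mathcal{F})\ge p^3-\epsilon$ then there exists a Schur-umvirate $\mathcal{T}$ with $\mu_p(\mathcal{T}\,\Delta\,\mathcal{F})\le c_p\epsilon$. For $p=1/2$, the corresponding statements hold for odd-linear-dependency-agreeing families, with Schur-umvirates replaced by Schur juntas: if $\mathcal{F}$ is odd-linear-dependency-agreeing then $\mu_{1/2}(\mathcal{F})\le 1/8$, with equality iff $\mathcal{F}$ is a Schur junta, and if $\mu_{1/2}(\mathcal{F})\ge 1/8-\epsilon$ then $\mu_{1/2}(\mathcal{T}\,\Delta\,\mathcal{F})\le c_{1/2}\epsilon$ for some Schur junta $\mathcal{T}$.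
   Context: A family $\mathcal{F}$ of subsets of $\mathbb{Z}_2^n$ is odd-linear-dependency-intersecting if for any $S,T\in\mathcal{F}$ there exist $l\in\mathbb{N}$ and non-zero vectors $v_1,\dots,v_{2l+1}\in S\cap T$ with $v_1+\dots+v_{2l+1}=0$; it is odd-linear-dependency-agreeing if the same holds with $\overline{S\Delta T}$ (complement of the symmetric difference, in $\mathbb{Z}_2^n$) in place of $S\cap T$. For $p\in[0,1]$, $\mu_p(S)=p^{|S|}(1-p)^{2^n-|S|}$ for $S\subseteq\mathbb{Z}_2^n$ and $\mu_p(\mathcal{F})=\sum_{S\in\mathcal{F}}\mu_p(S)$. A Schur triple is a set $\{x,y,x+y\}$ of three distinct non-zero vectors. A Schur-umvirate is the family of all subsets of $\mathbb{Z}_2^n$ containing a fixed Schur triple; a Schur junta is the family of all subsets of $\mathbb{Z}_2^n$ with a prescribed intersection with a fixed Schur triple.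
   Formalization: The quantities p, ε and δ range over rational numbers instead of real numbers (so the boundedness of c_p is over rational p in [δ,1/2]), and the constants c_p are rational. -}

module Defs where

open import Data.Bool using (Bool; true; false; _xor_; _∧_; not)
open import Data.Nat as ℕ using (ℕ; zero; suc; _∸_)
open import Data.Fin using (Fin; _↑ˡ_; _↑ʳ_)
open import Data.Vec using (Vec; []; _∷_; lookup; replicate; zipWith; foldr; count)
open import Data.List as L using (List)
open import Data.Rational using (ℚ; 0ℚ; 1ℚ; _+_; _*_; _-_)
open import Data.Product using (Σ; ∃; _×_; _,_)
open import Relation.Binary.PropositionalEquality using (_≡_; _≢_)
open import Relation.Nullary using (¬_)
open import Data.Vec.Relation.Unary.All using (All)
open import Function.Bundles using (_⇔_)

Point : ℕ → Set
Point n = Vec Bool n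

0v : ∀ {n} → Point n
0v = replicate _ false

_⊕_ : ∀ {n} → Point n → Point n → Point n
_⊕_ = zipWith _xor_

vsum : ∀ {n k} → Vec (Point n) k → Point n
vsum = foldr _ _⊕_ 0v

idx : ∀ {n} → Point n → Fin (2 ℕ.^ n)
idx {zero} [] = Fin.zero
idx {suc n} (false ∷ v) = idx v ↑ˡ (2 ℕ.^ n ℕ.+ 0)
idx {suc n} (true ∷ v) = (2 ℕ.^ n) ↑ʳ (idx v ↑ˡ 0)

-- a subset of Z_2^n, as its characteristic vector indexed by idx
record Sub (n : ℕ) : Set where
  constructor sub
  field bits : Vec Bool (2 ℕ.^ n)
open Sub public

_∈ₛ_ : ∀ {n} → Point n → Sub n → Bool
v ∈ₛ S = lookup (bits S) (idx v)

size : ∀ {n} → Sub n → ℕ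
size S = count (λ b → Data.Bool._≟_ b true) (bits S)
  where import Data.Bool

Family : ℕ → Set
Family n = Sub n → Bool

allVecs : (m : ℕ) → List (Vec Bool m)
allVecs zero = L.[ [] ]
allVecs (suc m) = L.map (false ∷_) (allVecs m) L.++ L.map (true ∷_) (allVecs m)

_^ℚ_ : ℚ → ℕ → ℚ
x ^ℚ zero = 1ℚ
x ^ℚ suc k = x * (x ^ℚ k)

μₛ : ∀ {n} → ℚ → Sub n → ℚ
μₛ {n} p S = (p ^ℚ size S) * ((1ℚ - p) ^ℚ (2 ℕ.^ n ∸ size S))

μ : ∀ {n} → ℚ → Family n → ℚ
μ {n} p F = L.foldr _+_ 0ℚ
  (L.map (λ S → if F S then μₛ p S else 0ℚ) (L.map sub (allVecs (2 ℕ.^ n))))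
  where open import Data.Bool using (if_then_else_)

_Δ_ : ∀ {n} → Family n → Family n → Family n
(F Δ G) S = F S xor G S

OddDep : ∀ {n} → (Point n → Set) → Set
OddDep {n} P = ∃ λ (l : ℕ) → Σ (Vec (Point n) (suc (2 ℕ.* l))) λ vs →
  All (λ v → v ≢ 0v × P v) vs × vsum vs ≡ 0v

OddIntersecting : ∀ {n} → Family n → Set
OddIntersecting {n} F = ∀ (S T : Sub n) → F S ≡ true → F T ≡ true →
  OddDep (λ v → (v ∈ₛ S) ≡ true × (v ∈ₛ T) ≡ true)

-- v ∈ complement of S Δ T  iff  (v ∈ S ↔ v ∈ T)
OddAgreeing : ∀ {n} → Family n → Set
OddAgreeing {n} F = ∀ (S T : Sub n) → F S ≡ true → F T ≡ true →
  OddDep (λ v → (v ∈ₛ S) ≡ (v ∈ₛ T))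

SchurTriple : ∀ {n} → Point n → Point n → Point n → Set
SchurTriple x y z = x ≢ 0v × y ≢ 0v × z ≢ 0v × x ≢ y × x ≢ z × y ≢ z × z ≡ x ⊕ y

SchurUmvirate : ∀ {n} → Family n → Set
SchurUmvirate {n} F = ∃ λ (x : Point n) → ∃ λ (y : Point n) → ∃ λ (z : Point n) →
  SchurTriple x y z ×
  (∀ (S : Sub n) → (F S ≡ true) ⇔ ((x ∈ₛ S) ≡ true × (y ∈ₛ S) ≡ true × (z ∈ₛ S) ≡ true))

SchurJunta : ∀ {n} → Family n → Set
SchurJunta {n} F = ∃ λ (x : Point n) → ∃ λ (y : Point n) → ∃ λ (z : Point n) →
  SchurTriple x y z × ∃ λ (a : Bool) → ∃ λ (b : Bool) → ∃ λ (c : Bool) →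
  (∀ (S : Sub n) → (F S ≡ true) ⇔ ((x ∈ₛ S) ≡ a × (y ∈ₛ S) ≡ b × (z ∈ₛ S) ≡ c))

{-# OPTIONS --safe #-}

-- For w ∈ ℤ₂ⁿ put H = {x : ⟨w,x⟩ = 1}. An odd dependency never lies in H, so members S, T of the family meet
-- (resp. agree) at a nonzero vector off H. Expand the indicator f of the family in p-biased characters χ_R and put
-- q = p/(1 − p). Then for every w and Y ⊆ H ∪ {0} the function Σ_{R ∩ (H ∪ {0}) = Y} (−q)^|R∖Y| f̂(R) χ_R vanishes
-- on the family. Pairing with f and averaging over w, with coefficients depending on R ∩ H, gives Σ_R λ_R W(R) = 0
-- for the Fourier weights W(R). The coefficients are chosen so that λ_R = −q³ on singletons, pairs and Schur triples
-- while λ_R ≥ −(127/128)q³ on all other nonempty R; Hoffman's argument then yields μ ≤ p³, and if μ ≥ p³ − ε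
-- the weight outside these sets is O(ε).
--
-- Stability needs no junta theorem. If R = {x,y,z} is a Schur triple with R ∩ H = {x,y}, the pointwise identity says
-- that f χ_x χ_y (f̂(xy) − q f̂(xyz) χ_z) equals an error supported on that small weight, which bounds f̂(R)² times
-- the smaller of the measures of {S ∈ F : z ∈ S} and {S ∈ F : z ∉ S}. Summing over R and w gives one Schur triple for
-- which all three minima are O(ε), so the family is O(ε)-close to a cylinder over this triple. Taking ε below the
-- measure of a point settles the equality case.
module Submission where

open import Defs
open import Data.Bool using (Bool; true; false; not; _∧_; _∨_; _xor_; if_then_else_)
import Data.Bool as Bool
import Data.Bool.Properties as Bool
open import Data.Empty using (⊥; ⊥-elim)
open import Data.Fin using (Fin; zero; suc)
import Data.Fin.Properties as Fin
open import Data.Integer using (+_)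
open import Data.List using (List; []; _∷_; _++_; length; filterᵇ; null)
import Data.List as List
import Data.List.Properties as List
open import Data.List.Relation.Unary.All using (All; []; _∷_)
import Data.List.Relation.Unary.All as All
import Data.List.Relation.Unary.All.Properties as All
open import Data.List.Relation.Unary.AllPairs using ([]; _∷_)
import Data.List.Relation.Unary.AllPairs.Properties as AllPairs
open import Data.List.Relation.Unary.Unique.Propositional using (Unique)
import Data.List.Relation.Unary.Unique.Propositional.Properties as Unique
open import Data.Maybe using (Maybe; just; nothing)
open import Data.Nat using (ℕ; zero; suc; _≤_; z≤n; s≤s)
import Data.Nat as ℕ
import Data.Nat.Properties as ℕ
open import Data.Product using (∃; _×_; _,_; proj₁; proj₂)
open import Data.Rational using (ℚ; 0ℚ; 1ℚ; ½; _+_; _*_; _-_; -_; _/_; _⊓_) renaming (_≤_ to _≤ℚ_; _<_ to _<ℚ_)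
import Data.Rational as ℚ
import Data.Rational.Properties as ℚ
open import Data.Sum using (_⊎_; inj₁; inj₂; [_,_]′)
open import Data.Unit using (⊤; tt)
open import Data.Vec using (Vec; []; _∷_; _[_]≔_; lookup; map; zipWith; toList)
import Data.Vec as Vec
import Data.Vec.Properties as Vec
import Data.Vec.Relation.Unary.All as VecAll
open import Function using (_∘_; id)
open import Function.Bundles using (_⇔_; mk⇔; Equivalence)
open import Level using (0ℓ)
open import Relation.Binary.PropositionalEquality using (_≡_; _≢_; refl; sym; trans; cong; cong₂; subst; subst₂; module ≡-Reasoning)
open import Relation.Nullary using (¬_; yes; no)
open import Relation.Nullary.Decidable using (True; toWitness)
open import Tactic.RingSolver using (solve-∀)
open import Tactic.RingSolver.Core.AlmostCommutativeRing using (AlmostCommutativeRing; fromCommutativeRing)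

-- Sums over the cube

-- The prescribed eigenvalues are dictated by the extremal example. The indicator of the family
-- attached to a Schur triple has Fourier support on the subsets of that triple, and equality in
-- Hoffman's bound requires its nonempty frequencies to carry the least eigenvalue. Every nonzero
-- vector and every pair of distinct ones lies in a Schur triple, so three coefficients are fixed.
-- The empty set then receives (1 + q)³ - q³, and the Hoffman ratio q³/(1 + q)³ is p³.
--
-- The obstacle is p = 1/2: there q = 1, the factor (-q)^|R| does not decay, and the average over w
-- alone must keep every large R away from -q³, from below for even |R| and from above for odd |R|.
-- For general R only the pairwise independence of the bits ⟨w,x⟩ is at hand, hence bounds by
-- quadratics in |R ∩ H|. Two situations need more: a vector outside the span of the others, since
-- then |R ∩ H| = 1 can occur, with a very negative coefficient; and small rank, since then R ∩ H =
-- ∅ is frequent and its coefficient is large. The case splits follow these two.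

0≟ : (x : ℚ) → Maybe (0ℚ ≡ x)
0≟ x with 0ℚ ℚ.≟ x
... | yes e = just e
... | no _ = nothing

ring : AlmostCommutativeRing 0ℓ 0ℓ
ring = fromCommutativeRing ℚ.+-*-commutativeRing 0≟

2ℚ 3ℚ 5ℚ 6ℚ 7ℚ 9ℚ 15ℚ : ℚ
2ℚ = + 2 / 1
3ℚ = + 3 / 1
5ℚ = + 5 / 1
6ℚ = + 6 / 1
7ℚ = + 7 / 1
9ℚ = + 9 / 1
15ℚ = + 15 / 1

nonneg : ∀ c {_ : True (0ℚ ℚ.≤? c)} → 0ℚ ≤ℚ c
nonneg c {t} = toWitness t

infixl 6 _⊞_
infixl 7 _⊠_

_⊞_ : ∀ {a b} → 0ℚ ≤ℚ a → 0ℚ ≤ℚ b → 0ℚ ≤ℚ a + b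
_⊞_ = ℚ.+-mono-≤

_⊠_ : ∀ {a b} → 0ℚ ≤ℚ a → 0ℚ ≤ℚ b → 0ℚ ≤ℚ a * b
_⊠_ {a} {b} 0≤a 0≤b = subst (_≤ℚ a * b) (ℚ.*-zeroʳ a) (ℚ.*-monoˡ-≤-nonNeg a {{ℚ.nonNegative 0≤a}} 0≤b)

neg-neg : ∀ a → - a * - a ≡ a * a
neg-neg = solve-∀ ring

square-nonneg : ∀ a → 0ℚ ≤ℚ a * a
square-nonneg a with ℚ.≤-total 0ℚ a
... | inj₁ 0≤a = 0≤a ⊠ 0≤a
... | inj₂ a≤0 = subst (0ℚ ≤ℚ_) (neg-neg a) (0≤-a ⊠ 0≤-a)
  where
  0≤-a : 0ℚ ≤ℚ - a
  0≤-a = ℚ.neg-antimono-≤ a≤0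

a+[b-a] : ∀ a b → a + (b - a) ≡ b
a+[b-a] = solve-∀ ring

diff : ∀ {a b} → a ≤ℚ b → 0ℚ ≤ℚ b - a
diff {a} {b} a≤b = subst (_≤ℚ b - a) (ℚ.+-inverseʳ a) (ℚ.+-monoˡ-≤ (- a) a≤b)

by-diff : ∀ {a b r} → 0ℚ ≤ℚ r → b - a ≡ r → a ≤ℚ b
by-diff {a} {b} 0≤r e = subst₂ _≤ℚ_ (ℚ.+-identityʳ a) (a+[b-a] a b) (ℚ.+-monoʳ-≤ a (subst (0ℚ ≤ℚ_) (sym e) 0≤r))

*-monoˡ : ∀ {a b c} → 0ℚ ≤ℚ c → a ≤ℚ b → c * a ≤ℚ c * b
*-monoˡ {c = c} 0≤c a≤b = ℚ.*-monoˡ-≤-nonNeg c {{ℚ.nonNegative 0≤c}} a≤b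

*-monoʳ : ∀ {a b c} → 0ℚ ≤ℚ c → a ≤ℚ b → a * c ≤ℚ b * c
*-monoʳ {c = c} 0≤c a≤b = ℚ.*-monoʳ-≤-nonNeg c {{ℚ.nonNegative 0≤c}} a≤b

*-swap : ∀ a b c → a * (b * c) ≡ b * (a * c)
*-swap = solve-∀ ring

1-x³-nonneg : ∀ {x} → 0ℚ ≤ℚ x → 0ℚ ≤ℚ 1ℚ - x → 0ℚ ≤ℚ 1ℚ - x * (x * x)
1-x³-nonneg {x} 0≤x 0≤1-x = subst (0ℚ ≤ℚ_) (e x) (0≤1-x ⊠ (nonneg 1ℚ ⊞ 0≤x ⊞ 0≤x ⊠ 0≤x))
  where
  e : ∀ x → (1ℚ - x) * (1ℚ + x + x * x) ≡ 1ℚ - x * (x * x)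
  e = solve-∀ ring

0<*0< : ∀ {a b} → 0ℚ <ℚ a → 0ℚ <ℚ b → 0ℚ <ℚ a * b
0<*0< {a} {b} 0<a 0<b = subst (_<ℚ a * b) (ℚ.*-zeroʳ a) (ℚ.*-monoʳ-<-pos a {{ℚ.positive 0<a}} 0<b)

𝟙 : Bool → ℚ
𝟙 true = 1ℚ
𝟙 false = 0ℚ

𝟙-nonneg : ∀ b → 0ℚ ≤ℚ 𝟙 b
𝟙-nonneg true = nonneg 1ℚ
𝟙-nonneg false = nonneg 0ℚ

𝟙-idem : ∀ b → 𝟙 b * 𝟙 b ≡ 𝟙 b
𝟙-idem true = refl
𝟙-idem false = refl

-- Weights 1 - p, p give the biased expectation, ½, ½ the average over functionals, and 1, 1 the
-- plain sum over frequencies. A common definition lets `wsum-swap` exchange any two of them.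
wsum : ∀ {N} → ℚ → ℚ → (Vec Bool N → ℚ) → ℚ
wsum {zero} a b f = f []
wsum {suc N} a b f = a * wsum a b (f ∘ (false ∷_)) + b * wsum a b (f ∘ (true ∷_))

module _ {a b : ℚ} where

  wsum-cong : ∀ {N} {f g : Vec Bool N → ℚ} → (∀ x → f x ≡ g x) → wsum a b f ≡ wsum a b g
  wsum-cong {zero} e = e []
  wsum-cong {suc N} e = cong₂ (λ s t → a * s + b * t) (wsum-cong (e ∘ (false ∷_))) (wsum-cong (e ∘ (true ∷_)))

  wsum-+ : ∀ {N} (f g : Vec Bool N → ℚ) → wsum a b (λ x → f x + g x) ≡ wsum a b f + wsum a b g
  wsum-+ {zero} f g = refl
  wsum-+ {suc N} f g = trans
    (cong₂ (λ s t → a * s + b * t) (wsum-+ (f ∘ (false ∷_)) (g ∘ (false ∷_))) (wsum-+ (f ∘ (true ∷_)) (g ∘ (true ∷_))))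
    (step a b (wsum a b (f ∘ (false ∷_))) (wsum a b (g ∘ (false ∷_))) (wsum a b (f ∘ (true ∷_))) (wsum a b (g ∘ (true ∷_))))
    where
    step : ∀ a b s t u v → a * (s + t) + b * (u + v) ≡ (a * s + b * u) + (a * t + b * v)
    step = solve-∀ ring

  wsum-* : ∀ {N} c (f : Vec Bool N → ℚ) → wsum a b (λ x → c * f x) ≡ c * wsum a b f
  wsum-* {zero} c f = refl
  wsum-* {suc N} c f = trans
    (cong₂ (λ s t → a * s + b * t) (wsum-* c (f ∘ (false ∷_))) (wsum-* c (f ∘ (true ∷_))))
    (step a b c (wsum a b (f ∘ (false ∷_))) (wsum a b (f ∘ (true ∷_))))
    where
    step : ∀ a b c s t → a * (c * s) + b * (c * t) ≡ c * (a * s + b * t)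
    step = solve-∀ ring

  wsum-lin : ∀ {N} c d (f g : Vec Bool N → ℚ) → wsum a b (λ x → c * f x + d * g x) ≡ c * wsum a b f + d * wsum a b g
  wsum-lin c d f g = trans (wsum-+ (λ x → c * f x) (λ x → d * g x)) (cong₂ _+_ (wsum-* c f) (wsum-* d g))

  wsum-0 : ∀ {N} → wsum {N} a b (λ _ → 0ℚ) ≡ 0ℚ
  wsum-0 {N} = trans (wsum-* {N} 0ℚ (λ _ → 0ℚ)) (ℚ.*-zeroˡ (wsum {N} a b (λ _ → 0ℚ)))

  wsum-const : ∀ {N} → a + b ≡ 1ℚ → ∀ c → wsum {N} a b (λ _ → c) ≡ c
  wsum-const {zero} e c = refl
  wsum-const {suc N} e c = trans (cong₂ (λ s t → a * s + b * t) (wsum-const {N} e c) (wsum-const {N} e c))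
    (trans (sym (ℚ.*-distribʳ-+ c a b)) (trans (cong (_* c) e) (ℚ.*-identityˡ c)))

  wsum-mono : 0ℚ ≤ℚ a → 0ℚ ≤ℚ b → ∀ {N} {f g : Vec Bool N → ℚ} → (∀ x → f x ≤ℚ g x) → wsum a b f ≤ℚ wsum a b g
  wsum-mono 0≤a 0≤b {zero} f≤g = f≤g []
  wsum-mono 0≤a 0≤b {suc N} f≤g = ℚ.+-mono-≤
    (*-monoˡ 0≤a (wsum-mono 0≤a 0≤b (f≤g ∘ (false ∷_))))
    (*-monoˡ 0≤b (wsum-mono 0≤a 0≤b (f≤g ∘ (true ∷_))))

  wsum-nonneg : 0ℚ ≤ℚ a → 0ℚ ≤ℚ b → ∀ {N} {f : Vec Bool N → ℚ} → (∀ x → 0ℚ ≤ℚ f x) → 0ℚ ≤ℚ wsum a b f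
  wsum-nonneg 0≤a 0≤b {N} {f} 0≤f = subst (_≤ℚ wsum a b f) (wsum-0 {N}) (wsum-mono 0≤a 0≤b 0≤f)

wsum-swap : ∀ {a b c d N M} (f : Vec Bool N → Vec Bool M → ℚ) →
  wsum a b (λ x → wsum c d (f x)) ≡ wsum c d (λ y → wsum a b (λ x → f x y))
wsum-swap {N = zero} f = refl
wsum-swap {a} {b} {N = suc N} f = trans
  (cong₂ (λ s t → a * s + b * t) (wsum-swap (f ∘ (false ∷_))) (wsum-swap (f ∘ (true ∷_))))
  (sym (wsum-lin a b (λ y → wsum a b (λ x → f (false ∷ x) y)) (λ y → wsum a b (λ x → f (true ∷ x) y))))

Σᵥ : ∀ {N} → (Vec Bool N → ℚ) → ℚ
Σᵥ = wsum 1ℚ 1ℚ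

-- Biased Fourier analysis

-- The first vector marks the free coordinates. With `comp` a negated conjunction, S ∩ T lies inside
-- the marked set; with `comp` exclusive or, S and T differ everywhere outside it.
data Compat (comp : Bool → Bool → Bool) : ∀ {N} → Vec Bool N → Vec Bool N → Vec Bool N → Set where
  [] : Compat comp [] [] []
  _∷_ : ∀ {N h s t} {hs S T : Vec Bool N} → h ≡ true ⊎ comp s t ≡ true → Compat comp hs S T → Compat comp (h ∷ hs) (s ∷ S) (t ∷ T)

pow : ℚ → ∀ {N} → Vec Bool N → ℚ
pow x [] = 1ℚ
pow x (false ∷ R) = pow x R
pow x (true ∷ R) = x * pow x R

_∩_ : ∀ {N} → Vec Bool N → Vec Bool N → Vec Bool N
_∩_ = zipWith _∧_

∁ : ∀ {N} → Vec Bool N → Vec Bool N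
∁ = map not

∅ : ∀ {N} → Vec Bool N
∅ {zero} = []
∅ {suc N} = false ∷ ∅

pow-nonneg : ∀ {x} → 0ℚ ≤ℚ x → ∀ {N} (R : Vec Bool N) → 0ℚ ≤ℚ pow x R
pow-nonneg 0≤x [] = nonneg 1ℚ
pow-nonneg 0≤x (false ∷ R) = pow-nonneg 0≤x R
pow-nonneg 0≤x (true ∷ R) = 0≤x ⊠ pow-nonneg 0≤x R

pow-split : ∀ x {N} (h R : Vec Bool N) → pow x (R ∩ h) * pow x (R ∩ ∁ h) ≡ pow x R
pow-split x [] [] = refl
pow-split x (h ∷ hs) (false ∷ R) = pow-split x hs R
pow-split x (true ∷ hs) (true ∷ R) = trans (ℚ.*-assoc x _ _) (cong (x *_) (pow-split x hs R))
pow-split x (false ∷ hs) (true ∷ R) = trans (*-swap (pow x (R ∩ hs)) x (pow x (R ∩ ∁ hs))) (cong (x *_) (pow-split x hs R))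

-- ψ is the unnormalised p-biased character of one coordinate, so ∫ψ² = p(1 − p) and no square root occurs;
-- −q is the eigenvalue on ψ of the reversible Markov chain that never moves from 1 to 1.
module Fourier (p q : ℚ) (q-eq : q * (1ℚ - p) ≡ p) where

  v : ℚ
  v = p * (1ℚ - p)

  𝔼 : ∀ {N} → (Vec Bool N → ℚ) → ℚ
  𝔼 = wsum (1ℚ - p) p

  ψ : Bool → ℚ
  ψ false = - p
  ψ true = 1ℚ - p

  ft : ∀ {N} → (Vec Bool N → ℚ) → Vec Bool N → ℚ
  ft f [] = f []
  ft f (false ∷ R) = ft (λ S → (1ℚ - p) * f (false ∷ S) + p * f (true ∷ S)) R
  ft f (true ∷ R) = ft (λ S → f (true ∷ S) - f (false ∷ S)) R

  ift : ∀ {N} → (Vec Bool N → ℚ) → Vec Bool N → ℚ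
  ift c [] = c []
  ift c (s ∷ S) = ift (c ∘ (false ∷_)) S + ψ s * ift (c ∘ (true ∷_)) S

  χ : ∀ {N} → Vec Bool N → Vec Bool N → ℚ
  χ [] [] = 1ℚ
  χ (false ∷ R) (s ∷ S) = χ R S
  χ (true ∷ R) (s ∷ S) = ψ s * χ R S

  ft-cong : ∀ {N} {f g : Vec Bool N → ℚ} → (∀ S → f S ≡ g S) → ∀ R → ft f R ≡ ft g R
  ft-cong e [] = e []
  ft-cong e (false ∷ R) = ft-cong (λ S → cong₂ (λ s t → (1ℚ - p) * s + p * t) (e (false ∷ S)) (e (true ∷ S))) R
  ft-cong e (true ∷ R) = ft-cong (λ S → cong₂ _-_ (e (true ∷ S)) (e (false ∷ S))) R

  ft-lin : ∀ {N} c d (f g : Vec Bool N → ℚ) R → ft (λ S → c * f S + d * g S) R ≡ c * ft f R + d * ft g R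
  ft-lin c d f g [] = refl
  ft-lin c d f g (false ∷ R) = trans
    (ft-cong (λ S → step p c d (f (false ∷ S)) (g (false ∷ S)) (f (true ∷ S)) (g (true ∷ S))) R)
    (ft-lin c d (λ S → (1ℚ - p) * f (false ∷ S) + p * f (true ∷ S)) (λ S → (1ℚ - p) * g (false ∷ S) + p * g (true ∷ S)) R)
    where
    step : ∀ p c d s t u v → (1ℚ - p) * (c * s + d * t) + p * (c * u + d * v) ≡ c * ((1ℚ - p) * s + p * u) + d * ((1ℚ - p) * t + p * v)
    step = solve-∀ ring
  ft-lin c d f g (true ∷ R) = trans
    (ft-cong (λ S → step c d (f (false ∷ S)) (g (false ∷ S)) (f (true ∷ S)) (g (true ∷ S))) R)
    (ft-lin c d (λ S → f (true ∷ S) - f (false ∷ S)) (λ S → g (true ∷ S) - g (false ∷ S)) R)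
    where
    step : ∀ c d s t u v → (c * u + d * v) - (c * s + d * t) ≡ c * (u - s) + d * (v - t)
    step = solve-∀ ring

  ift-cong : ∀ {N} {c d : Vec Bool N → ℚ} → (∀ R → c R ≡ d R) → ∀ S → ift c S ≡ ift d S
  ift-cong e [] = e []
  ift-cong e (s ∷ S) = cong₂ (λ a b → a + ψ s * b) (ift-cong (e ∘ (false ∷_)) S) (ift-cong (e ∘ (true ∷_)) S)

  ift-* : ∀ {N} a (c : Vec Bool N → ℚ) S → ift (λ R → a * c R) S ≡ a * ift c S
  ift-* a c [] = refl
  ift-* a c (s ∷ S) = trans
    (cong₂ (λ x y → x + ψ s * y) (ift-* a (c ∘ (false ∷_)) S) (ift-* a (c ∘ (true ∷_)) S))
    (step a (ψ s) (ift (c ∘ (false ∷_)) S) (ift (c ∘ (true ∷_)) S))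
    where
    step : ∀ a z s u → (a * s) + z * (a * u) ≡ a * (s + z * u)
    step = solve-∀ ring

  ift-+ : ∀ {N} (c d : Vec Bool N → ℚ) S → ift (λ R → c R + d R) S ≡ ift c S + ift d S
  ift-+ c d [] = refl
  ift-+ c d (s ∷ S) = trans
    (cong₂ (λ x y → x + ψ s * y) (ift-+ (c ∘ (false ∷_)) (d ∘ (false ∷_)) S) (ift-+ (c ∘ (true ∷_)) (d ∘ (true ∷_)) S))
    (step (ψ s) (ift (c ∘ (false ∷_)) S) (ift (d ∘ (false ∷_)) S) (ift (c ∘ (true ∷_)) S) (ift (d ∘ (true ∷_)) S))
    where
    step : ∀ z s t u v → (s + t) + z * (u + v) ≡ (s + z * u) + (t + z * v)
    step = solve-∀ ring

  -- The coordinate factors of the operator that applies the chain off h and projects onto the Y-component on h.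
  κ₁ : Bool → Bool → Bool → ℚ
  κ₁ true true r = 𝟙 r
  κ₁ true false r = 𝟙 (not r)
  κ₁ false true r = 0ℚ
  κ₁ false false false = 1ℚ
  κ₁ false false true = - q

  κ : ∀ {N} → Vec Bool N → Vec Bool N → Vec Bool N → ℚ
  κ [] [] [] = 1ℚ
  κ (h ∷ hs) (y ∷ Y) (r ∷ R) = κ₁ h y r * κ hs Y R

  op : ∀ {N} → Vec Bool N → Vec Bool N → (Vec Bool N → ℚ) → Vec Bool N → ℚ
  op h Y f = ift (λ R → κ h Y R * ft f R)

  -- The operator is a tensor product, so its first factor can be applied to the function before the
  -- other coordinates are expanded. Inductions on the coordinates rest on this.
  op-step : ∀ {N} h y (hs Y : Vec Bool N) f s S → op (h ∷ hs) (y ∷ Y) f (s ∷ S) ≡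
    op hs Y (λ T → κ₁ h y false * ((1ℚ - p) * f (false ∷ T) + p * f (true ∷ T)) + ψ s * κ₁ h y true * (f (true ∷ T) - f (false ∷ T))) S
  op-step h y hs Y f s S = sym (trans
    (ift-cong (λ R → trans
      (cong (κ hs Y R *_) (ft-lin k₀ (ψ s * k₁) m d R))
      (step₁ k₀ (ψ s) k₁ (κ hs Y R) (ft m R) (ft d R))) S)
    (trans (ift-+ (λ R → k₀ * κ hs Y R * ft m R) (λ R → ψ s * (k₁ * κ hs Y R * ft d R)) S)
      (cong (λ x → ift (λ R → k₀ * κ hs Y R * ft m R) S + x) (ift-* (ψ s) (λ R → k₁ * κ hs Y R * ft d R) S))))
    where
    k₀ = κ₁ h y false
    k₁ = κ₁ h y true
    m d : _ → ℚ
    m T = (1ℚ - p) * f (false ∷ T) + p * f (true ∷ T)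
    d T = f (true ∷ T) - f (false ∷ T)
    step₁ : ∀ k₀ z k₁ κ m d → κ * (k₀ * m + z * k₁ * d) ≡ k₀ * κ * m + z * (k₁ * κ * d)
    step₁ = solve-∀ ring

  module _ {comp : Bool → Bool → Bool} (comp-tf : comp true false ≡ true) (comp-ft : comp false true ≡ true)
           (comp-ff : comp false false ≡ true ⊎ q ≡ 1ℚ) where

    private
      pq : p * q ≡ q - p
      pq = trans (a p q) (cong (λ x → q - x) q-eq)
        where
        a : ∀ p q → p * q ≡ q - q * (1ℚ - p)
        a = solve-∀ ring

    -- Off `h` the chain moves from 1 to 0 surely, and from 0 to 1 with probability q, staying at 0
    -- with probability 1 - q; so it only reaches sets compatible with S. Staying at 0 is harmless
    -- either because the pair of two zeros is compatible or because q = 1 makes it impossible.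
    op-vanish : ∀ {N} (h Y S : Vec Bool N) (f : Vec Bool N → ℚ) → (∀ T → Compat comp h S T → f T ≡ 0ℚ) → op h Y f S ≡ 0ℚ
    op-vanish [] [] [] f f≡0 = trans (ℚ.*-identityˡ (f [])) (f≡0 [] [])
    op-vanish (h ∷ hs) (y ∷ Y) (s ∷ S) f f≡0 = trans (op-step h y hs Y f s S) (op-vanish hs Y S _ (λ T c → vanish h y s T c (λ t b → f≡0 (t ∷ T) (b ∷ c))))
      where
      vanish : ∀ h y s T → Compat comp hs S T → (∀ t → h ≡ true ⊎ comp s t ≡ true → f (t ∷ T) ≡ 0ℚ) →
        κ₁ h y false * ((1ℚ - p) * f (false ∷ T) + p * f (true ∷ T)) + ψ s * κ₁ h y true * (f (true ∷ T) - f (false ∷ T)) ≡ 0ℚ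
      vanish true y s T _ z rewrite z false (inj₁ refl) | z true (inj₁ refl) = zz (κ₁ true y false) p (ψ s * κ₁ true y true)
        where
        zz : ∀ k p l → k * ((1ℚ - p) * 0ℚ + p * 0ℚ) + l * (0ℚ - 0ℚ) ≡ 0ℚ
        zz = solve-∀ ring
      vanish false true s T _ z = zz (ψ s) ((1ℚ - p) * f (false ∷ T) + p * f (true ∷ T)) (f (true ∷ T) - f (false ∷ T))
        where
        zz : ∀ k a b → 0ℚ * a + k * 0ℚ * b ≡ 0ℚ
        zz = solve-∀ ring
      vanish false false true T _ z rewrite z false (inj₂ comp-tf) = trans (zz p q (f (true ∷ T)))
        (trans (cong (λ x → (p - x) * f (true ∷ T)) q-eq) (zz′ p (f (true ∷ T))))
        where
        zz : ∀ p q a → 1ℚ * ((1ℚ - p) * 0ℚ + p * a) + (1ℚ - p) * (- q) * (a - 0ℚ) ≡ (p - q * (1ℚ - p)) * a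
        zz = solve-∀ ring
        zz′ : ∀ p a → (p - p) * a ≡ 0ℚ
        zz′ = solve-∀ ring
      vanish false false false T _ z rewrite z true (inj₂ comp-ft) = idle comp-ff
        where
        zz₀ : ∀ p q → 1ℚ * ((1ℚ - p) * 0ℚ + p * 0ℚ) + (- p) * (- q) * (0ℚ - 0ℚ) ≡ 0ℚ
        zz₀ = solve-∀ ring
        zz : ∀ p q a → 1ℚ * ((1ℚ - p) * a + p * 0ℚ) + (- p) * (- q) * (0ℚ - a) ≡ (1ℚ - p - p * q) * a
        zz = solve-∀ ring
        zz′ : ∀ p a → (1ℚ - p - (1ℚ - p)) * a ≡ 0ℚ
        zz′ = solve-∀ ring
        idle : comp false false ≡ true ⊎ q ≡ 1ℚ →
          1ℚ * ((1ℚ - p) * f (false ∷ T) + p * 0ℚ) + (- p) * (- q) * (0ℚ - f (false ∷ T)) ≡ 0ℚ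
        idle (inj₁ cff) rewrite z false (inj₂ cff) = zz₀ p q
        idle (inj₂ q≡1) = trans (zz p q (f (false ∷ T))) (trans (cong (λ x → (1ℚ - p - x) * f (false ∷ T)) pq)
          (trans (cong (λ x → (1ℚ - p - (x - p)) * f (false ∷ T)) q≡1) (zz′ p (f (false ∷ T)))))

  ft-inv : ∀ {N} (f : Vec Bool N → ℚ) S → ift (ft f) S ≡ f S
  ft-inv f [] = refl
  ft-inv f (s ∷ S) = trans (cong₂ (λ a b → a + ψ s * b) (ft-inv _ S) (ft-inv _ S)) (step s)
    where
    step₀ : ∀ p a b → (1ℚ - p) * a + p * b + (- p) * (b - a) ≡ a
    step₀ = solve-∀ ring
    step₁ : ∀ p a b → (1ℚ - p) * a + p * b + (1ℚ - p) * (b - a) ≡ b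
    step₁ = solve-∀ ring
    step : ∀ s → (1ℚ - p) * f (false ∷ S) + p * f (true ∷ S) + ψ s * (f (true ∷ S) - f (false ∷ S)) ≡ f (s ∷ S)
    step false = step₀ p _ _
    step true = step₁ p _ _

  parseval : ∀ {N} (c d : Vec Bool N → ℚ) → 𝔼 (λ S → ift c S * ift d S) ≡ Σᵥ (λ R → pow v R * (c R * d R))
  parseval {zero} c d = sym (ℚ.*-identityˡ _)
  parseval {suc N} c d = begin
    (1ℚ - p) * 𝔼 (at false) + p * 𝔼 (at true)
      ≡⟨ wsum-lin (1ℚ - p) p (at false) (at true) ⟨
    𝔼 (λ S → (1ℚ - p) * at false S + p * at true S)
      ≡⟨ wsum-cong (λ S → step p (ift c₀ S) (ift c₁ S) (ift d₀ S) (ift d₁ S)) ⟩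
    𝔼 (λ S → 1ℚ * (ift c₀ S * ift d₀ S) + p * (1ℚ - p) * (ift c₁ S * ift d₁ S))
      ≡⟨ wsum-lin 1ℚ (p * (1ℚ - p)) (λ S → ift c₀ S * ift d₀ S) (λ S → ift c₁ S * ift d₁ S) ⟩
    1ℚ * 𝔼 (λ S → ift c₀ S * ift d₀ S) + p * (1ℚ - p) * 𝔼 (λ S → ift c₁ S * ift d₁ S)
      ≡⟨ cong₂ (λ a b → 1ℚ * a + v * b) (parseval c₀ d₀) (parseval c₁ d₁) ⟩
    1ℚ * Σᵥ (λ R → pow v R * (c₀ R * d₀ R)) + v * Σᵥ (λ R → pow v R * (c₁ R * d₁ R))
      ≡⟨ cong (λ x → 1ℚ * Σᵥ (λ R → pow v R * (c₀ R * d₀ R)) + x) (trans (sym (wsum-* v (λ R → pow v R * (c₁ R * d₁ R)))) (trans (wsum-cong {N = N} (λ R → sym (ℚ.*-assoc v (pow v R) (c₁ R * d₁ R)))) (sym (ℚ.*-identityˡ _)))) ⟩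
    1ℚ * Σᵥ (λ R → pow v R * (c₀ R * d₀ R)) + 1ℚ * Σᵥ (λ R → v * pow v R * (c₁ R * d₁ R)) ∎
    where
    open ≡-Reasoning
    c₀ c₁ d₀ d₁ : Vec Bool N → ℚ
    c₀ = c ∘ (false ∷_)
    c₁ = c ∘ (true ∷_)
    d₀ = d ∘ (false ∷_)
    d₁ = d ∘ (true ∷_)
    at : Bool → Vec Bool N → ℚ
    at s S = (ift c₀ S + ψ s * ift c₁ S) * (ift d₀ S + ψ s * ift d₁ S)
    step : ∀ p a b c d → (1ℚ - p) * ((a + (- p) * b) * (c + (- p) * d)) + p * ((a + (1ℚ - p) * b) * (c + (1ℚ - p) * d)) ≡ 1ℚ * (a * c) + p * (1ℚ - p) * (b * d)
    step = solve-∀ ring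

  ft-∅ : ∀ {N} (f : Vec Bool N → ℚ) → ft f ∅ ≡ 𝔼 f
  ft-∅ {zero} f = refl
  ft-∅ {suc N} f = trans (ft-∅ {N} _) (wsum-lin (1ℚ - p) p (f ∘ (false ∷_)) (f ∘ (true ∷_)))

  -- For given R the factor `κ h Y R` vanishes unless Y = R ∩ h, where only the powers of -q from
  -- the coordinates of R off `h` remain.
  Σ-κ : ∀ {N} (G : Vec Bool N → ℚ) h R → Σᵥ (λ Y → G Y * κ h Y R) ≡ G (R ∩ h) * pow (- q) (R ∩ ∁ h)
  Σ-κ G [] [] = refl
  Σ-κ G (h ∷ hs) (r ∷ R) = trans (cong₂ (λ a b → 1ℚ * a + 1ℚ * b) (half false) (half true)) (step h r)
    where
    half : ∀ y → Σᵥ (λ Y → G (y ∷ Y) * (κ₁ h y r * κ hs Y R)) ≡ κ₁ h y r * (G (y ∷ (R ∩ hs)) * pow (- q) (R ∩ ∁ hs))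
    half y = trans (wsum-cong (λ Y → *-swap (G (y ∷ Y)) (κ₁ h y r) (κ hs Y R)))
      (trans (wsum-* (κ₁ h y r) (λ Y → G (y ∷ Y) * κ hs Y R)) (cong (κ₁ h y r *_) (Σ-κ (λ Y → G (y ∷ Y)) hs R)))
    g : Bool → ℚ
    g y = G (y ∷ (R ∩ hs))
    u = pow (- q) (R ∩ ∁ hs)
    z₀ : ∀ a b u → 1ℚ * (1ℚ * (a * u)) + 1ℚ * (0ℚ * (b * u)) ≡ a * u
    z₀ = solve-∀ ring
    z₁ : ∀ a b u → 1ℚ * (0ℚ * (a * u)) + 1ℚ * (1ℚ * (b * u)) ≡ b * u
    z₁ = solve-∀ ring
    z₂ : ∀ q a b u → 1ℚ * ((- q) * (a * u)) + 1ℚ * (0ℚ * (b * u)) ≡ a * (- q * u)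
    z₂ = solve-∀ ring
    step : ∀ h r → 1ℚ * (κ₁ h false r * (g false * u)) + 1ℚ * (κ₁ h true r * (g true * u)) ≡ G ((r ∧ h) ∷ (R ∩ hs)) * pow (- q) ((r ∧ not h) ∷ (R ∩ ∁ hs))
    step true true = z₁ (g false) (g true) u
    step true false = z₀ (g false) (g true) u
    step false true = z₂ q (g false) (g true) u
    step false false = z₀ (g false) (g true) u

  W : ∀ {N} → (Vec Bool N → ℚ) → Vec Bool N → ℚ
  W f R = pow v R * (ft f R * ft f R)

  Σ-op : ∀ {N} (f : Vec Bool N → ℚ) (h : Vec Bool N) → (∀ Y S → f S * op h Y f S ≡ 0ℚ) → (G : Vec Bool N → ℚ) →
    Σᵥ (λ R → pow (- q) R * G (R ∩ h) * W f R) ≡ 0ℚ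
  Σ-op {N} f h f·op≡0 G = begin
    Σᵥ (λ R → pow (- q) R * G (R ∩ h) * W f R)
      ≡⟨ wsum-cong (λ R → trans (cong (λ x → x * G (R ∩ h) * W f R) (sym (pow-split (- q) h R))) (trans (z (pow (- q) (R ∩ h)) (pow (- q) (R ∩ ∁ h)) (G (R ∩ h)) (W f R)) (trans (cong (W f R *_) (sym (Σ-κ Ĝ h R))) (sym (wsum-* (W f R) (λ Y → Ĝ Y * κ h Y R)))))) ⟩
    Σᵥ (λ R → Σᵥ (λ Y → W f R * (Ĝ Y * κ h Y R)))
      ≡⟨ wsum-swap (λ R Y → W f R * (Ĝ Y * κ h Y R)) ⟩
    Σᵥ (λ Y → Σᵥ (λ R → W f R * (Ĝ Y * κ h Y R)))
      ≡⟨ wsum-cong (λ Y → trans (wsum-cong (λ R → z′ (pow v R) (ft f R) (Ĝ Y) (κ h Y R))) (trans (wsum-* (Ĝ Y) (λ R → pow v R * (ft f R * (κ h Y R * ft f R)))) (cong (Ĝ Y *_) (orth Y)))) ⟩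
    Σᵥ {N} (λ Y → Ĝ Y * 0ℚ)
      ≡⟨ wsum-cong {N = N} (λ Y → ℚ.*-zeroʳ (Ĝ Y)) ⟩
    Σᵥ {N} (λ Y → 0ℚ)
      ≡⟨ wsum-0 {N = N} ⟩
    0ℚ ∎
    where
    open ≡-Reasoning
    -- The extra (-q)^|Y| completes the power of -q taken off `h` to (-q)^|R|, which no longer
    -- depends on `h`. The average over functionals then acts on G alone.
    Ĝ : _ → ℚ
    Ĝ Y = pow (- q) Y * G Y
    z : ∀ a b g w → a * b * g * w ≡ w * (a * g * b)
    z = solve-∀ ring
    z′ : ∀ v f g k → v * (f * f) * (g * k) ≡ g * (v * (f * (k * f)))
    z′ = solve-∀ ring
    orth : ∀ Y → Σᵥ (λ R → pow v R * (ft f R * (κ h Y R * ft f R))) ≡ 0ℚ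
    orth Y = trans (sym (parseval (ft f) (λ R → κ h Y R * ft f R)))
      (trans (wsum-cong (λ S → trans (cong (_* op h Y f S) (ft-inv f S)) (f·op≡0 Y S))) (wsum-0 {N = N}))

-- Random linear functionals

search : ∀ {N} (b : Vec Bool N → Bool) → (∃ λ x → b x ≡ true) ⊎ (∀ x → b x ≡ false)
search {zero} b with b [] in e
... | true = inj₁ ([] , e)
... | false = inj₂ λ { [] → e }
search {suc N} b with search (b ∘ (false ∷_)) | search (b ∘ (true ∷_))
... | inj₁ (x , e) | _ = inj₁ (false ∷ x , e)
... | inj₂ _ | inj₁ (x , e) = inj₁ (true ∷ x , e)
... | inj₂ e₀ | inj₂ e₁ = inj₂ λ { (false ∷ x) → e₀ x ; (true ∷ x) → e₁ x }

⊕-comm : ∀ {n} (x y : Point n) → x ⊕ y ≡ y ⊕ x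
⊕-comm [] [] = refl
⊕-comm (a ∷ x) (b ∷ y) = cong₂ _∷_ (Bool.xor-comm a b) (⊕-comm x y)

⊕-assoc : ∀ {n} (x y z : Point n) → (x ⊕ y) ⊕ z ≡ x ⊕ (y ⊕ z)
⊕-assoc [] [] [] = refl
⊕-assoc (a ∷ x) (b ∷ y) (c ∷ z) = cong₂ _∷_ (Bool.xor-assoc a b c) (⊕-assoc x y z)

⊕-identityˡ : ∀ {n} (x : Point n) → 0v ⊕ x ≡ x
⊕-identityˡ [] = refl
⊕-identityˡ (a ∷ x) = cong (a ∷_) (⊕-identityˡ x)

⊕-identityʳ : ∀ {n} (x : Point n) → x ⊕ 0v ≡ x
⊕-identityʳ x = trans (⊕-comm x 0v) (⊕-identityˡ x)

⊕-self : ∀ {n} (x : Point n) → x ⊕ x ≡ 0v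
⊕-self [] = refl
⊕-self (a ∷ x) = cong₂ _∷_ (Bool.xor-same a) (⊕-self x)

⊕≡0⇒≡ : ∀ {n} (x y : Point n) → x ⊕ y ≡ 0v → x ≡ y
⊕≡0⇒≡ x y e = begin
  x ≡⟨ ⊕-identityʳ x ⟨
  x ⊕ 0v ≡⟨ cong (x ⊕_) (⊕-self y) ⟨
  x ⊕ (y ⊕ y) ≡⟨ ⊕-assoc x y y ⟨
  (x ⊕ y) ⊕ y ≡⟨ cong (_⊕ y) e ⟩
  0v ⊕ y ≡⟨ ⊕-identityˡ y ⟩
  y ∎
  where open ≡-Reasoning

dot : ∀ {n} → Point n → Point n → Bool
dot [] [] = false
dot (a ∷ w) (b ∷ x) = (a ∧ b) xor dot w x

xor-interchange : ∀ a b c d → (a xor b) xor (c xor d) ≡ (a xor c) xor (b xor d)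
xor-interchange a b c d = trans (Bool.xor-assoc a b (c xor d)) (trans (cong (a xor_) swap) (sym (Bool.xor-assoc a c (b xor d))))
  where
  swap : b xor (c xor d) ≡ c xor (b xor d)
  swap = trans (sym (Bool.xor-assoc b c d)) (trans (cong (_xor d) (Bool.xor-comm b c)) (Bool.xor-assoc c b d))

dot-⊕ʳ : ∀ {n} (w x y : Point n) → dot w (x ⊕ y) ≡ dot w x xor dot w y
dot-⊕ʳ [] [] [] = refl
dot-⊕ʳ (a ∷ w) (b ∷ x) (c ∷ y) = trans (cong₂ _xor_ (Bool.∧-distribˡ-xor a b c) (dot-⊕ʳ w x y)) (xor-interchange (a ∧ b) (a ∧ c) (dot w x) (dot w y))

dot-comm : ∀ {n} (w x : Point n) → dot w x ≡ dot x w
dot-comm [] [] = refl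
dot-comm (a ∷ w) (b ∷ x) = cong₂ _xor_ (Bool.∧-comm a b) (dot-comm w x)

dot-⊕ˡ : ∀ {n} (w w′ x : Point n) → dot (w ⊕ w′) x ≡ dot w x xor dot w′ x
dot-⊕ˡ w w′ x = trans (dot-comm (w ⊕ w′) x) (trans (dot-⊕ʳ x w w′) (cong₂ _xor_ (dot-comm x w) (dot-comm x w′)))

dot-0 : ∀ {n} (w : Point n) → dot w 0v ≡ false
dot-0 [] = refl
dot-0 (true ∷ w) = dot-0 w
dot-0 (false ∷ w) = dot-0 w

dot-true⇒≢0 : ∀ {n} {w x : Point n} → dot w x ≡ true → x ≢ 0v
dot-true⇒≢0 {w = w} e refl with () ← trans (sym e) (dot-0 w)

𝔼ᵤ : ∀ {n} → (Vec Bool n → ℚ) → ℚ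
𝔼ᵤ = wsum ½ ½

𝔼ᵤ-mono : ∀ {n} {f g : Vec Bool n → ℚ} → (∀ w → f w ≤ℚ g w) → 𝔼ᵤ f ≤ℚ 𝔼ᵤ g
𝔼ᵤ-mono = wsum-mono (nonneg ½) (nonneg ½)

sg : Bool → ℚ
sg false = 1ℚ
sg true = - 1ℚ

sg-xor : ∀ a b → sg (a xor b) ≡ sg a * sg b
sg-xor false b = sym (ℚ.*-identityˡ (sg b))
sg-xor true false = refl
sg-xor true true = refl

𝔼-char : ∀ {n} (x : Point n) → x ≢ 0v → 𝔼ᵤ (λ w → sg (dot w x)) ≡ 0ℚ
𝔼-char [] x≢0 = ⊥-elim (x≢0 refl)
𝔼-char (false ∷ x) x≢0 = cong (λ e → ½ * e + ½ * e) (𝔼-char x (x≢0 ∘ cong (false ∷_)))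
𝔼-char (true ∷ x) x≢0 = trans
  (cong (λ e → ½ * 𝔼ᵤ (λ w → sg (dot w x)) + ½ * e) (trans (wsum-cong (λ w → sg-xor true (dot w x))) (wsum-* (- 1ℚ) (λ w → sg (dot w x)))))
  (cancel (𝔼ᵤ (λ w → sg (dot w x))))
  where
  cancel : ∀ e → ½ * e + ½ * (- 1ℚ * e) ≡ 0ℚ
  cancel = solve-∀ ring

-- The coefficient of `v` is tried with both values, so no coefficient vector has to be named. The
-- recursion is the one by which `uncorrelated` splits off one bit and is left with the characters
-- of `u` and `u ⊕ v`.
∉span : ∀ {n k} → Point n → Vec (Point n) k → Set
∉span u [] = u ≢ 0v
∉span u (v ∷ vs) = ∉span u vs × ∉span (u ⊕ v) vs

Indep : ∀ {n k} → Vec (Point n) k → Set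
Indep [] = ⊤
Indep (v ∷ vs) = ∉span v vs × Indep vs

split-bit : ∀ (Φ : Bool → ℚ) b → Φ b ≡ ½ * (Φ false + Φ true) + sg b * (½ * (Φ false - Φ true))
split-bit Φ false = step (Φ false) (Φ true)
  where
  step : ∀ s t → s ≡ ½ * (s + t) + 1ℚ * (½ * (s - t))
  step = solve-∀ ring
split-bit Φ true = step (Φ false) (Φ true)
  where
  step : ∀ s t → t ≡ ½ * (s + t) + - 1ℚ * (½ * (s - t))
  step = solve-∀ ring

module _ {n : ℕ} where

  dots : ∀ {k} → Point n → Vec (Point n) k → Vec Bool k
  dots w = map (dot w)

  mean⁺ mean⁻ : ∀ {k} → (Vec Bool (suc k) → ℚ) → Vec Bool k → ℚ
  mean⁺ Φ bs = ½ * (Φ (false ∷ bs) + Φ (true ∷ bs))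
  mean⁻ Φ bs = ½ * (Φ (false ∷ bs) - Φ (true ∷ bs))

  uncorrelated : ∀ {k} (u : Point n) (vs : Vec (Point n) k) → ∉span u vs → (Φ : Vec Bool k → ℚ) →
    𝔼ᵤ (λ w → sg (dot w u) * Φ (dots w vs)) ≡ 0ℚ
  uncorrelated u [] u≢0 Φ = trans (wsum-cong (λ w → ℚ.*-comm (sg (dot w u)) (Φ []))) (trans (wsum-* (Φ []) (λ w → sg (dot w u))) (trans (cong (Φ [] *_) (𝔼-char u u≢0)) (ℚ.*-zeroʳ (Φ []))))
  uncorrelated u (v ∷ vs) (a , b) Φ = begin
    𝔼ᵤ (λ w → sg (dot w u) * Φ (dots w (v ∷ vs)))
      ≡⟨ wsum-cong (λ w → trans (cong (sg (dot w u) *_) (split-bit (λ b → Φ (b ∷ dots w vs)) (dot w v)))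
           (trans (step (sg (dot w u)) (sg (dot w v)) (Φ⁺ (dots w vs)) (Φ⁻ (dots w vs)))
                  (cong (λ x → sg (dot w u) * Φ⁺ (dots w vs) + x * Φ⁻ (dots w vs)) (sym (trans (cong sg (dot-⊕ʳ w u v)) (sg-xor (dot w u) (dot w v))))))) ⟩
    𝔼ᵤ (λ w → sg (dot w u) * Φ⁺ (dots w vs) + sg (dot w (u ⊕ v)) * Φ⁻ (dots w vs))
      ≡⟨ wsum-+ (λ w → sg (dot w u) * Φ⁺ (dots w vs)) (λ w → sg (dot w (u ⊕ v)) * Φ⁻ (dots w vs)) ⟩
    _
      ≡⟨ cong₂ _+_ (uncorrelated u vs a Φ⁺) (uncorrelated (u ⊕ v) vs b Φ⁻) ⟩
    0ℚ ∎
    where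
    open ≡-Reasoning
    Φ⁺ = mean⁺ Φ
    Φ⁻ = mean⁻ Φ
    step : ∀ a b s t → a * (s + b * t) ≡ a * s + (a * b) * t
    step = solve-∀ ring

  uniform : ∀ {k} (vs : Vec (Point n) k) → Indep vs → (Φ : Vec Bool k → ℚ) → 𝔼ᵤ (λ w → Φ (dots w vs)) ≡ 𝔼ᵤ Φ
  uniform [] _ Φ = wsum-const {N = n} refl (Φ [])
  uniform {suc k} (v ∷ vs) (a , i) Φ = begin
    𝔼ᵤ (λ w → Φ (dots w (v ∷ vs)))
      ≡⟨ wsum-cong (λ w → split-bit (λ b → Φ (b ∷ dots w vs)) (dot w v)) ⟩
    𝔼ᵤ (λ w → Φ⁺ (dots w vs) + sg (dot w v) * Φ⁻ (dots w vs))
      ≡⟨ wsum-+ (λ w → Φ⁺ (dots w vs)) (λ w → sg (dot w v) * Φ⁻ (dots w vs)) ⟩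
    _
      ≡⟨ cong₂ _+_ (uniform vs i Φ⁺) (uncorrelated v vs a Φ⁻) ⟩
    𝔼ᵤ Φ⁺ + 0ℚ
      ≡⟨ ℚ.+-identityʳ _ ⟩
    𝔼ᵤ Φ⁺
      ≡⟨ trans (wsum-* {N = k} ½ _) (trans (cong (½ *_) (wsum-+ {N = k} (Φ ∘ (false ∷_)) (Φ ∘ (true ∷_)))) (ℚ.*-distribˡ-+ ½ (𝔼ᵤ (Φ ∘ (false ∷_))) (𝔼ᵤ (Φ ∘ (true ∷_))))) ⟩
    𝔼ᵤ Φ ∎
    where
    open ≡-Reasoning
    Φ⁺ = mean⁺ Φ
    Φ⁻ = mean⁻ Φ

shift : ∀ {n} (w₀ : Point n) (F : Point n → ℚ) → 𝔼ᵤ (λ w → F (w ⊕ w₀)) ≡ 𝔼ᵤ F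
shift [] F = refl
shift (false ∷ w₀) F = cong₂ (λ s t → ½ * s + ½ * t) (shift w₀ (F ∘ (false ∷_))) (shift w₀ (F ∘ (true ∷_)))
shift (true ∷ w₀) F = trans (cong₂ (λ s t → ½ * s + ½ * t) (shift w₀ (F ∘ (true ∷_))) (shift w₀ (F ∘ (false ∷_)))) (ℚ.+-comm (½ * 𝔼ᵤ (F ∘ (true ∷_))) (½ * 𝔼ᵤ (F ∘ (false ∷_))))

-- Translation by `w₀` preserves the uniform distribution, flips the bit of `x` and fixes Ψ. Pairing
-- `w` with `w ⊕ w₀` makes this bit a fair coin independent of everything else.
toggle : ∀ {n} {w₀ x : Point n} → dot w₀ x ≡ true → (Ψ : Bool → Point n → ℚ) → (∀ b w → Ψ b (w ⊕ w₀) ≡ Ψ b w) →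
  𝔼ᵤ (λ w → Ψ (dot w x) w) ≡ 𝔼ᵤ (λ w → ½ * (Ψ false w + Ψ true w))
toggle {n} {w₀} {x} e Ψ inv = begin
  𝔼ᵤ F ≡⟨ halves (𝔼ᵤ F) ⟩
  ½ * 𝔼ᵤ F + ½ * 𝔼ᵤ F ≡⟨ cong (λ s → ½ * 𝔼ᵤ F + ½ * s) (shift w₀ F) ⟨
  ½ * 𝔼ᵤ F + ½ * 𝔼ᵤ (λ w → F (w ⊕ w₀)) ≡⟨ wsum-lin ½ ½ F (λ w → F (w ⊕ w₀)) ⟨
  𝔼ᵤ (λ w → ½ * F w + ½ * F (w ⊕ w₀)) ≡⟨ wsum-cong both ⟩
  𝔼ᵤ (λ w → ½ * (Ψ false w + Ψ true w)) ∎
  where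
  open ≡-Reasoning
  F : Point n → ℚ
  F w = Ψ (dot w x) w
  halves : ∀ e → e ≡ ½ * e + ½ * e
  halves = solve-∀ ring
  z₀ : ∀ s t → ½ * s + ½ * t ≡ ½ * (s + t)
  z₀ = solve-∀ ring
  z₁ : ∀ s t → ½ * t + ½ * s ≡ ½ * (s + t)
  z₁ = solve-∀ ring
  F-shift : ∀ w → F (w ⊕ w₀) ≡ Ψ (not (dot w x)) w
  F-shift w = trans (inv (dot (w ⊕ w₀) x) w) (cong (λ b → Ψ b w) (trans (dot-⊕ˡ w w₀ x) (trans (cong (dot w x xor_) e) (Bool.xor-comm (dot w x) true))))
  both : ∀ w → ½ * F w + ½ * F (w ⊕ w₀) ≡ ½ * (Ψ false w + Ψ true w)
  both w rewrite F-shift w with dot w x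
  ... | false = z₀ (Ψ false w) (Ψ true w)
  ... | true = z₁ (Ψ false w) (Ψ true w)

ι : ℕ → ℚ
ι zero = 0ℚ
ι (suc k) = 1ℚ + ι k

ι-nonneg : ∀ k → 0ℚ ≤ℚ ι k
ι-nonneg zero = nonneg 0ℚ
ι-nonneg (suc k) = nonneg 1ℚ ⊞ ι-nonneg k

hits : ∀ {n} → Point n → List (Point n) → List (Point n)
hits w = filterᵇ (dot w)

cnt : ∀ {n} → Point n → List (Point n) → ℕ
cnt w xs = length (hits w xs)

ι-cnt : ∀ {n} (w x : Point n) xs → ι (cnt w (x ∷ xs)) ≡ 𝟙 (dot w x) + ι (cnt w xs)
ι-cnt w x xs with dot w x
... | true = refl
... | false = sym (ℚ.+-identityˡ _)

Good : ∀ {n} → List (Point n) → Set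
Good xs = All (_≢ 0v) xs × Unique xs

module _ {n : ℕ} where

  𝔼-bit : (x : Point n) → x ≢ 0v → 𝔼ᵤ (λ w → 𝟙 (dot w x)) ≡ ½
  𝔼-bit x x≢0 = uniform (x ∷ []) (x≢0 , tt) (λ { (b ∷ []) → 𝟙 b })

  distinct⇒indep : (x y : Point n) → x ≢ 0v → y ≢ 0v → x ≢ y → Indep (x ∷ y ∷ [])
  distinct⇒indep x y x≢0 y≢0 x≢y = (x≢0 , x≢y ∘ ⊕≡0⇒≡ x y) , y≢0 , tt

  𝔼-dots : (x y : Point n) → x ≢ 0v → y ≢ 0v → x ≢ y → 𝔼ᵤ (λ w → 𝟙 (dot w x) * 𝟙 (dot w y)) ≡ ½ * ½
  𝔼-dots x y x≢0 y≢0 x≢y = uniform (x ∷ y ∷ []) (distinct⇒indep x y x≢0 y≢0 x≢y) (λ { (a ∷ b ∷ []) → 𝟙 a * 𝟙 b })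

  𝔼-cnt : (xs : List (Point n)) → All (_≢ 0v) xs → 𝔼ᵤ (λ w → ι (cnt w xs)) ≡ ½ * ι (length xs)
  𝔼-cnt [] _ = wsum-0 {N = n}
  𝔼-cnt (x ∷ xs) (x≢0 ∷ a) = trans (wsum-cong (λ w → ι-cnt w x xs)) (trans (wsum-+ (λ w → 𝟙 (dot w x)) (λ w → ι (cnt w xs)))
    (trans (cong₂ _+_ (𝔼-bit x x≢0) (𝔼-cnt xs a)) (sym (ℚ.*-distribˡ-+ ½ 1ℚ (ι (length xs))))))

  𝔼-bit-cnt : (x : Point n) (xs : List (Point n)) → x ≢ 0v → All (_≢ 0v) xs → All (x ≢_) xs →
    𝔼ᵤ (λ w → 𝟙 (dot w x) * ι (cnt w xs)) ≡ ½ * ½ * ι (length xs)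
  𝔼-bit-cnt x [] x≢0 _ _ = trans (wsum-cong (λ w → ℚ.*-zeroʳ (𝟙 (dot w x)))) (wsum-0 {N = n})
  𝔼-bit-cnt x (y ∷ ys) x≢0 (y≢0 ∷ a) (x≢y ∷ b) = trans
    (wsum-cong (λ w → trans (cong (𝟙 (dot w x) *_) (ι-cnt w y ys)) (ℚ.*-distribˡ-+ (𝟙 (dot w x)) (𝟙 (dot w y)) (ι (cnt w ys)))))
    (trans (wsum-+ (λ w → 𝟙 (dot w x) * 𝟙 (dot w y)) (λ w → 𝟙 (dot w x) * ι (cnt w ys)))
    (trans (cong₂ _+_ (𝔼-dots x y x≢0 y≢0 x≢y) (𝔼-bit-cnt x ys x≢0 a b)) (sym (ℚ.*-distribˡ-+ (½ * ½) 1ℚ (ι (length ys))))))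

  𝔼-cnt² : (xs : List (Point n)) → Good xs → 𝔼ᵤ (λ w → ι (cnt w xs) * ι (cnt w xs)) ≡ ½ * ½ * (ι (length xs) * (1ℚ + ι (length xs)))
  𝔼-cnt² [] _ = wsum-0 {N = n}
  𝔼-cnt² (x ∷ xs) (x≢0 ∷ a , x∉xs ∷ uniq) = begin
    𝔼ᵤ (λ w → ι (cnt w (x ∷ xs)) * ι (cnt w (x ∷ xs)))
      ≡⟨ wsum-cong (λ w → trans (cong (λ k → k * k) (ι-cnt w x xs)) (trans (sq (𝟙 (dot w x)) (ι (cnt w xs)))
           (cong (λ s → 1ℚ * (s + (1ℚ + 1ℚ) * (𝟙 (dot w x) * ι (cnt w xs))) + 1ℚ * (ι (cnt w xs) * ι (cnt w xs))) (𝟙-idem (dot w x))))) ⟩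
    𝔼ᵤ (λ w → 1ℚ * (𝟙 (dot w x) + (1ℚ + 1ℚ) * (𝟙 (dot w x) * ι (cnt w xs))) + 1ℚ * (ι (cnt w xs) * ι (cnt w xs)))
      ≡⟨ wsum-lin 1ℚ 1ℚ (λ w → 𝟙 (dot w x) + (1ℚ + 1ℚ) * (𝟙 (dot w x) * ι (cnt w xs))) (λ w → ι (cnt w xs) * ι (cnt w xs)) ⟩
    1ℚ * 𝔼ᵤ (λ w → 𝟙 (dot w x) + (1ℚ + 1ℚ) * (𝟙 (dot w x) * ι (cnt w xs))) + 1ℚ * 𝔼ᵤ (λ w → ι (cnt w xs) * ι (cnt w xs))
      ≡⟨ cong₂ (λ s t → 1ℚ * s + 1ℚ * t)
           (trans (wsum-+ (λ w → 𝟙 (dot w x)) (λ w → (1ℚ + 1ℚ) * (𝟙 (dot w x) * ι (cnt w xs)))) (cong₂ _+_ (𝔼-bit x x≢0)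
              (trans (wsum-* (1ℚ + 1ℚ) (λ w → 𝟙 (dot w x) * ι (cnt w xs))) (cong ((1ℚ + 1ℚ) *_) (𝔼-bit-cnt x xs x≢0 a x∉xs)))))
           (𝔼-cnt² xs (a , uniq)) ⟩
    1ℚ * (½ + (1ℚ + 1ℚ) * (½ * ½ * m)) + 1ℚ * (½ * ½ * (m * (1ℚ + m)))
      ≡⟨ fin m ⟩
    ½ * ½ * ((1ℚ + m) * (1ℚ + (1ℚ + m))) ∎
    where
    open ≡-Reasoning
    m = ι (length xs)
    sq : ∀ b c → (b + c) * (b + c) ≡ 1ℚ * (b * b + (1ℚ + 1ℚ) * (b * c)) + 1ℚ * (c * c)
    sq = solve-∀ ring
    fin : ∀ m → 1ℚ * (½ + (1ℚ + 1ℚ) * (½ * ½ * m)) + 1ℚ * (½ * ½ * (m * (1ℚ + m))) ≡ ½ * ½ * ((1ℚ + m) * (1ℚ + (1ℚ + m)))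
    fin = solve-∀ ring

  -- Pairwise independence of the bits dot w x determines the first two moments of cnt.
  𝔼-quadratic : (xs : List (Point n)) → Good xs → ∀ α β δ →
    𝔼ᵤ (λ w → α + β * ι (cnt w xs) + δ * (ι (cnt w xs) * ι (cnt w xs))) ≡ α + β * (½ * ι (length xs)) + δ * (½ * ½ * (ι (length xs) * (1ℚ + ι (length xs))))
  𝔼-quadratic xs good@(nz , _) α β δ = trans
    (wsum-+ (λ w → α + β * ι (cnt w xs)) (λ w → δ * (ι (cnt w xs) * ι (cnt w xs))))
    (cong₂ _+_ (trans (wsum-+ (λ _ → α) (λ w → β * ι (cnt w xs))) (cong₂ _+_ (wsum-const {N = n} refl α) (trans (wsum-* β (λ w → ι (cnt w xs))) (cong (β *_) (𝔼-cnt xs nz)))))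
      (trans (wsum-* δ (λ w → ι (cnt w xs) * ι (cnt w xs))) (cong (δ *_) (𝔼-cnt² xs good))))

dec≤ : ∀ a b {_ : True (a ℚ.≤? b)} → a ≤ℚ b
dec≤ a b {t} = toWitness t

quad : ℚ → ℚ → ℚ → ℕ → ℚ
quad α β δ k = α + β * ι k + δ * (ι k * ι k)

add : Bool → ℕ → ℕ
add true k = suc k
add false k = k

-- The coefficient profile and isolated vectors

is0 : ∀ {n} → Point n → Bool
is0 [] = true
is0 (true ∷ x) = false
is0 (false ∷ x) = is0 x

is0-sound : ∀ {n} (x : Point n) → is0 x ≡ true → x ≡ 0v
is0-sound [] _ = refl
is0-sound (false ∷ x) e = cong (false ∷_) (is0-sound x e)

is0-0v : ∀ {n} → is0 (0v {n}) ≡ true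
is0-0v {zero} = refl
is0-0v {suc n} = is0-0v {n}

is0-false : ∀ {n} {x : Point n} → is0 x ≡ false → x ≢ 0v
is0-false {n} e refl with () ← trans (sym e) (is0-0v {n})

≢0⇒is0-false : ∀ {n} {x : Point n} → x ≢ 0v → is0 x ≡ false
≢0⇒is0-false {x = x} x≢0 with is0 x in e
... | true = ⊥-elim (x≢0 (is0-sound x e))
... | false = refl

total : ∀ {n} → List (Point n) → Point n
total [] = 0v
total (x ∷ xs) = x ⊕ total xs

-- Size alone does not suffice at four hits. Take the values of `Spectrum` at q = 1. If dependent
-- quadruples also received 5/8, the seven nonzero vectors of a 3-dimensional space, where every
-- nonzero functional hits such a quadruple, would rise from 7/8 to 91/64. If independent quadruples
-- received 0, four independent vectors would fall to -33/32.
γ : ∀ {n} → ℚ → ℚ → ℚ → ℚ → List (Point n) → ℚ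
γ D A B g [] = D
γ D A B g (_ ∷ []) = A
γ D A B g (_ ∷ _ ∷ []) = B
γ D A B g (_ ∷ _ ∷ _ ∷ []) = g
γ D A B g (a ∷ b ∷ c ∷ d ∷ []) = if is0 (total (a ∷ b ∷ c ∷ d ∷ [])) then 0ℚ else g
γ D A B g (_ ∷ _ ∷ _ ∷ _ ∷ _ ∷ _) = 0ℚ

Λ : ∀ {n} → ℚ → ℚ → ℚ → ℚ → List (Point n) → ℚ
Λ D A B g xs = 𝔼ᵤ (λ w → γ D A B g (hits w xs))

cnt-∷ : ∀ {n} (w x : Point n) xs → cnt w (x ∷ xs) ≡ add (dot w x) (cnt w xs)
cnt-∷ w x xs with dot w x
... | true = refl
... | false = refl

cnt-++ : ∀ {n} (w : Point n) xs ys → cnt w xs ≤ cnt w (xs ++ ys)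
cnt-++ w [] ys = z≤n
cnt-++ w (x ∷ xs) ys with dot w x
... | true = s≤s (cnt-++ w xs ys)
... | false = cnt-++ w xs ys

cnt≤length : ∀ {n} (w : Point n) xs → cnt w xs ≤ length xs
cnt≤length w = List.length-filter (Bool.T? ∘ dot w)

cnt-shift : ∀ {n} {w₀ : Point n} {xs} → All (λ x → dot w₀ x ≡ false) xs → ∀ w → cnt (w ⊕ w₀) xs ≡ cnt w xs
cnt-shift [] w = refl
cnt-shift {w₀ = w₀} {x ∷ xs} (e ∷ es) w rewrite cnt-∷ (w ⊕ w₀) x xs | cnt-∷ w x xs | dot-⊕ˡ w w₀ x | e | Bool.xor-comm (dot w x) false =
  cong (add (dot w x)) (cnt-shift es w)

filterᵇ-All : ∀ {A : Set} {P : A → Set} (f : A → Bool) {xs} → All P xs → All P (filterᵇ f xs)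
filterᵇ-All f = All.filter⁺ (Bool.T? ∘ f)

filterᵇ-Unique : ∀ {A : Set} (f : A → Bool) {xs : List A} → Unique xs → Unique (filterᵇ f xs)
filterᵇ-Unique f = Unique.filter⁺ (Bool.T? ∘ f)

filterᵇ-true : ∀ {A : Set} (f : A → Bool) xs → All (λ x → f x ≡ true) (filterᵇ f xs)
filterᵇ-true f [] = []
filterᵇ-true f (x ∷ xs) with f x in e
... | true = e ∷ filterᵇ-true f xs
... | false = filterᵇ-true f xs

Unique-++ˡ : ∀ {A : Set} (xs : List A) {ys} → Unique (xs ++ ys) → Unique xs
Unique-++ˡ [] _ = []
Unique-++ˡ (x ∷ xs) (p ∷ ps) = All.++⁻ˡ xs p ∷ Unique-++ˡ xs ps

Good-++ˡ : ∀ {n} (xs : List (Point n)) {ys} → Good (xs ++ ys) → Good xs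
Good-++ˡ xs (nz , u) = All.++⁻ˡ xs nz , Unique-++ˡ xs u

cnt≡0 : ∀ {n} (w : Point n) xs → cnt w xs ≡ 0 → All (λ x → dot w x ≡ false) xs
cnt≡0 w [] _ = []
cnt≡0 w (x ∷ xs) e with dot w x in d
... | false = d ∷ cnt≡0 w xs e

data Even : ℕ → Set where
  zero : Even 0
  2+_ : ∀ {k} → Even k → Even (suc (suc k))

even? : ∀ k → Even k ⊎ Even (suc k)
even? zero = inj₁ zero
even? (suc k) with even? k
... | inj₁ e = inj₂ (2+ e)
... | inj₂ e = inj₁ e

dot-total : ∀ {n} (w : Point n) xs → cnt w xs ≡ 1 → dot w (total xs) ≡ true
dot-total w (x ∷ xs) e with dot w x in d
... | true = trans (dot-⊕ʳ w x (total xs)) (trans (cong₂ _xor_ d (none xs (cnt≡0 w xs (ℕ.suc-injective e)))) refl)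
  where
  none : ∀ ys → All (λ y → dot w y ≡ false) ys → dot w (total ys) ≡ false
  none [] _ = dot-0 w
  none (y ∷ ys) (p ∷ ps) = trans (dot-⊕ʳ w y (total ys)) (cong₂ _xor_ p (none ys ps))
... | false = trans (dot-⊕ʳ w x (total xs)) (cong₂ _xor_ d (dot-total w xs e))

-- Since `w` is 1 on `point` and 0 on `others`, the point lies outside their span: it is a coloop of
-- the binary matroid of `xs`. The last fields transport what does not depend on the order of the
-- list, so the coloop may be moved to the front.
record Isolated {n} (w : Point n) (xs : List (Point n)) : Set₁ where
  field
    point : Point n
    others : List (Point n)
    hit : dot w point ≡ true
    miss : All (λ y → dot w y ≡ false) others
    len : length xs ≡ suc (length others)
    counts : ∀ w′ → cnt w′ xs ≡ cnt w′ (point ∷ others)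
    all : ∀ {P : Point n → Set} → All P xs → All P (point ∷ others)
    uniq : Unique xs → Unique (point ∷ others)

isolate : ∀ {n} (w : Point n) xs → cnt w xs ≡ 1 → Isolated w xs
isolate w (x ∷ xs) e with dot w x in d
... | true = record { point = x ; others = xs ; hit = d ; miss = cnt≡0 w xs (ℕ.suc-injective e) ; len = refl ; counts = λ _ → refl ; all = id ; uniq = id }
... | false = record
  { point = I.point ; others = x ∷ I.others ; hit = I.hit ; miss = d ∷ I.miss ; len = cong suc I.len
  ; counts = counts′ ; all = λ { (p ∷ ps) → swap p (I.all ps) } ; uniq = λ { (p ∷ ps) → swapᵤ (I.all p) (I.uniq ps) } }
  where
  module I = Isolated (isolate w xs e)
  swap : ∀ {P : Point _ → Set} → P x → All P (I.point ∷ I.others) → All P (I.point ∷ x ∷ I.others)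
  swap p (p′ ∷ ps) = p′ ∷ p ∷ ps
  swapᵤ : All (x ≢_) (I.point ∷ I.others) → Unique (I.point ∷ I.others) → Unique (I.point ∷ x ∷ I.others)
  swapᵤ (a ∷ as) (b ∷ bs) = ((λ e → a (sym e)) ∷ b) ∷ as ∷ bs
  add-comm : ∀ a b k → add a (add b k) ≡ add b (add a k)
  add-comm true true k = refl
  add-comm true false k = refl
  add-comm false true k = refl
  add-comm false false k = refl
  counts′ : ∀ w′ → cnt w′ (x ∷ xs) ≡ cnt w′ (I.point ∷ x ∷ I.others)
  counts′ w′ rewrite cnt-∷ w′ x xs | I.counts w′ | cnt-∷ w′ I.point I.others | cnt-∷ w′ I.point (x ∷ I.others) | cnt-∷ w′ x I.others =
    add-comm (dot w′ x) (dot w′ I.point) (cnt w′ I.others)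

sel : ∀ {A : Set} {k} → Vec Bool k → Vec A k → List A
sel [] [] = []
sel (true ∷ bs) (x ∷ xs) = x ∷ sel bs xs
sel (false ∷ bs) (x ∷ xs) = sel bs xs

filterᵇ-sel : ∀ {A : Set} {k} (f : A → Bool) (xs : Vec A k) → filterᵇ f (toList xs) ≡ sel (map f xs) xs
filterᵇ-sel f [] = refl
filterᵇ-sel f (x ∷ xs) with f x
... | true = cong (x ∷_) (filterᵇ-sel f xs)
... | false = filterᵇ-sel f xs

module _ {n : ℕ} (D A B g : ℚ) where

  Λ-indep : ∀ {k} (xs : Vec (Point n) k) → Indep xs → Λ D A B g (toList xs) ≡ 𝔼ᵤ (λ bs → γ D A B g (sel bs xs))
  Λ-indep xs ind = trans (wsum-cong (λ w → cong (γ D A B g) (filterᵇ-sel (dot w) xs))) (uniform xs ind (λ bs → γ D A B g (sel bs xs)))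

  Λ-[] : Λ {n} D A B g [] ≡ D
  Λ-[] = wsum-const {N = n} refl D

  Λ-single : ∀ (x : Point n) → x ≢ 0v → Λ D A B g (x ∷ []) ≡ ½ * (D + A)
  Λ-single x x≢0 = trans (Λ-indep (x ∷ []) (x≢0 , tt)) (sym (ℚ.*-distribˡ-+ ½ D A))

  Λ-pair : ∀ (x y : Point n) → Good (x ∷ y ∷ []) → Λ D A B g (x ∷ y ∷ []) ≡ ½ * ½ * (D + (1ℚ + 1ℚ) * A + B)
  Λ-pair x y (x≢0 ∷ y≢0 ∷ [] , (x≢y ∷ []) ∷ _) = trans (Λ-indep (x ∷ y ∷ []) (distinct⇒indep x y x≢0 y≢0 x≢y)) (fin D A B)
    where
    fin : ∀ D A B → ½ * (½ * D + ½ * A) + ½ * (½ * A + ½ * B) ≡ ½ * ½ * (D + (1ℚ + 1ℚ) * A + B)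
    fin = solve-∀ ring

  Λ-schur : ∀ (x y z : Point n) → Good (x ∷ y ∷ []) → z ≡ x ⊕ y → Λ D A B g (x ∷ y ∷ z ∷ []) ≡ ½ * ½ * (D + (1ℚ + 1ℚ + 1ℚ) * B)
  Λ-schur x y z (x≢0 ∷ y≢0 ∷ [] , (x≢y ∷ []) ∷ _) z≡ = trans (wsum-cong pick) (trans (uniform (x ∷ y ∷ []) (distinct⇒indep x y x≢0 y≢0 x≢y) Φ) (fin D B))
    where
    Φ : Vec Bool 2 → ℚ
    Φ (a ∷ b ∷ []) = γ D A B g (sel (a ∷ b ∷ (a xor b) ∷ []) (x ∷ y ∷ z ∷ []))
    pick : ∀ w → γ D A B g (hits w (x ∷ y ∷ z ∷ [])) ≡ Φ (dots w (x ∷ y ∷ []))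
    pick w = cong (γ D A B g) (trans (filterᵇ-sel (dot w) (x ∷ y ∷ z ∷ []))
      (cong (λ c → sel (dot w x ∷ dot w y ∷ c ∷ []) (x ∷ y ∷ z ∷ [])) (trans (cong (dot w) z≡) (dot-⊕ʳ w x y))))
    fin : ∀ D B → ½ * (½ * D + ½ * B) + ½ * (½ * B + ½ * B) ≡ ½ * ½ * (D + (1ℚ + 1ℚ + 1ℚ) * B)
    fin = solve-∀ ring

  Λ-indep₃ : ∀ (x y z : Point n) → Indep (x ∷ y ∷ z ∷ []) →
    Λ D A B g (x ∷ y ∷ z ∷ []) ≡ ½ * ½ * ½ * (D + (1ℚ + 1ℚ + 1ℚ) * A + (1ℚ + 1ℚ + 1ℚ) * B + g)
  Λ-indep₃ x y z ind = trans (Λ-indep (x ∷ y ∷ z ∷ []) ind) (fin D A B g)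
    where
    fin : ∀ D A B g → ½ * (½ * (½ * D + ½ * A) + ½ * (½ * A + ½ * B)) + ½ * (½ * (½ * A + ½ * B) + ½ * (½ * B + ½ * g))
      ≡ ½ * ½ * ½ * (D + (1ℚ + 1ℚ + 1ℚ) * A + (1ℚ + 1ℚ + 1ℚ) * B + g)
    fin = solve-∀ ring

-- Eigenvalue gaps

≡ᵇ-sound : ∀ m k → (m ℕ.≡ᵇ k) ≡ true → m ≡ k
≡ᵇ-sound m k e = ℕ.≡ᵇ⇒≡ m k (subst Bool.T (sym e) tt)

≡ᵇ-refuted : ∀ {m k} → (m ℕ.≡ᵇ k) ≡ false → m ≢ k
≡ᵇ-refuted {m} e refl = subst Bool.T e (ℕ.≡⇒≡ᵇ m m refl)

noneᵇ : ∀ {k} → Vec Bool k → Bool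
noneᵇ [] = true
noneᵇ (b ∷ bs) = not b ∧ noneᵇ bs

module _ {n : ℕ} where

  -- This is 2 to the power minus the rank of `xs`. No hit at all is the event carrying the large
  -- coefficient `D`, so upper bounds by quadratics get a separate term for it.
  P₀ : List (Point n) → ℚ
  P₀ xs = 𝔼ᵤ (λ w → 𝟙 (cnt w xs ℕ.≡ᵇ 0))

  P₀-indep : ∀ {k} xs (vs : Vec (Point n) k) → Indep vs → (∀ {P : Point n → Set} → All P xs → All P (toList vs)) →
    P₀ xs ≤ℚ 𝔼ᵤ (λ (bs : Vec Bool k) → 𝟙 (noneᵇ bs))
  P₀-indep xs vs ind incl = subst (P₀ xs ≤ℚ_) (uniform vs ind (λ bs → 𝟙 (noneᵇ bs))) (𝔼ᵤ-mono bound)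
    where
    none-dots : ∀ {k} w (us : Vec (Point n) k) → All (λ x → dot w x ≡ false) (toList us) → noneᵇ (dots w us) ≡ true
    none-dots w [] _ = refl
    none-dots w (u ∷ us) (e ∷ es) rewrite e = none-dots w us es
    bound : ∀ w → 𝟙 (cnt w xs ℕ.≡ᵇ 0) ≤ℚ 𝟙 (noneᵇ (dots w vs))
    bound w with cnt w xs ℕ.≡ᵇ 0 in e
    ... | false = 𝟙-nonneg (noneᵇ (dots w vs))
    ... | true rewrite none-dots w vs (incl (cnt≡0 w xs (≡ᵇ-sound (cnt w xs) 0 e))) = ℚ.≤-refl

  indep₃ : (a b c : Point n) → Good (a ∷ b ∷ c ∷ []) → (a ⊕ b) ⊕ c ≢ 0v → Indep (a ∷ b ∷ c ∷ [])
  indep₃ a b c (a≢0 ∷ b≢0 ∷ c≢0 ∷ [] , (a≢b ∷ a≢c ∷ []) ∷ (b≢c ∷ []) ∷ _) s =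
    ((a≢0 , a≢c ∘ ⊕≡0⇒≡ a c) , (a≢b ∘ ⊕≡0⇒≡ a b , s)) , distinct⇒indep b c b≢0 c≢0 b≢c

  odd-sum≢0 : ∀ {w : Point n} a b c → dot w a ≡ true → dot w b ≡ true → dot w c ≡ true → (a ⊕ b) ⊕ c ≢ 0v
  odd-sum≢0 {w} a b c da db dc = dot-true⇒≢0 {w = w} (trans (dot-⊕ʳ w (a ⊕ b) c) (cong₂ _xor_ (trans (dot-⊕ʳ w a b) (cong₂ _xor_ da db)) dc))

  -- Odd sums are nonzero because `w` is 1 on them, and sums of two because the vectors are
  -- distinct. Only the sum of all four is left to exclude.
  indep₄ : ∀ {w : Point n} {a b c d} → All (λ x → dot w x ≡ true) (a ∷ b ∷ c ∷ d ∷ []) → Unique (a ∷ b ∷ c ∷ d ∷ []) →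
    ((a ⊕ b) ⊕ c) ⊕ d ≢ 0v → Indep (a ∷ b ∷ c ∷ d ∷ [])
  indep₄ {w} {a} {b} {c} {d} (da ∷ db ∷ dc ∷ dd ∷ []) ((a≢b ∷ a≢c ∷ a≢d ∷ []) ∷ u) s =
    (((nz da , a≢d ∘ ⊕≡0⇒≡ a d) , (a≢c ∘ ⊕≡0⇒≡ a c , odd-sum≢0 {w} a c d da dc dd)) ,
     ((a≢b ∘ ⊕≡0⇒≡ a b , odd-sum≢0 {w} a b d da db dd) , (odd-sum≢0 {w} a b c da db dc , s))) ,
    indep₃ b c d (nz db ∷ nz dc ∷ nz dd ∷ [] , u) (odd-sum≢0 {w} b c d db dc dd)
    where
    nz : ∀ {x} → dot w x ≡ true → x ≢ 0v
    nz = dot-true⇒≢0 {w = w}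

  total₃ : ∀ (a b c : Point n) → total (a ∷ b ∷ c ∷ []) ≡ (a ⊕ b) ⊕ c
  total₃ a b c = trans (cong (λ x → a ⊕ (b ⊕ x)) (⊕-identityʳ c)) (sym (⊕-assoc a b c))

  total₄ : ∀ (a b c d : Point n) → total (a ∷ b ∷ c ∷ d ∷ []) ≡ ((a ⊕ b) ⊕ c) ⊕ d
  total₄ a b c d = trans (cong (a ⊕_) (total₃ b c d)) (trans (sym (⊕-assoc a (b ⊕ c) d)) (cong (_⊕ d) (sym (⊕-assoc a b c))))

  -- On a set X ⊆ {x : ⟨w,x⟩ = 1} this holds iff X contains four independent vectors.
  rank≥4 : List (Point n) → Bool
  rank≥4 (a ∷ b ∷ c ∷ d ∷ []) = not (is0 (total (a ∷ b ∷ c ∷ d ∷ [])))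
  rank≥4 (_ ∷ _ ∷ _ ∷ _ ∷ _ ∷ _) = true
  rank≥4 _ = false

  -- Among five distinct vectors on which `w` is 1 there are four independent ones: if a, b, c, d
  -- sum to zero then a, b, c, e do not, as d ≠ e.
  P₀-rank≥4 : ∀ w xs → Good xs → rank≥4 (hits w xs) ≡ true → P₀ xs ≤ℚ + 1 / 16
  P₀-rank≥4 w xs (nz , u) = go (hits w xs) (filterᵇ-true (dot w) xs) (filterᵇ-Unique (dot w) u) (filterᵇ-All (dot w))
    where
    go : ∀ X → All (λ x → dot w x ≡ true) X → Unique X → (∀ {P : Point n → Set} → All P xs → All P X) → rank≥4 X ≡ true → P₀ xs ≤ℚ + 1 / 16
    go (a ∷ b ∷ c ∷ d ∷ []) ds uX incl r with is0 (total (a ∷ b ∷ c ∷ d ∷ [])) in e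
    ... | false = P₀-indep xs (a ∷ b ∷ c ∷ d ∷ []) (indep₄ {w = w} ds uX (is0-false (trans (sym (cong is0 (total₄ a b c d))) e))) incl
    go (a ∷ b ∷ c ∷ d ∷ e ∷ X) (da ∷ db ∷ dc ∷ dd ∷ de ∷ _) ((a≢b ∷ a≢c ∷ a≢d ∷ a≢e ∷ _) ∷ (b≢c ∷ b≢d ∷ b≢e ∷ _) ∷ (c≢d ∷ c≢e ∷ _) ∷ (d≢e ∷ _) ∷ _) incl _
      with is0 (((a ⊕ b) ⊕ c) ⊕ d) in z
    ... | false = P₀-indep xs (a ∷ b ∷ c ∷ d ∷ []) (indep₄ {w = w} (da ∷ db ∷ dc ∷ dd ∷ [])
                    ((a≢b ∷ a≢c ∷ a≢d ∷ []) ∷ (b≢c ∷ b≢d ∷ []) ∷ (c≢d ∷ []) ∷ [] ∷ []) (is0-false z))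
                    (λ ps → All.++⁻ˡ (a ∷ b ∷ c ∷ d ∷ []) (incl ps))
    ... | true = P₀-indep xs (a ∷ b ∷ c ∷ e ∷ []) (indep₄ {w = w} (da ∷ db ∷ dc ∷ de ∷ [])
                    ((a≢b ∷ a≢c ∷ a≢e ∷ []) ∷ (b≢c ∷ b≢e ∷ []) ∷ (c≢e ∷ []) ∷ [] ∷ [])
                    (λ z′ → d≢e (trans (sym (⊕≡0⇒≡ _ d (is0-sound _ z))) (⊕≡0⇒≡ _ e z′))))
                    (λ ps → drop₄ (incl ps))
      where
      drop₄ : ∀ {P : Point n → Set} → All P (a ∷ b ∷ c ∷ d ∷ e ∷ X) → All P (a ∷ b ∷ c ∷ e ∷ [])
      drop₄ (pa ∷ pb ∷ pc ∷ _ ∷ pe ∷ _) = pa ∷ pb ∷ pc ∷ pe ∷ []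

  P₀≤⅛ : ∀ (a b c d : Point n) xs → Good (a ∷ b ∷ c ∷ d ∷ xs) → P₀ (a ∷ b ∷ c ∷ d ∷ xs) ≤ℚ + 1 / 8
  P₀≤⅛ a b c d xs (a≢0 ∷ b≢0 ∷ c≢0 ∷ d≢0 ∷ _ , (a≢b ∷ a≢c ∷ a≢d ∷ _) ∷ (b≢c ∷ b≢d ∷ _) ∷ (c≢d ∷ _) ∷ _) with is0 ((a ⊕ b) ⊕ c) in z
  ... | false = P₀-indep (a ∷ b ∷ c ∷ d ∷ xs) (a ∷ b ∷ c ∷ [])
                  (indep₃ a b c (a≢0 ∷ b≢0 ∷ c≢0 ∷ [] , (a≢b ∷ a≢c ∷ []) ∷ (b≢c ∷ []) ∷ [] ∷ []) (is0-false z))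
                  (All.++⁻ˡ (a ∷ b ∷ c ∷ []))
  ... | true = P₀-indep (a ∷ b ∷ c ∷ d ∷ xs) (a ∷ b ∷ d ∷ [])
                  (indep₃ a b d (a≢0 ∷ b≢0 ∷ d≢0 ∷ [] , (a≢b ∷ a≢d ∷ []) ∷ (b≢d ∷ []) ∷ [] ∷ [])
                    (λ z′ → c≢d (trans (sym (⊕≡0⇒≡ _ c (is0-sound _ z))) (⊕≡0⇒≡ _ d z′))))
                  (λ { (pa ∷ pb ∷ _ ∷ pd ∷ _) → pa ∷ pb ∷ pd ∷ [] })

  -- `ys` is kept apart from the set whose coefficient is `F`, because long sets are treated through
  -- the hits in a prefix of fixed length.
  quad-lower : ∀ α β δ (ys : List (Point n)) → Good ys → (F : Point n → ℚ) → (∀ w → quad α β δ (cnt w ys) ≤ℚ F w) →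
    α + β * (½ * ι (length ys)) + δ * (½ * ½ * (ι (length ys) * (1ℚ + ι (length ys)))) ≤ℚ 𝔼ᵤ F
  quad-lower α β δ ys good F Q≤F = subst (_≤ℚ 𝔼ᵤ F) (𝔼-quadratic ys good α β δ) (𝔼ᵤ-mono Q≤F)

  quad-upper : ∀ α β δ κ c (ys xs : List (Point n)) → Good ys → 0ℚ ≤ℚ κ → P₀ xs ≤ℚ c → (F : Point n → ℚ) →
    (∀ w → F w ≤ℚ quad α β δ (cnt w ys) + κ * 𝟙 (cnt w xs ℕ.≡ᵇ 0)) →
    𝔼ᵤ F ≤ℚ α + β * (½ * ι (length ys)) + δ * (½ * ½ * (ι (length ys) * (1ℚ + ι (length ys)))) + κ * c
  quad-upper α β δ κ c ys xs good 0≤κ P₀≤c F F≤Q = ℚ.≤-trans (𝔼ᵤ-mono F≤Q) (subst (_≤ℚ _)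
    (sym (trans (wsum-+ (λ w → quad α β δ (cnt w ys)) (λ w → κ * 𝟙 (cnt w xs ℕ.≡ᵇ 0))) (cong₂ _+_ (𝔼-quadratic ys good α β δ) (wsum-* κ (λ w → 𝟙 (cnt w xs ℕ.≡ᵇ 0))))))
    (ℚ.+-monoʳ-≤ (α + β * (½ * ι (length ys)) + δ * (½ * ½ * (ι (length ys) * (1ℚ + ι (length ys))))) (*-monoˡ 0≤κ P₀≤c)))

-- Four independent vectors at q = 1 give (D + 4A + 6B + 5g)/16 = -127/128.
ρ : ℚ
ρ = + 127 / 128

-- D, A, B are forced by requiring eigenvalue −q³ on singletons, pairs and Schur triples; the value 5/8 on
-- three vectors and on four independent ones is what separates the eigenvalues of all other sets from −q³.
module Spectrum {n : ℕ} (q : ℚ) (0≤q : 0ℚ ≤ℚ q) (q≤1 : q ≤ℚ 1ℚ) where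

  D A B g : ℚ
  D = 1ℚ + 3ℚ * q + 3ℚ * (q * q)
  A = - (1ℚ + 3ℚ * q + q * q)
  B = 1ℚ - q - q * q
  g = + 5 / 8

  Γ : List (Point n) → ℚ
  Γ = γ D A B g

  Λ̂ : List (Point n) → ℚ
  Λ̂ = Λ D A B g

  0≤1-q : 0ℚ ≤ℚ 1ℚ - q
  0≤1-q = diff q≤1

  0≤q² : 0ℚ ≤ℚ q * q
  0≤q² = 0≤q ⊠ 0≤q

  0≤D : 0ℚ ≤ℚ D
  0≤D = nonneg 1ℚ ⊞ nonneg 3ℚ ⊠ 0≤q ⊞ nonneg 3ℚ ⊠ 0≤q²

  -1≤B : - 1ℚ ≤ℚ B
  -1≤B = by-diff (0≤1-q ⊞ 0≤1-q ⊠ (nonneg 1ℚ ⊞ 0≤q)) (e q)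
    where
    e : ∀ q → 1ℚ - q - q * q - - 1ℚ ≡ (1ℚ - q) + (1ℚ - q) * (1ℚ + q)
    e = solve-∀ ring

  floor : ℕ → ℚ
  floor 0 = D
  floor 1 = A
  floor 2 = B
  floor _ = 0ℚ

  floor≤Γ : ∀ X → floor (length X) ≤ℚ Γ X
  floor≤Γ [] = ℚ.≤-refl
  floor≤Γ (_ ∷ []) = ℚ.≤-refl
  floor≤Γ (_ ∷ _ ∷ []) = ℚ.≤-refl
  floor≤Γ (_ ∷ _ ∷ _ ∷ []) = nonneg g
  floor≤Γ (a ∷ b ∷ c ∷ d ∷ []) with is0 (total (a ∷ b ∷ c ∷ d ∷ []))
  ... | true = ℚ.≤-refl
  ... | false = nonneg g
  floor≤Γ (_ ∷ _ ∷ _ ∷ _ ∷ _ ∷ _) = ℚ.≤-refl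

  nonpos-square : ∀ c x → 0ℚ ≤ℚ c → - (c * (x * x)) ≤ℚ 0ℚ
  nonpos-square c x 0≤c = ℚ.neg-antimono-≤ (0≤c ⊠ square-nonneg x)

  -- The coefficient `A`, which is -5 at q = 1, occurs only at a single hit. Without single hits the
  -- coefficient is at least -1 at two hits and nonnegative elsewhere, and a quadratic below these
  -- values has a large enough average.
  coloop-free : ∀ {j} → Even j → ∀ xs → length xs ≡ 4 ℕ.+ j → Good xs → (∀ w → cnt w xs ≢ 1) → - ρ ≤ℚ Λ̂ xs
  -- The parabola k(k - 4)/4 touches -1 at k = 2, vanishes at 0 and 4, and averages to -3/4 over
  -- four points.
  coloop-free zero xs@(_ ∷ _ ∷ _ ∷ _ ∷ []) _ good cnt≢1 = ℚ.≤-trans (dec≤ (- ρ) (- (+ 3 / 4)))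
    (quad-lower 0ℚ (- 1ℚ) (+ 1 / 4) xs good (λ w → Γ (hits w xs)) (λ w → ℚ.≤-trans (below (cnt w xs) (cnt≤length w xs) (cnt≢1 w)) (floor≤Γ (hits w xs))))
    where
    below : ∀ k → k ≤ 4 → k ≢ 1 → quad 0ℚ (- 1ℚ) (+ 1 / 4) k ≤ℚ floor k
    below 0 _ _ = 0≤D
    below 1 _ k≢1 = ⊥-elim (k≢1 refl)
    below 2 _ _ = -1≤B
    below 3 _ _ = dec≤ _ _
    below 4 _ _ = dec≤ _ _
    below (suc (suc (suc (suc (suc k))))) (s≤s (s≤s (s≤s (s≤s ())))) _
  -- Here the parabola is -(5 - l)²/9, equal to -1 at l = 2. It increases up to l = 5, so counting
  -- only the hits among five of the points keeps it below; its average is -5/6.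
  coloop-free (2+ _) xs@(x₁ ∷ x₂ ∷ x₃ ∷ x₄ ∷ x₅ ∷ rest) _ good cnt≢1 = ℚ.≤-trans (dec≤ (- ρ) (- (+ 5 / 6)))
    (quad-lower (- (+ 25 / 9)) (+ 10 / 9) (- (+ 1 / 9)) ys (Good-++ˡ ys good) (λ w → Γ (hits w xs))
      (λ w → ℚ.≤-trans (below (cnt w xs) (cnt w ys) (cnt-++ w ys rest) (cnt≢1 w)) (floor≤Γ (hits w xs))))
    where
    ys = x₁ ∷ x₂ ∷ x₃ ∷ x₄ ∷ x₅ ∷ []
    below : ∀ k l → l ≤ k → k ≢ 1 → quad (- (+ 25 / 9)) (+ 10 / 9) (- (+ 1 / 9)) l ≤ℚ floor k
    below 0 .0 z≤n _ = ℚ.≤-trans (dec≤ _ 0ℚ) 0≤D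
    below 1 _ _ k≢1 = ⊥-elim (k≢1 refl)
    below 2 .0 z≤n _ = ℚ.≤-trans (dec≤ _ (- 1ℚ)) -1≤B
    below 2 .1 (s≤s z≤n) _ = ℚ.≤-trans (dec≤ _ (- 1ℚ)) -1≤B
    below 2 .2 (s≤s (s≤s z≤n)) _ = ℚ.≤-trans (dec≤ _ (- 1ℚ)) -1≤B
    below (suc (suc (suc k))) l _ _ = subst (_≤ℚ 0ℚ) (sym (e (ι l))) (nonpos-square (+ 1 / 9) (5ℚ - ι l) (nonneg (+ 1 / 9)))
      where
      e : ∀ x → - (+ 25 / 9) + + 10 / 9 * x + - (+ 1 / 9) * (x * x) ≡ - (+ 1 / 9 * ((5ℚ - x) * (5ℚ - x)))
      e = solve-∀ ring

  -- Given the hits among the others, the bit of the coloop is a fair coin. No other hit averages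
  -- `D` with `A` to q², two other hits average `B` with 0, and a single other hit is excluded.
  one-coloop : ∀ {w₀} xs → (I : Isolated w₀ xs) → (∀ w → cnt w (Isolated.others I) ≢ 1) → - ½ ≤ℚ Λ̂ xs
  one-coloop {w₀} xs I cnt≢1 = ℚ.≤-trans
    (subst (_≤ℚ 𝔼ᵤ (λ w → ½ * (floor (c w) + floor (suc (c w))))) (wsum-const {N = n} refl (- ½)) (𝔼ᵤ-mono (λ w → below (c w) (cnt≢1 w))))
    (subst (_≤ℚ Λ̂ xs) (toggle {w₀ = w₀} hit (λ b w → floor (add b (c w))) (λ b w → cong (floor ∘ add b) (cnt-shift miss w)))
      (𝔼ᵤ-mono (λ w → subst (λ k → floor k ≤ℚ Γ (hits w xs)) (trans (counts w) (cnt-∷ w point others)) (floor≤Γ (hits w xs)))))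
    where
    open Isolated I
    c : Point n → ℕ
    c w = cnt w others
    below : ∀ k → k ≢ 1 → - ½ ≤ℚ ½ * (floor k + floor (suc k))
    below 0 _ = ℚ.≤-trans (dec≤ (- ½) 0ℚ) (subst (0ℚ ≤ℚ_) (e q) 0≤q²)
      where
      e : ∀ q → q * q ≡ ½ * ((1ℚ + 3ℚ * q + 3ℚ * (q * q)) + - (1ℚ + 3ℚ * q + q * q))
      e = solve-∀ ring
    below 1 k≢1 = ⊥-elim (k≢1 refl)
    below 2 _ = *-monoˡ (nonneg ½) (ℚ.+-mono-≤ -1≤B (ℚ.≤-refl {0ℚ}))
    below (suc (suc (suc k))) _ = dec≤ _ _

  twice : (ℕ → ℚ) → ℕ → ℚ
  twice φ k = ½ * (½ * (φ k + φ (suc k)) + ½ * (φ (suc k) + φ (suc (suc k))))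

  two-toggles : ∀ {w₀ w₁} xs (I : Isolated w₀ xs) (J : Isolated w₁ (Isolated.others I)) (φ : ℕ → ℚ) →
    𝔼ᵤ (λ w → φ (cnt w xs)) ≡ 𝔼ᵤ (λ w → twice φ (cnt w (Isolated.others J)))
  two-toggles {w₀} {w₁} xs I J φ = begin
    𝔼ᵤ (λ w → φ (cnt w xs))
      ≡⟨ wsum-cong (λ w → cong φ (trans (I.counts w) (trans (cnt-∷ w I.point I.others) (cong (add (dot w I.point)) (trans (J.counts w) (cnt-∷ w J.point J.others)))))) ⟩
    𝔼ᵤ (λ w → φ (add (dot w I.point) (add (dot w J.point) (c w))))
      ≡⟨ toggle {w₀ = w₀} I.hit (λ b w → φ (add b (add (dot w J.point) (c w)))) (λ b w → cong (φ ∘ add b) (inv₀ w)) ⟩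
    𝔼ᵤ (λ w → ½ * (φ (add (dot w J.point) (c w)) + φ (suc (add (dot w J.point) (c w)))))
      ≡⟨ toggle {w₀ = w₁} J.hit (λ b w → ½ * (φ (add b (c w)) + φ (suc (add b (c w))))) (λ b w → cong (λ k → ½ * (φ (add b k) + φ (suc (add b k)))) (cnt-shift J.miss w)) ⟩
    𝔼ᵤ (λ w → twice φ (c w)) ∎
    where
    open ≡-Reasoning
    module I = Isolated I
    module J = Isolated J
    c : Point n → ℕ
    c w = cnt w J.others
    inv₀ : ∀ w → add (dot (w ⊕ w₀) J.point) (c (w ⊕ w₀)) ≡ add (dot w J.point) (c w)
    inv₀ w with J.all I.miss
    ... | m ∷ ms = cong₂ add (trans (dot-⊕ˡ w w₀ J.point) (trans (cong (dot w J.point xor_) m) (Bool.xor-comm (dot w J.point) false))) (cnt-shift ms w)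

  -- Averaging over two coin bits already tames `A`: with 0, 1, 2 other hits the averages are at
  -- least -1, -7/4, -1/4, and 0 beyond.
  two-coloops : ∀ {j} → Even j → ∀ xs {w₀ w₁} (I : Isolated w₀ xs) (J : Isolated w₁ (Isolated.others I)) →
    length xs ≡ 4 ℕ.+ j → Good xs → cnt w₀ xs ≡ 1 → - ρ ≤ℚ Λ̂ xs
  two-coloops {j} ev xs {w₀} I J len good@(nz , u) one = go ev len J.others refl len′ good′
    where
    module I = Isolated I
    module J = Isolated J
    len′ : length J.others ≡ suc (suc j)
    len′ = ℕ.suc-injective (ℕ.suc-injective (trans (cong suc (sym J.len)) (trans (sym I.len) len)))
    good′ : Good J.others
    good′ with I.all nz | I.uniq u
    ... | _ ∷ nz′ | _ ∷ u′ with J.all nz′ | J.uniq u′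
    ... | _ ∷ nz″ | _ ∷ u″ = nz″ , u″
    reduce : (φ : ℕ → ℚ) → (∀ w → φ (cnt w xs) ≤ℚ Γ (hits w xs)) → 𝔼ᵤ (λ w → twice φ (cnt w J.others)) ≤ℚ Λ̂ xs
    reduce φ φ≤Γ = subst (_≤ℚ Λ̂ xs) (two-toggles xs I J φ) (𝔼ᵤ-mono φ≤Γ)
    floor₄ : ℕ → ℚ
    floor₄ 0 = D
    floor₄ 1 = A
    floor₄ 2 = B
    floor₄ 3 = g
    floor₄ 4 = g
    floor₄ _ = 0ℚ
    -- The functional isolating a point is 1 on the sum of all points. A set of four therefore
    -- counts as an independent quadruple and earns `g` when it is hit entirely.
    sum≢0 : is0 (total xs) ≡ false
    sum≢0 = ≢0⇒is0-false (dot-true⇒≢0 {w = w₀} (dot-total w₀ xs one))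
    floor₄≤Γ : length xs ≡ 4 → ∀ w → floor₄ (cnt w xs) ≤ℚ Γ (hits w xs)
    floor₄≤Γ len₄ w = below (hits w xs) (λ e → List.filter-complete (Bool.T? ∘ dot w) (trans e (sym len₄)))
      where
      below : ∀ X → (length X ≡ 4 → X ≡ xs) → floor₄ (length X) ≤ℚ Γ X
      below [] _ = ℚ.≤-refl
      below (_ ∷ []) _ = ℚ.≤-refl
      below (_ ∷ _ ∷ []) _ = ℚ.≤-refl
      below (_ ∷ _ ∷ _ ∷ []) _ = ℚ.≤-refl
      below (a ∷ b ∷ c ∷ d ∷ []) is rewrite trans (cong (is0 ∘ total) (is refl)) sum≢0 = ℚ.≤-refl
      below (_ ∷ _ ∷ _ ∷ _ ∷ _ ∷ []) _ = ℚ.≤-refl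
      below (_ ∷ _ ∷ _ ∷ _ ∷ _ ∷ _ ∷ _) _ = ℚ.≤-refl
    go : ∀ {j} → Even j → length xs ≡ 4 ℕ.+ j → ∀ zs → zs ≡ J.others → length zs ≡ suc (suc j) → Good zs → - ρ ≤ℚ Λ̂ xs
    -- The two remaining vectors are distinct and nonzero, hence independent, so the average can be
    -- computed exactly. The bound -ρ is attained here at q = 1.
    go zero len₄ (x ∷ y ∷ []) refl _ (x≢0 ∷ y≢0 ∷ [] , (x≢y ∷ []) ∷ _) = ℚ.≤-trans
      (by-diff (nonneg (+ 1 / 16) ⊠ (nonneg 15ℚ ⊠ 0≤1-q ⊞ nonneg 7ℚ ⊠ (0≤1-q ⊠ (nonneg 1ℚ ⊞ 0≤q)))) (e q))
      (subst (_≤ℚ Λ̂ xs) (trans (wsum-cong (λ w → cong (twice floor₄ ∘ length) (filterᵇ-sel (dot w) (x ∷ y ∷ []))))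
        (uniform (x ∷ y ∷ []) (distinct⇒indep x y x≢0 y≢0 x≢y) (λ bs → twice floor₄ (length (sel bs (x ∷ y ∷ [])))))) (reduce floor₄ (floor₄≤Γ len₄)))
      where
      e : ∀ q → let D = 1ℚ + 3ℚ * q + 3ℚ * (q * q) ; A = - (1ℚ + 3ℚ * q + q * q) ; B = 1ℚ - q - q * q ; g = + 5 / 8
                    h₀ = ½ * (½ * (D + A) + ½ * (A + B)) ; h₁ = ½ * (½ * (A + B) + ½ * (B + g)) ; h₂ = ½ * (½ * (B + g) + ½ * (g + g)) in
        (½ * (½ * h₀ + ½ * h₁) + ½ * (½ * h₁ + ½ * h₂)) - - (+ 127 / 128) ≡ + 1 / 16 * (15ℚ * (1ℚ - q) + 7ℚ * ((1ℚ - q) * (1ℚ + q)))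
      e = solve-∀ ring
    -- The parabola -7(3 - l)²/16 meets -7/4 at l = 1. It is nonpositive and increases up to l = 3,
    -- and its average over four points is -7/8.
    go (2+ _) _ zs@(x₁ ∷ x₂ ∷ x₃ ∷ x₄ ∷ rest) refl _ good″ = ℚ.≤-trans (ℚ.≤-trans (dec≤ (- ρ) (- (+ 7 / 8)))
      (quad-lower (- (+ 63 / 16)) (+ 21 / 8) (- (+ 7 / 16)) ys (Good-++ˡ ys good″) (λ w → twice floor (cnt w zs))
        (λ w → below (cnt w zs) (cnt w ys) (cnt-++ w ys rest))))
      (reduce floor (λ w → floor≤Γ (hits w xs)))
      where
      ys = x₁ ∷ x₂ ∷ x₃ ∷ x₄ ∷ []
      h₀ : - 1ℚ ≤ℚ twice floor 0
      h₀ = by-diff 0≤1-q (e q)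
        where
        e : ∀ q → let D = 1ℚ + 3ℚ * q + 3ℚ * (q * q) ; A = - (1ℚ + 3ℚ * q + q * q) ; B = 1ℚ - q - q * q in
          ½ * (½ * (D + A) + ½ * (A + B)) - - 1ℚ ≡ 1ℚ - q
        e = solve-∀ ring
      h₁ : - (+ 7 / 4) ≤ℚ twice floor 1
      h₁ = by-diff (nonneg (+ 1 / 4) ⊠ (nonneg 5ℚ ⊠ 0≤1-q ⊞ nonneg 3ℚ ⊠ (0≤1-q ⊠ (nonneg 1ℚ ⊞ 0≤q)))) (e q)
        where
        e : ∀ q → let A = - (1ℚ + 3ℚ * q + q * q) ; B = 1ℚ - q - q * q in
          ½ * (½ * (A + B) + ½ * (B + 0ℚ)) - - (+ 7 / 4) ≡ + 1 / 4 * (5ℚ * (1ℚ - q) + 3ℚ * ((1ℚ - q) * (1ℚ + q)))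
        e = solve-∀ ring
      h₂ : - (+ 1 / 4) ≤ℚ twice floor 2
      h₂ = *-monoˡ (nonneg ½) (ℚ.+-mono-≤ (*-monoˡ (nonneg ½) (ℚ.+-mono-≤ -1≤B (ℚ.≤-refl {0ℚ}))) (ℚ.≤-refl {½ * (0ℚ + 0ℚ)}))
      below : ∀ k l → l ≤ k → quad (- (+ 63 / 16)) (+ 21 / 8) (- (+ 7 / 16)) l ≤ℚ twice floor k
      below 0 .0 z≤n = ℚ.≤-trans (dec≤ _ (- 1ℚ)) h₀
      below 1 .0 z≤n = ℚ.≤-trans (dec≤ _ (- (+ 7 / 4))) h₁
      below 1 .1 (s≤s z≤n) = ℚ.≤-trans (dec≤ _ (- (+ 7 / 4))) h₁
      below 2 .0 z≤n = ℚ.≤-trans (dec≤ _ (- (+ 1 / 4))) h₂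
      below 2 .1 (s≤s z≤n) = ℚ.≤-trans (dec≤ _ (- (+ 1 / 4))) h₂
      below 2 .2 (s≤s (s≤s z≤n)) = ℚ.≤-trans (dec≤ _ (- (+ 1 / 4))) h₂
      below (suc (suc (suc k))) l _ = subst (_≤ℚ 0ℚ) (sym (e (ι l))) (nonpos-square (+ 7 / 16) (3ℚ - ι l) (nonneg (+ 7 / 16)))
        where
        e : ∀ x → - (+ 63 / 16) + + 21 / 8 * x + - (+ 7 / 16) * (x * x) ≡ - (+ 7 / 16 * ((3ℚ - x) * (3ℚ - x)))
        e = solve-∀ ring

  even-gap : ∀ {j} → Even j → ∀ xs → length xs ≡ 4 ℕ.+ j → Good xs → - ρ ≤ℚ Λ̂ xs
  even-gap ev xs len good with search (λ w → cnt w xs ℕ.≡ᵇ 1)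
  ... | inj₂ none = coloop-free ev xs len good (λ w → ≡ᵇ-refuted (none w))
  ... | inj₁ (w₀ , e) = further (isolate w₀ xs one)
    where
    one : cnt w₀ xs ≡ 1
    one = ≡ᵇ-sound _ 1 e
    further : Isolated w₀ xs → - ρ ≤ℚ Λ̂ xs
    further I with search (λ w → cnt w (Isolated.others I) ℕ.≡ᵇ 1)
    ... | inj₂ none = ℚ.≤-trans (dec≤ (- ρ) (- ½)) (one-coloop xs I (λ w → ≡ᵇ-refuted (none w)))
    ... | inj₁ (w₁ , e₁) = two-coloops ev xs I (isolate w₁ _ (≡ᵇ-sound _ 1 e₁)) len good one

  odd-gap₃ : ∀ a b c → Good (a ∷ b ∷ c ∷ []) → is0 (total (a ∷ b ∷ c ∷ [])) ≡ false → Λ̂ (a ∷ b ∷ c ∷ []) ≤ℚ ρ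
  odd-gap₃ a b c good s = subst (_≤ℚ ρ) (sym (Λ-indep₃ D A B g a b c (indep₃ a b c good (is0-false (trans (sym (cong is0 (total₃ a b c))) s)))))
    (by-diff (nonneg (+ 101 / 128) ⊞ nonneg (+ 9 / 8) ⊠ 0≤q ⊞ nonneg (+ 3 / 8) ⊠ 0≤q²) (e q))
    where
    e : ∀ q → let D = 1ℚ + 3ℚ * q + 3ℚ * (q * q) ; A = - (1ℚ + 3ℚ * q + q * q) ; B = 1ℚ - q - q * q ; g = + 5 / 8 in
      + 127 / 128 - ½ * ½ * ½ * (D + (1ℚ + 1ℚ + 1ℚ) * A + (1ℚ + 1ℚ + 1ℚ) * B + g) ≡ + 101 / 128 + + 9 / 8 * q + + 3 / 8 * (q * q)
    e = solve-∀ ring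

  -- Bounds uniform in q. The factor q² multiplied in by `q²Γ≤ceil` is what an odd set of at least
  -- five points retains after q³ is split off from q^|R|.
  ceil : ℕ → ℚ
  ceil 0 = 7ℚ
  ceil 1 = 0ℚ
  ceil 2 = + 1 / 4
  ceil 3 = g
  ceil 4 = g
  ceil _ = 0ℚ

  q²Γ≤ceil : ∀ X → q * q * Γ X ≤ℚ ceil (length X)
  q²Γ≤ceil [] = by-diff (0≤1-q ⊠ (nonneg 7ℚ ⊞ nonneg 7ℚ ⊠ 0≤q ⊞ nonneg 6ℚ ⊠ 0≤q² ⊞ nonneg 3ℚ ⊠ (0≤q ⊠ 0≤q²))) (e q)
    where
    e : ∀ q → 7ℚ - q * q * (1ℚ + 3ℚ * q + 3ℚ * (q * q)) ≡
      (1ℚ - q) * (7ℚ + 7ℚ * q + 6ℚ * (q * q) + 3ℚ * (q * (q * q)))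
    e = solve-∀ ring
  q²Γ≤ceil (_ ∷ []) = by-diff (0≤q² ⊠ (nonneg 1ℚ ⊞ nonneg 3ℚ ⊠ 0≤q ⊞ 0≤q²)) (e q)
    where
    e : ∀ q → 0ℚ - q * q * - (1ℚ + 3ℚ * q + q * q) ≡ q * q * (1ℚ + 3ℚ * q + q * q)
    e = solve-∀ ring
  q²Γ≤ceil (_ ∷ _ ∷ []) = by-diff (square-nonneg (½ - q) ⊞ 0≤q ⊠ 0≤1-q ⊠ 0≤1-q ⊞ 0≤q² ⊠ 0≤q²) (e q)
    where
    e : ∀ q → + 1 / 4 - q * q * (1ℚ - q - q * q) ≡ (½ - q) * (½ - q) + q * (1ℚ - q) * (1ℚ - q) + q * q * (q * q)
    e = solve-∀ ring
  q²Γ≤ceil (_ ∷ _ ∷ _ ∷ []) = q²g≤g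
    where
    q²g≤g : q * q * g ≤ℚ g
    q²g≤g = by-diff (nonneg g ⊠ (0≤1-q ⊠ (nonneg 1ℚ ⊞ 0≤q))) (e q)
      where
      e : ∀ q → + 5 / 8 - q * q * (+ 5 / 8) ≡ + 5 / 8 * ((1ℚ - q) * (1ℚ + q))
      e = solve-∀ ring
  q²Γ≤ceil (a ∷ b ∷ c ∷ d ∷ []) with is0 (total (a ∷ b ∷ c ∷ d ∷ []))
  ... | true = subst (_≤ℚ g) (sym (ℚ.*-zeroʳ (q * q))) (nonneg g)
  ... | false = q²Γ≤ceil (a ∷ b ∷ c ∷ [])
  q²Γ≤ceil (_ ∷ _ ∷ _ ∷ _ ∷ _ ∷ []) = ℚ.≤-reflexive (ℚ.*-zeroʳ (q * q))
  q²Γ≤ceil (_ ∷ _ ∷ _ ∷ _ ∷ _ ∷ _ ∷ _) = ℚ.≤-reflexive (ℚ.*-zeroʳ (q * q))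

  high-rank : ∀ {j} → Even j → ∀ xs → length xs ≡ 5 ℕ.+ j → Good xs → P₀ xs ≤ℚ + 1 / 16 → q * q * Λ̂ xs ≤ℚ ρ
  high-rank ev xs len good P₀≤ = subst (_≤ℚ ρ) (wsum-* (q * q) (λ w → Γ (hits w xs))) (go ev len)
    where
    -- The parabola 5k(7 - k)/96 is 5/8 at both k = 3 and k = 4 and nonnegative up to k = 7. The
    -- remaining 7 at k = 0 is paid with probability at most 1/16.
    small : ∀ k → k ≤ 7 → ceil k ≤ℚ quad 0ℚ (+ 35 / 96) (- (+ 5 / 96)) k + 7ℚ * 𝟙 (k ℕ.≡ᵇ 0)
    small 0 _ = dec≤ _ _
    small 1 _ = dec≤ _ _
    small 2 _ = dec≤ _ _
    small 3 _ = dec≤ _ _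
    small 4 _ = dec≤ _ _
    small 5 _ = dec≤ _ _
    small 6 _ = dec≤ _ _
    small 7 _ = dec≤ _ _
    small (suc (suc (suc (suc (suc (suc (suc (suc k)))))))) (s≤s (s≤s (s≤s (s≤s (s≤s (s≤s (s≤s ())))))))
    moderate : length xs ≤ 7 → 𝔼ᵤ (λ w → q * q * Γ (hits w xs)) ≤ℚ 0ℚ + + 35 / 96 * (½ * ι (length xs)) + - (+ 5 / 96) * (½ * ½ * (ι (length xs) * (1ℚ + ι (length xs)))) + 7ℚ * (+ 1 / 16)
    moderate ≤7 = quad-upper 0ℚ (+ 35 / 96) (- (+ 5 / 96)) 7ℚ (+ 1 / 16) xs xs good (nonneg 7ℚ) P₀≤ (λ w → q * q * Γ (hits w xs))
      (λ w → ℚ.≤-trans (q²Γ≤ceil (hits w xs)) (small (cnt w xs) (ℕ.≤-trans (cnt≤length w xs) ≤7)))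
    -- The parabola (9 - l)²/40 is 5/8 at l = 4 and decreases up to l = 9, so the hits among nine
    -- points suffice for any longer set.
    g≤quad : ∀ l → l ≤ 4 → g ≤ℚ quad (+ 81 / 40) (- (+ 18 / 40)) (+ 1 / 40) l + 5ℚ * 0ℚ
    g≤quad 0 _ = dec≤ _ _
    g≤quad 1 _ = dec≤ _ _
    g≤quad 2 _ = dec≤ _ _
    g≤quad 3 _ = dec≤ _ _
    g≤quad 4 _ = dec≤ _ _
    g≤quad (suc (suc (suc (suc (suc l))))) (s≤s (s≤s (s≤s (s≤s ()))))
    large : ∀ k l → l ≤ k → ceil k ≤ℚ quad (+ 81 / 40) (- (+ 18 / 40)) (+ 1 / 40) l + 5ℚ * 𝟙 (k ℕ.≡ᵇ 0)
    large 0 .0 z≤n = dec≤ _ _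
    large 1 l l≤k = ℚ.≤-trans (nonneg g) (g≤quad l (ℕ.≤-trans l≤k (s≤s z≤n)))
    large 2 l l≤k = ℚ.≤-trans (dec≤ (+ 1 / 4) g) (g≤quad l (ℕ.≤-trans l≤k (s≤s (s≤s z≤n))))
    large 3 l l≤k = g≤quad l (ℕ.≤-trans l≤k (s≤s (s≤s (s≤s z≤n))))
    large 4 l l≤k = g≤quad l l≤k
    large (suc (suc (suc (suc (suc k))))) l _ = subst (0ℚ ≤ℚ_) (sym (e (ι l))) (nonneg (+ 1 / 40) ⊠ square-nonneg (9ℚ - ι l))
      where
      e : ∀ x → + 81 / 40 + - (+ 18 / 40) * x + + 1 / 40 * (x * x) + 5ℚ * 0ℚ ≡ + 1 / 40 * ((9ℚ - x) * (9ℚ - x))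
      e = solve-∀ ring
    nine : ∀ ys zs → xs ≡ ys ++ zs → length ys ≡ 9 → 𝔼ᵤ (λ w → q * q * Γ (hits w xs)) ≤ℚ ρ
    nine ys zs refl len₉ = ℚ.≤-trans
      (quad-upper (+ 81 / 40) (- (+ 18 / 40)) (+ 1 / 40) 5ℚ (+ 1 / 16) ys xs (Good-++ˡ ys good) (nonneg 5ℚ) P₀≤ (λ w → q * q * Γ (hits w xs))
        (λ w → ℚ.≤-trans (q²Γ≤ceil (hits w xs)) (large (cnt w xs) (cnt w ys) (cnt-++ w ys zs))))
      (subst (λ m → + 81 / 40 + - (+ 18 / 40) * (½ * ι m) + + 1 / 40 * (½ * ½ * (ι m * (1ℚ + ι m))) + 5ℚ * (+ 1 / 16) ≤ℚ ρ) (sym len₉) (dec≤ _ _))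
    split₉ : ∀ k (ys : List (Point n)) → length ys ≡ 9 ℕ.+ k → ∃ λ us → ∃ λ vs → ys ≡ us ++ vs × length us ≡ 9
    split₉ k (x₁ ∷ x₂ ∷ x₃ ∷ x₄ ∷ x₅ ∷ x₆ ∷ x₇ ∷ x₈ ∷ x₉ ∷ ys) _ = (x₁ ∷ x₂ ∷ x₃ ∷ x₄ ∷ x₅ ∷ x₆ ∷ x₇ ∷ x₈ ∷ x₉ ∷ []) , ys , refl , refl
    moderate-value : ℕ → ℚ
    moderate-value m = 0ℚ + + 35 / 96 * (½ * ι m) + - (+ 5 / 96) * (½ * ½ * (ι m * (1ℚ + ι m))) + 7ℚ * (+ 1 / 16)
    go : ∀ {j} → Even j → length xs ≡ 5 ℕ.+ j → 𝔼ᵤ (λ w → q * q * Γ (hits w xs)) ≤ℚ ρ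
    go zero len₅ = ℚ.≤-trans (moderate (subst (_≤ 7) (sym len₅) (s≤s (s≤s (s≤s (s≤s (s≤s z≤n))))))) (subst (λ m → moderate-value m ≤ℚ ρ) (sym len₅) (dec≤ _ _))
    go (2+ zero) len₇ = ℚ.≤-trans (moderate (subst (_≤ 7) (sym len₇) ℕ.≤-refl)) (subst (λ m → moderate-value m ≤ℚ ρ) (sym len₇) (dec≤ _ _))
    go (2+ (2+_ {k} _)) len₉ with split₉ k xs len₉
    ... | us , vs , eq , l = nine us vs eq l

  -- No functional hits more than four points, and a quadruple that is hit is dependent. The
  -- coefficient thus depends on the number of hits alone, which compensates for the weaker bound
  -- 1/8 on the probability of no hit.
  low-rank : ∀ {j} → Even j → ∀ xs → length xs ≡ 5 ℕ.+ j → Good xs → (∀ w → rank≥4 (hits w xs) ≡ false) → Λ̂ xs ≤ℚ ρ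
  low-rank ev xs@(a ∷ b ∷ c ∷ d ∷ _) len good low = ℚ.≤-trans
    (quad-upper α β δ κ (+ 1 / 8) xs xs good 0≤κ (P₀≤⅛ a b c d _ good) (λ w → Γ (hits w xs)) (λ w → above (hits w xs) (low w)))
    (subst (λ m → value m ≤ℚ ρ) (sym len) (value≤ρ ev))
    where
    α β δ κ : ℚ
    -- The quadratic through the values B, 5/8, 0 at two, three and four hits; κ is what it lacks to
    -- reach `D` at no hit.
    α = 6ℚ * B - 5ℚ
    β = + 15 / 4 - + 7 / 2 * B
    δ = ½ * B - + 5 / 8
    κ = 9ℚ * (q + q * q)
    0≤κ : 0ℚ ≤ℚ κ
    0≤κ = nonneg 9ℚ ⊠ (0≤q ⊞ 0≤q²)
    above : ∀ X → rank≥4 X ≡ false → Γ X ≤ℚ quad α β δ (length X) + κ * 𝟙 (length X ℕ.≡ᵇ 0)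
    above [] _ = ℚ.≤-reflexive (e q)
      where
      e : ∀ q → let B = 1ℚ - q - q * q in 1ℚ + 3ℚ * q + 3ℚ * (q * q) ≡
        6ℚ * B - 5ℚ + (+ 15 / 4 - + 7 / 2 * B) * 0ℚ + (½ * B - + 5 / 8) * (0ℚ * 0ℚ) + 9ℚ * (q + q * q) * 1ℚ
      e = solve-∀ ring
    above (_ ∷ []) _ = by-diff (nonneg (+ 1 / 8) ⊞ nonneg 2ℚ ⊠ (0≤1-q ⊠ (nonneg 1ℚ ⊞ 0≤q))) (e q)
      where
      e : ∀ q → let B = 1ℚ - q - q * q in
        6ℚ * B - 5ℚ + (+ 15 / 4 - + 7 / 2 * B) * (1ℚ + 0ℚ) + (½ * B - + 5 / 8) * ((1ℚ + 0ℚ) * (1ℚ + 0ℚ)) + 9ℚ * (q + q * q) * 0ℚ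
        - - (1ℚ + 3ℚ * q + q * q) ≡ + 1 / 8 + 2ℚ * ((1ℚ - q) * (1ℚ + q))
      e = solve-∀ ring
    above (_ ∷ _ ∷ []) _ = ℚ.≤-reflexive (e (1ℚ - q - q * q) κ)
      where
      e : ∀ B κ → B ≡ 6ℚ * B - 5ℚ + (+ 15 / 4 - + 7 / 2 * B) * (1ℚ + (1ℚ + 0ℚ)) + (½ * B - + 5 / 8) * ((1ℚ + (1ℚ + 0ℚ)) * (1ℚ + (1ℚ + 0ℚ))) + κ * 0ℚ
      e = solve-∀ ring
    above (_ ∷ _ ∷ _ ∷ []) _ = ℚ.≤-reflexive (e (1ℚ - q - q * q) κ)
      where
      e : ∀ B κ → + 5 / 8 ≡ 6ℚ * B - 5ℚ + (+ 15 / 4 - + 7 / 2 * B) * (1ℚ + (1ℚ + (1ℚ + 0ℚ))) + (½ * B - + 5 / 8) * ((1ℚ + (1ℚ + (1ℚ + 0ℚ))) * (1ℚ + (1ℚ + (1ℚ + 0ℚ)))) + κ * 0ℚ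
      e = solve-∀ ring
    above (x ∷ y ∷ z ∷ t ∷ []) r with is0 (total (x ∷ y ∷ z ∷ t ∷ []))
    ... | true = ℚ.≤-reflexive (e (1ℚ - q - q * q) κ)
      where
      e : ∀ B κ → 0ℚ ≡ 6ℚ * B - 5ℚ + (+ 15 / 4 - + 7 / 2 * B) * (1ℚ + (1ℚ + (1ℚ + (1ℚ + 0ℚ)))) + (½ * B - + 5 / 8) * ((1ℚ + (1ℚ + (1ℚ + (1ℚ + 0ℚ)))) * (1ℚ + (1ℚ + (1ℚ + (1ℚ + 0ℚ))))) + κ * 0ℚ
      e = solve-∀ ring
    value : ℕ → ℚ
    value m = α + β * (½ * ι m) + δ * (½ * ½ * (ι m * (1ℚ + ι m))) + κ * (+ 1 / 8)
    -- As B = 1 − s with s = q + q², the value is affine in s ∈ [0, 2]; 2 − s = (1 − q) + (1 − q)(1 + q).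
    0≤s : 0ℚ ≤ℚ q + q * q
    0≤s = 0≤q ⊞ 0≤q²
    0≤2-s : 0ℚ ≤ℚ (1ℚ - q) + (1ℚ - q) * (1ℚ + q)
    0≤2-s = 0≤1-q ⊞ 0≤1-q ⊠ (nonneg 1ℚ ⊞ 0≤q)
    at-0 at-2 : ℚ → ℚ
    at-0 m = + 1 / 32 * (m * m - 3ℚ * m) - + 1 / 128
    at-2 m = + 1 / 32 * (9ℚ * ((m - 5ℚ) * (m - 7ℚ)) + m) - + 13 / 128
    interpolate : ∀ m → 0ℚ ≤ℚ at-0 (ι m) → 0ℚ ≤ℚ at-2 (ι m) → value m ≤ℚ ρ
    interpolate m 0≤u 0≤u′ = by-diff (nonneg ½ ⊠ (0≤2-s ⊠ 0≤u ⊞ 0≤s ⊠ 0≤u′)) (e q (ι m))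
      where
      e : ∀ q m → let B = 1ℚ - q - q * q in
        + 127 / 128 - (6ℚ * B - 5ℚ + (+ 15 / 4 - + 7 / 2 * B) * (½ * m) + (½ * B - + 5 / 8) * (½ * ½ * (m * (1ℚ + m))) + 9ℚ * (q + q * q) * (+ 1 / 8))
        ≡ ½ * (((1ℚ - q) + (1ℚ - q) * (1ℚ + q)) * (+ 1 / 32 * (m * m - 3ℚ * m) - + 1 / 128) + (q + q * q) * (+ 1 / 32 * (9ℚ * ((m - 5ℚ) * (m - 7ℚ)) + m) - + 13 / 128))
      e = solve-∀ ring
    -- Parity matters: the product (m - 5)(m - 7) in `at-2` is nonnegative for odd m, but at m = 6
    -- it would make `at-2` negative.
    value≤ρ : ∀ {j} → Even j → value (5 ℕ.+ j) ≤ℚ ρ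
    value≤ρ zero = interpolate 5 (nonneg (at-0 (ι 5))) (nonneg (at-2 (ι 5)))
    value≤ρ (2+ zero) = interpolate 7 (nonneg (at-0 (ι 7))) (nonneg (at-2 (ι 7)))
    value≤ρ (2+ (2+_ {k} _)) = interpolate (9 ℕ.+ k)
      (subst (0ℚ ≤ℚ_) (e₀ (ι k)) (nonneg (+ 215 / 128) ⊞ nonneg (+ 15 / 32) ⊠ 0≤t ⊞ nonneg (+ 1 / 32) ⊠ (0≤t ⊠ 0≤t)))
      (subst (0ℚ ≤ℚ_) (e₂ (ι k)) (nonneg (+ 311 / 128) ⊞ nonneg (+ 55 / 32) ⊠ 0≤t ⊞ nonneg (+ 9 / 32) ⊠ (0≤t ⊠ 0≤t)))
      where
      0≤t = ι-nonneg k
      e₀ : ∀ t → let m = 1ℚ + (1ℚ + (1ℚ + (1ℚ + (1ℚ + (1ℚ + (1ℚ + (1ℚ + (1ℚ + t)))))))) in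
        + 215 / 128 + + 15 / 32 * t + + 1 / 32 * (t * t) ≡ + 1 / 32 * (m * m - 3ℚ * m) - + 1 / 128
      e₀ = solve-∀ ring
      e₂ : ∀ t → let m = 1ℚ + (1ℚ + (1ℚ + (1ℚ + (1ℚ + (1ℚ + (1ℚ + (1ℚ + (1ℚ + t)))))))) in
        + 311 / 128 + + 55 / 32 * t + + 9 / 32 * (t * t) ≡ + 1 / 32 * (9ℚ * ((m - 5ℚ) * (m - 7ℚ)) + m) - + 13 / 128
      e₂ = solve-∀ ring

  odd-gap₅ : ∀ {j} → Even j → ∀ xs → length xs ≡ 5 ℕ.+ j → Good xs → q * q * Λ̂ xs ≤ℚ ρ
  odd-gap₅ ev xs len good with search (λ w → rank≥4 (hits w xs))
  ... | inj₁ (w , r) = high-rank ev xs len good (P₀-rank≥4 w xs good r)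
  ... | inj₂ low = ℚ.≤-trans (*-monoˡ 0≤q² (low-rank ev xs len good low)) (by-diff (nonneg ρ ⊠ (0≤1-q ⊠ (nonneg 1ℚ ⊞ 0≤q))) (e q ρ))
    where
    e : ∀ q r → r - q * q * r ≡ r * ((1ℚ - q) * (1ℚ + q))
    e = solve-∀ ring

-- Frequencies as sets of points

sel-∩ : ∀ {A : Set} {k} (f : A → Bool) R (P : Vec A k) → sel (R ∩ map f P) P ≡ filterᵇ f (sel R P)
sel-∩ f [] [] = refl
sel-∩ f (false ∷ R) (x ∷ P) = sel-∩ f R P
sel-∩ f (true ∷ R) (x ∷ P) with f x
... | true = cong (x ∷_) (sel-∩ f R P)
... | false = sel-∩ f R P

∁-map : ∀ {A : Set} {k} (f : A → Bool) (P : Vec A k) → ∁ (map f P) ≡ map (not ∘ f) P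
∁-map f [] = refl
∁-map f (x ∷ P) = cong (not (f x) ∷_) (∁-map f P)

sel-∩∁ : ∀ {A : Set} {k} (f : A → Bool) R (P : Vec A k) → sel (R ∩ ∁ (map f P)) P ≡ filterᵇ (not ∘ f) (sel R P)
sel-∩∁ f R P = trans (cong (λ h → sel (R ∩ h) P) (∁-map f P)) (sel-∩ (not ∘ f) R P)

sel-All : ∀ {A : Set} {Q : A → Set} {k} R (P : Vec A k) → All Q (toList P) → All Q (sel R P)
sel-All [] [] _ = []
sel-All (true ∷ R) (x ∷ P) (q ∷ qs) = q ∷ sel-All R P qs
sel-All (false ∷ R) (x ∷ P) (q ∷ qs) = sel-All R P qs

sel-Unique : ∀ {A : Set} {k} R (P : Vec A k) → Unique (toList P) → Unique (sel R P)
sel-Unique [] [] _ = []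
sel-Unique (true ∷ R) (x ∷ P) (q ∷ qs) = sel-All R P q ∷ sel-Unique R P qs
sel-Unique (false ∷ R) (x ∷ P) (q ∷ qs) = sel-Unique R P qs

sel-injective : ∀ {A : Set} {k} R R′ (P : Vec A k) → Unique (toList P) → sel R P ≡ sel R′ P → R ≡ R′
sel-injective [] [] [] _ _ = refl
sel-injective (true ∷ R) (true ∷ R′) (x ∷ P) (_ ∷ u) e = cong (true ∷_) (sel-injective R R′ P u (proj₂ (List.∷-injective e)))
sel-injective (false ∷ R) (false ∷ R′) (x ∷ P) (_ ∷ u) e = cong (false ∷_) (sel-injective R R′ P u e)
sel-injective (true ∷ R) (false ∷ R′) (x ∷ P) (x∉P ∷ _) e with subst (All (x ≢_)) (sym e) (sel-All R′ P x∉P)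
... | x≢x ∷ _ = ⊥-elim (x≢x refl)
sel-injective (false ∷ R) (true ∷ R′) (x ∷ P) (x∉P ∷ _) e with subst (All (x ≢_)) e (sel-All R P x∉P)
... | x≢x ∷ _ = ⊥-elim (x≢x refl)

pow-sel : ∀ {A : Set} x {k} R (P : Vec A k) → pow x R ≡ x ^ℚ length (sel R P)
pow-sel x [] [] = refl
pow-sel x (true ∷ R) (_ ∷ P) = cong (x *_) (pow-sel x R P)
pow-sel x (false ∷ R) (_ ∷ P) = pow-sel x R P

∩-glue : ∀ {N} (h R R′ : Vec Bool N) → R ∩ h ≡ R′ ∩ h → R ∩ ∁ h ≡ R′ ∩ ∁ h → R ≡ R′
∩-glue [] [] [] _ _ = refl
∩-glue (h ∷ hs) (r ∷ R) (r′ ∷ R′) e e′ = cong₂ _∷_ (bit h r r′ (cong Data.Vec.head e) (cong Data.Vec.head e′)) (∩-glue hs R R′ (cong Data.Vec.tail e) (cong Data.Vec.tail e′))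
  where
  bit : ∀ h r r′ → r ∧ h ≡ r′ ∧ h → r ∧ not h ≡ r′ ∧ not h → r ≡ r′
  bit true r r′ e _ = trans (sym (Bool.∧-identityʳ r)) (trans e (Bool.∧-identityʳ r′))
  bit false r r′ _ e = trans (sym (Bool.∧-identityʳ r)) (trans e (Bool.∧-identityʳ r′))

_==_ : ∀ {N} → Vec Bool N → Vec Bool N → Bool
[] == [] = true
(a ∷ x) == (b ∷ y) = not (a xor b) ∧ (x == y)

==-sound : ∀ {N} (x y : Vec Bool N) → (x == y) ≡ true → x ≡ y
==-sound [] [] _ = refl
==-sound (true ∷ x) (true ∷ y) e = cong (true ∷_) (==-sound x y e)
==-sound (false ∷ x) (false ∷ y) e = cong (false ∷_) (==-sound x y e)

==-refl : ∀ {N} (x : Vec Bool N) → (x == x) ≡ true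
==-refl [] = refl
==-refl (true ∷ x) = ==-refl x
==-refl (false ∷ x) = ==-refl x

Σᵥ-nonneg : ∀ {N} {f : Vec Bool N → ℚ} → (∀ x → 0ℚ ≤ℚ f x) → 0ℚ ≤ℚ Σᵥ f
Σᵥ-nonneg = wsum-nonneg (nonneg 1ℚ) (nonneg 1ℚ)

Σᵥ-mono : ∀ {N} {f g : Vec Bool N → ℚ} → (∀ x → f x ≤ℚ g x) → Σᵥ f ≤ℚ Σᵥ g
Σᵥ-mono = wsum-mono (nonneg 1ℚ) (nonneg 1ℚ)

Σᵥ-unique : ∀ {N} (b : Vec Bool N → Bool) → (∀ x y → b x ≡ true → b y ≡ true → x ≡ y) → Σᵥ (𝟙 ∘ b) ≤ℚ 1ℚ
Σᵥ-unique {zero} b _ with b []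
... | true = ℚ.≤-refl
... | false = nonneg 1ℚ
Σᵥ-unique {suc N} b uniq with search (b ∘ (false ∷_))
... | inj₂ none = subst (_≤ℚ 1ℚ) (sym (trans (cong (λ s → 1ℚ * s + 1ℚ * Σᵥ (𝟙 ∘ b ∘ (true ∷_))) (trans (wsum-cong (λ x → cong 𝟙 (none x))) (wsum-0 {N = N}))) (e (Σᵥ (𝟙 ∘ b ∘ (true ∷_))))))
    (Σᵥ-unique (b ∘ (true ∷_)) (λ x y bx by → cong Data.Vec.tail (uniq (true ∷ x) (true ∷ y) bx by)))
  where
  e : ∀ s → 1ℚ * 0ℚ + 1ℚ * s ≡ s
  e = solve-∀ ring
... | inj₁ (x₀ , b₀) = subst (_≤ℚ 1ℚ) (sym (trans (cong (λ s → 1ℚ * Σᵥ (𝟙 ∘ b ∘ (false ∷_)) + 1ℚ * s) (trans (wsum-cong (λ x → cong 𝟙 (none x))) (wsum-0 {N = N}))) (e (Σᵥ (𝟙 ∘ b ∘ (false ∷_))))))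
    (Σᵥ-unique (b ∘ (false ∷_)) (λ x y bx by → cong Data.Vec.tail (uniq (false ∷ x) (false ∷ y) bx by)))
  where
  e : ∀ s → 1ℚ * s + 1ℚ * 0ℚ ≡ s
  e = solve-∀ ring
  none : ∀ x → b (true ∷ x) ≡ false
  none x with b (true ∷ x) in bx
  ... | false = refl
  ... | true with () ← uniq (false ∷ x₀) (true ∷ x) b₀ bx

Σᵥ-null : ∀ {A : Set} {N} (P : Vec A N) (X : Vec Bool N → ℚ) → Σᵥ (λ R → 𝟙 (null (sel R P)) * X R) ≡ X ∅
Σᵥ-null [] X = ℚ.*-identityˡ (X [])
Σᵥ-null {N = suc N} (x ∷ P) X = trans (cong₂ (λ s t → 1ℚ * s + 1ℚ * t) (Σᵥ-null P (X ∘ (false ∷_))) (trans (wsum-cong (λ R → ℚ.*-zeroˡ (X (true ∷ R)))) (wsum-0 {N = N}))) (e (X ∅))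
  where
  e : ∀ s → 1ℚ * s + 1ℚ * 0ℚ ≡ s
  e = solve-∀ ring

total-split : ∀ {n} (f : Point n → Bool) xs → total (filterᵇ f xs) ⊕ total (filterᵇ (not ∘ f) xs) ≡ total xs
total-split f [] = ⊕-identityˡ 0v
total-split f (x ∷ xs) with f x
... | true = trans (⊕-assoc x _ _) (cong (x ⊕_) (total-split f xs))
... | false = trans (sym (⊕-assoc s x t)) (trans (cong (_⊕ t) (⊕-comm s x)) (trans (⊕-assoc x s t) (cong (x ⊕_) (total-split f xs))))
  where
  s = total (filterᵇ f xs)
  t = total (filterᵇ (not ∘ f) xs)

length-split : ∀ {A : Set} (f : A → Bool) xs → length (filterᵇ f xs) ℕ.+ length (filterᵇ (not ∘ f) xs) ≡ length xs
length-split f [] = refl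
length-split f (x ∷ xs) with f x
... | true = cong suc (length-split f xs)
... | false = trans (ℕ.+-suc _ _) (cong suc (length-split f xs))

-- Dependencies consist of nonzero vectors and say nothing about the coordinate 0v, so it is left
-- free for every `w`.
hit : ∀ {n} → Point n → Point n → Bool
hit w x = is0 x ∨ dot w x

hasZero : ∀ {n} → List (Point n) → Bool
hasZero [] = false
hasZero (x ∷ xs) = is0 x ∨ hasZero xs

wide : ∀ {n} → List (Point n) → Bool
wide [] = false
wide (_ ∷ []) = false
wide (_ ∷ _ ∷ []) = false
wide (a ∷ b ∷ c ∷ []) = not (is0 (total (a ∷ b ∷ c ∷ [])))
wide (_ ∷ _ ∷ _ ∷ _ ∷ _) = true

-- The sets on which the eigenvalue is bounded away from −q³.
slack : ∀ {n} → List (Point n) → Bool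
slack xs = hasZero xs ∨ wide xs

schur : ∀ {n} → List (Point n) → Bool
schur xs@(_ ∷ _ ∷ _ ∷ []) = not (slack xs)
schur _ = false

hasZero⇒¬schur : ∀ {n} (xs : List (Point n)) → hasZero xs ≡ true → schur xs ≡ false
hasZero⇒¬schur (_ ∷ []) _ = refl
hasZero⇒¬schur (_ ∷ _ ∷ []) _ = refl
hasZero⇒¬schur xs@(_ ∷ _ ∷ _ ∷ []) e = cong (λ b → not (b ∨ wide xs)) e
hasZero⇒¬schur (_ ∷ _ ∷ _ ∷ _ ∷ _) _ = refl

∨-false : ∀ {a b} → a ∨ b ≡ false → a ≡ false × b ≡ false
∨-false {false} e = refl , e

hasZero-false : ∀ {n} (xs : List (Point n)) → hasZero xs ≡ false → All (_≢ 0v) xs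
hasZero-false [] _ = []
hasZero-false (x ∷ xs) e with ∨-false {is0 x} e
... | x≢0 , rest = is0-false x≢0 ∷ hasZero-false xs rest

hit-nonzero : ∀ {n} {xs : List (Point n)} → All (_≢ 0v) xs → ∀ w → filterᵇ (hit w) xs ≡ hits w xs
hit-nonzero [] w = refl
hit-nonzero {xs = x ∷ xs} (x≢0 ∷ a) w rewrite ≢0⇒is0-false x≢0 with dot w x
... | true = cong (x ∷_) (hit-nonzero a w)
... | false = hit-nonzero a w

hasZero-hit : ∀ {n} w (xs : List (Point n)) → hasZero (filterᵇ (hit w) xs) ≡ hasZero xs
hasZero-hit w [] = refl
hasZero-hit w (x ∷ xs) with is0 x in z
... | true rewrite z = refl
... | false with dot w x
... | true rewrite z = hasZero-hit w xs
... | false = hasZero-hit w xs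

-- The zero vector is hit by every functional, so its presence in R is visible in the hit part. This
-- allows coefficient 0, hence eigenvalue 0, for all R containing it.
Λ⁰ : ∀ {n} → ℚ → ℚ → ℚ → ℚ → List (Point n) → ℚ
Λ⁰ D A B g xs = 𝔼ᵤ (λ w → if hasZero (filterᵇ (hit w) xs) then 0ℚ else γ D A B g (filterᵇ (hit w) xs))

Λ⁰-zero : ∀ {n} D A B g (xs : List (Point n)) → hasZero xs ≡ true → Λ⁰ D A B g xs ≡ 0ℚ
Λ⁰-zero {n} D A B g xs z = trans (wsum-cong (λ w → cong (λ b → if b then 0ℚ else γ D A B g (filterᵇ (hit w) xs)) (trans (hasZero-hit w xs) z))) (wsum-0 {N = n})

Λ⁰-nonzero : ∀ {n} D A B g (xs : List (Point n)) → hasZero xs ≡ false → Λ⁰ D A B g xs ≡ Λ D A B g xs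
Λ⁰-nonzero D A B g xs z = wsum-cong (λ w → trans (cong (λ b → if b then 0ℚ else γ D A B g (filterᵇ (hit w) xs)) (trans (hasZero-hit w xs) z)) (cong (γ D A B g) (hit-nonzero (hasZero-false xs z) w)))

schur-eq : ∀ {n} (x y z : Point n) → is0 (total (x ∷ y ∷ z ∷ [])) ≡ true → z ≡ x ⊕ y
schur-eq x y z e = sym (⊕≡0⇒≡ (x ⊕ y) z (trans (sym (total₃ x y z)) (is0-sound _ e)))

-- Eigenvalues of all frequencies

private
  -1≤xy : ∀ {x y} → - 1ℚ ≤ℚ x → x ≤ℚ 1ℚ → - 1ℚ ≤ℚ y → y ≤ℚ 1ℚ → - 1ℚ ≤ℚ x * y
  -1≤xy {x} {y} a b c d = by-diff (nonneg ½ ⊠ (diff a ⊠ diff c ⊞ diff b ⊠ diff d)) (e x y)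
    where
    e : ∀ x y → x * y - - 1ℚ ≡ ½ * ((x - - 1ℚ) * (y - - 1ℚ) + (1ℚ - x) * (1ℚ - y))
    e = solve-∀ ring

  xy≤1 : ∀ {x y} → - 1ℚ ≤ℚ x → x ≤ℚ 1ℚ → - 1ℚ ≤ℚ y → y ≤ℚ 1ℚ → x * y ≤ℚ 1ℚ
  xy≤1 {x} {y} a b c d = by-diff (nonneg ½ ⊠ (diff a ⊠ diff d ⊞ diff b ⊠ diff c)) (e x y)
    where
    e : ∀ x y → 1ℚ - x * y ≡ ½ * ((x - - 1ℚ) * (1ℚ - y) + (1ℚ - x) * (y - - 1ℚ))
    e = solve-∀ ring

module Eigenvalues {n : ℕ} (q : ℚ) (0≤q : 0ℚ ≤ℚ q) (q≤1 : q ≤ℚ 1ℚ) where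

  open Spectrum {n} q 0≤q q≤1

  q³ : ℚ
  q³ = q * (q * q)

  0≤q³ : 0ℚ ≤ℚ q³
  0≤q³ = 0≤q ⊠ 0≤q²

  even-power : ∀ {j} → Even j → 0ℚ ≤ℚ (- q) ^ℚ j × (- q) ^ℚ j ≤ℚ 1ℚ
  even-power zero = nonneg 1ℚ , ℚ.≤-refl
  even-power (2+_ {k} ev) with even-power ev
  ... | 0≤t , t≤1 = subst (0ℚ ≤ℚ_) (e q ((- q) ^ℚ k)) (0≤q² ⊠ 0≤t) ,
                    by-diff (diff t≤1 ⊞ 0≤1-q ⊠ (nonneg 1ℚ ⊞ 0≤q) ⊠ 0≤t) (e′ q ((- q) ^ℚ k))
    where
    e : ∀ q t → q * q * t ≡ - q * (- q * t)
    e = solve-∀ ring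
    e′ : ∀ q t → 1ℚ - - q * (- q * t) ≡ (1ℚ - t) + (1ℚ - q) * (1ℚ + q) * t
    e′ = solve-∀ ring

  power-bounds : ∀ j → - 1ℚ ≤ℚ (- q) ^ℚ j × (- q) ^ℚ j ≤ℚ 1ℚ
  power-bounds zero = dec≤ (- 1ℚ) 1ℚ , ℚ.≤-refl
  power-bounds (suc j) with power-bounds j
  ... | a , b = -1≤xy -1≤-q -q≤1 a b , xy≤1 -1≤-q -q≤1 a b
    where
    -1≤-q : - 1ℚ ≤ℚ - q
    -1≤-q = ℚ.neg-antimono-≤ q≤1
    -q≤1 : - q ≤ℚ 1ℚ
    -q≤1 = ℚ.≤-trans (ℚ.neg-antimono-≤ 0≤q) (nonneg 1ℚ)

  private
    slack-form : ∀ {x} → - (ρ * q³) ≤ℚ x → - q³ + 0ℚ * (D + q³) + 1ℚ * (+ 1 / 128 * q³) ≤ℚ x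
    slack-form {x} = subst (_≤ℚ x) (e q³ D)
      where
      e : ∀ r d → - (+ 127 / 128 * r) ≡ - r + 0ℚ * (d + r) + 1ℚ * (+ 1 / 128 * r)
      e = solve-∀ ring

    tight-form : ∀ {x} → x ≡ - q³ → - q³ + 0ℚ * (D + q³) + 0ℚ * (+ 1 / 128 * q³) ≤ℚ x
    tight-form x≡ = ℚ.≤-reflexive (trans (e q³ D) (sym x≡))
      where
      e : ∀ r d → - r + 0ℚ * (d + r) + 0ℚ * (+ 1 / 128 * r) ≡ - r
      e = solve-∀ ring

    zero-form : - (ρ * q³) ≤ℚ 0ℚ
    zero-form = ℚ.neg-antimono-≤ (nonneg ρ ⊠ 0≤q³)

    -- The sign of (-q)^|R| asks for a lower bound on the average when |R| is even and for an upper
    -- bound when it is odd. Beyond q³ there remains a factor q in the first case and q² in the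
    -- second.
    long : ∀ xs j → length xs ≡ 4 ℕ.+ j → Good xs → - (ρ * q³) ≤ℚ (- q) ^ℚ length xs * Λ̂ xs
    long xs j len good with even? j
    long xs j len good | inj₁ ev with even-power ev
    ... | 0≤t , t≤1 = by-diff (0≤q³ ⊠ ((0≤q ⊠ 0≤t) ⊠ diff (even-gap ev xs len good) ⊞ nonneg ρ ⊠ (0≤1-q ⊞ 0≤q ⊠ diff t≤1)))
                        (trans (cong (λ m → (- q) ^ℚ m * Λ̂ xs - - (ρ * q³)) len) (e q ((- q) ^ℚ j) (Λ̂ xs)))
      where
      e : ∀ q t l → (- q * (- q * (- q * (- q * t)))) * l - - (+ 127 / 128 * (q * (q * q))) ≡
        q * (q * q) * ((q * t) * (l - - (+ 127 / 128)) + + 127 / 128 * ((1ℚ - q) + q * (1ℚ - t)))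
      e = solve-∀ ring
    long xs (suc j) len good | inj₂ (2+ ev) with even-power ev
    ... | 0≤t , t≤1 = by-diff (0≤q³ ⊠ (0≤t ⊠ diff (odd-gap₅ ev xs len good) ⊞ nonneg ρ ⊠ diff t≤1))
                        (trans (cong (λ m → (- q) ^ℚ m * Λ̂ xs - - (ρ * q³)) len) (e q ((- q) ^ℚ j) (Λ̂ xs)))
      where
      e : ∀ q t l → (- q * (- q * (- q * (- q * (- q * t))))) * l - - (+ 127 / 128 * (q * (q * q))) ≡
        q * (q * q) * (t * (+ 127 / 128 - q * q * l) + + 127 / 128 * (1ℚ - t))
      e = solve-∀ ring

  -- The indicators are there so that one sum against the Fourier weights yields the total weight,
  -- the squared mean and the slack weight together.
  eigenvalue-bound : ∀ xs → Unique xs → - q³ + 𝟙 (null xs) * (D + q³) + 𝟙 (slack xs) * (+ 1 / 128 * q³) ≤ℚ (- q) ^ℚ length xs * Λ⁰ D A B g xs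
  eigenvalue-bound xs u with hasZero xs in z
  eigenvalue-bound (x ∷ xs) u | true = slack-form (subst (- (ρ * q³) ≤ℚ_) (sym (trans (cong ((- q) ^ℚ length (x ∷ xs) *_) (Λ⁰-zero D A B g (x ∷ xs) z)) (ℚ.*-zeroʳ ((- q) ^ℚ length (x ∷ xs))))) zero-form)
  eigenvalue-bound xs u | false rewrite Λ⁰-nonzero D A B g xs z = go xs (hasZero-false xs z , u)
    where
    go : ∀ xs → Good xs → - q³ + 𝟙 (null xs) * (D + q³) + 𝟙 (wide xs) * (+ 1 / 128 * q³) ≤ℚ (- q) ^ℚ length xs * Λ̂ xs
    go [] _ = ℚ.≤-reflexive (trans (e q³ D) (cong (1ℚ *_) (sym (Λ-[] {n} D A B g))))
      where
      e : ∀ r d → - r + 1ℚ * (d + r) + 0ℚ * (+ 1 / 128 * r) ≡ 1ℚ * d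
      e = solve-∀ ring
    go (x ∷ []) (x≢0 ∷ [] , _) = tight-form (trans (cong (- q * 1ℚ *_) (Λ-single D A B g x x≢0)) (e q))
      where
      e : ∀ q → - q * 1ℚ * (½ * ((1ℚ + 3ℚ * q + 3ℚ * (q * q)) + - (1ℚ + 3ℚ * q + q * q))) ≡ - (q * (q * q))
      e = solve-∀ ring
    go (x ∷ y ∷ []) good = tight-form (trans (cong (- q * (- q * 1ℚ) *_) (Λ-pair D A B g x y good)) (e q))
      where
      e : ∀ q → - q * (- q * 1ℚ) * (½ * ½ * ((1ℚ + 3ℚ * q + 3ℚ * (q * q)) + (1ℚ + 1ℚ) * - (1ℚ + 3ℚ * q + q * q) + (1ℚ - q - q * q))) ≡ - (q * (q * q))
      e = solve-∀ ring
    go (x ∷ y ∷ z ∷ []) good with is0 (total (x ∷ y ∷ z ∷ [])) in s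
    ... | true = tight-form (trans (cong (- q * (- q * (- q * 1ℚ)) *_) (Λ-schur D A B g x y z (Good-++ˡ (x ∷ y ∷ []) good) (schur-eq x y z s))) (e q))
      where
      e : ∀ q → - q * (- q * (- q * 1ℚ)) * (½ * ½ * ((1ℚ + 3ℚ * q + 3ℚ * (q * q)) + (1ℚ + 1ℚ + 1ℚ) * (1ℚ - q - q * q))) ≡ - (q * (q * q))
      e = solve-∀ ring
    ... | false = slack-form (by-diff (0≤q³ ⊠ diff (odd-gap₃ x y z good s)) (e q (Λ̂ (x ∷ y ∷ z ∷ []))))
      where
      e : ∀ q l → - q * (- q * (- q * 1ℚ)) * l - - (+ 127 / 128 * (q * (q * q))) ≡ q * (q * q) * (+ 127 / 128 - l)
      e = solve-∀ ring
    go xs@(_ ∷ _ ∷ _ ∷ _ ∷ ys) good = slack-form (long xs (length ys) refl good)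

  -- The profile 1, −1, 1, 0 gives singletons and pairs eigenvalue 0, which isolates the weight of the Schur triples.
  schur-eigenvalue : ∀ xs → Unique xs → 𝟙 (null xs) + - (𝟙 (schur xs) * q³) + - 𝟙 (slack xs) ≤ℚ (- q) ^ℚ length xs * Λ⁰ 1ℚ (- 1ℚ) 1ℚ 0ℚ xs
  schur-eigenvalue xs u with hasZero xs in z
  schur-eigenvalue xs@(_ ∷ _) u | true rewrite Λ⁰-zero 1ℚ (- 1ℚ) 1ℚ 0ℚ xs z | ℚ.*-zeroʳ ((- q) ^ℚ length xs) | hasZero⇒¬schur xs z =
    subst (_≤ℚ 0ℚ) (sym (e q³)) (dec≤ (- 1ℚ) 0ℚ)
    where
    e : ∀ r → 0ℚ + - (0ℚ * r) + - 1ℚ ≡ - 1ℚ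
    e = solve-∀ ring
  schur-eigenvalue xs u | false rewrite Λ⁰-nonzero 1ℚ (- 1ℚ) 1ℚ 0ℚ xs z = go xs (hasZero-false xs z , u) z
    where
    Λ′ : List (Point n) → ℚ
    Λ′ = Λ 1ℚ (- 1ℚ) 1ℚ 0ℚ
    bounds : ∀ X → - 1ℚ ≤ℚ γ {n} 1ℚ (- 1ℚ) 1ℚ 0ℚ X × γ {n} 1ℚ (- 1ℚ) 1ℚ 0ℚ X ≤ℚ 1ℚ
    bounds [] = dec≤ _ _ , dec≤ _ _
    bounds (_ ∷ []) = dec≤ _ _ , dec≤ _ _
    bounds (_ ∷ _ ∷ []) = dec≤ _ _ , dec≤ _ _
    bounds (_ ∷ _ ∷ _ ∷ []) = dec≤ _ _ , dec≤ _ _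
    bounds (a ∷ b ∷ c ∷ d ∷ []) with is0 (total (a ∷ b ∷ c ∷ d ∷ []))
    ... | true = dec≤ _ _ , dec≤ _ _
    ... | false = dec≤ _ _ , dec≤ _ _
    bounds (_ ∷ _ ∷ _ ∷ _ ∷ _ ∷ _) = dec≤ _ _ , dec≤ _ _
    generic : ∀ xs → 0ℚ + - (0ℚ * q³) + - 1ℚ ≤ℚ (- q) ^ℚ length xs * Λ′ xs
    generic xs = subst (_≤ℚ (- q) ^ℚ length xs * Λ′ xs) (e q³) (-1≤xy (proj₁ (power-bounds (length xs))) (proj₂ (power-bounds (length xs)))
      (subst (_≤ℚ Λ′ xs) (wsum-const {N = n} refl (- 1ℚ)) (𝔼ᵤ-mono (λ w → proj₁ (bounds (hits w xs)))))
      (subst (Λ′ xs ≤ℚ_) (wsum-const {N = n} refl 1ℚ) (𝔼ᵤ-mono (λ w → proj₂ (bounds (hits w xs))))))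
      where
      e : ∀ r → - 1ℚ ≡ 0ℚ + - (0ℚ * r) + - 1ℚ
      e = solve-∀ ring
    go : ∀ xs → Good xs → hasZero xs ≡ false → 𝟙 (null xs) + - (𝟙 (schur xs) * q³) + - 𝟙 (wide xs) ≤ℚ (- q) ^ℚ length xs * Λ′ xs
    go [] _ _ = ℚ.≤-reflexive (trans (e q³) (cong (1ℚ *_) (sym (Λ-[] {n} 1ℚ (- 1ℚ) 1ℚ 0ℚ))))
      where
      e : ∀ r → 1ℚ + - (0ℚ * r) + - 0ℚ ≡ 1ℚ * 1ℚ
      e = solve-∀ ring
    go (x ∷ []) (x≢0 ∷ [] , _) _ = ℚ.≤-reflexive (trans (e q³ (- q)) (cong (- q * 1ℚ *_) (sym (Λ-single 1ℚ (- 1ℚ) 1ℚ 0ℚ x x≢0))))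
      where
      e : ∀ r q → 0ℚ + - (0ℚ * r) + - 0ℚ ≡ q * 1ℚ * (½ * (1ℚ + - 1ℚ))
      e = solve-∀ ring
    go (x ∷ y ∷ []) good _ = ℚ.≤-reflexive (trans (e q³ (- q)) (cong (- q * (- q * 1ℚ) *_) (sym (Λ-pair 1ℚ (- 1ℚ) 1ℚ 0ℚ x y good))))
      where
      e : ∀ r q → 0ℚ + - (0ℚ * r) + - 0ℚ ≡ q * (q * 1ℚ) * (½ * ½ * (1ℚ + (1ℚ + 1ℚ) * - 1ℚ + 1ℚ))
      e = solve-∀ ring
    go (x ∷ y ∷ z ∷ []) good hz rewrite hz with is0 (total (x ∷ y ∷ z ∷ [])) in s
    ... | true = ℚ.≤-reflexive (trans (e q) (cong (- q * (- q * (- q * 1ℚ)) *_) (sym (Λ-schur 1ℚ (- 1ℚ) 1ℚ 0ℚ x y z (Good-++ˡ (x ∷ y ∷ []) good) (schur-eq x y z s)))))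
      where
      e : ∀ q → 0ℚ + - (1ℚ * (q * (q * q))) + - 0ℚ ≡ - q * (- q * (- q * 1ℚ)) * (½ * ½ * (1ℚ + (1ℚ + 1ℚ + 1ℚ) * 1ℚ))
      e = solve-∀ ring
    ... | false = generic (x ∷ y ∷ z ∷ [])
    go xs@(_ ∷ _ ∷ _ ∷ _ ∷ ys) good _ = generic xs

-- Hoffman bound and structure of near-extremal families

_≤ᵇ_ : ℚ → ℚ → Bool
a ≤ᵇ b with a ℚ.≤? b
... | yes _ = true
... | no _ = false

≤ᵇ-true : ∀ a b → (a ≤ᵇ b) ≡ true → a ≤ℚ b
≤ᵇ-true a b e with a ℚ.≤? b
... | yes a≤b = a≤b

≤ᵇ-false : ∀ a b → (a ≤ᵇ b) ≡ false → b ≤ℚ a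
≤ᵇ-false a b e with a ℚ.≤? b
... | no a≰b = ℚ.<⇒≤ (ℚ.≰⇒> a≰b)

at : ∀ {n N} → Vec (Point n) N → Vec Bool N → Point n → Bool
at [] [] z = false
at (x ∷ P) (s ∷ S) z = if is0 (x ⊕ z) then s else at P S z

schur⇒¬slack : ∀ {n} (xs : List (Point n)) → schur xs ≡ true → slack xs ≡ false × length xs ≡ 3
schur⇒¬slack xs@(_ ∷ _ ∷ _ ∷ []) e = trans (sym (Bool.not-involutive (slack xs))) (cong not e) , refl

-- A set without slack and with two hits is a pair or a Schur triple; in the latter case the missed
-- point is the sum of the hits. Such a set is thus nearly determined by its hit part.
tight-misses : ∀ {n} (f : Point n → Bool) xs → slack xs ≡ false → length (filterᵇ f xs) ≡ 2 →
  filterᵇ (not ∘ f) xs ≡ [] ⊎ filterᵇ (not ∘ f) xs ≡ total (filterᵇ f xs) ∷ []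
tight-misses f xs tight two = go xs (proj₂ (∨-false {hasZero xs} tight)) (trans (cong (ℕ._+ length (filterᵇ (not ∘ f) xs)) (sym two)) (length-split f xs)) (total-split f xs)
  where
  misses = filterᵇ (not ∘ f) xs
  nil : ∀ ys → 2 ℕ.+ length ys ≡ 2 → ys ≡ []
  nil [] _ = refl
  one : ∀ ys s → 2 ℕ.+ length ys ≡ 3 → s ⊕ total ys ≡ 0v → ys ≡ s ∷ []
  one (y ∷ []) s _ e = cong (_∷ []) (trans (sym (⊕-identityʳ y)) (sym (⊕≡0⇒≡ s (y ⊕ 0v) e)))
  go : ∀ ys → wide ys ≡ false → 2 ℕ.+ length misses ≡ length ys → total (filterᵇ f xs) ⊕ total misses ≡ total ys →
    misses ≡ [] ⊎ misses ≡ total (filterᵇ f xs) ∷ []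
  go (_ ∷ _ ∷ []) _ l _ = inj₁ (nil misses l)
  go (a ∷ b ∷ c ∷ []) s l t with is0 (total (a ∷ b ∷ c ∷ [])) in e
  ... | true = inj₂ (one misses (total (filterᵇ f xs)) l (trans t (is0-sound _ e)))

schur-miss : ∀ {n} (f : Point n → Bool) xs → schur xs ≡ true → length (filterᵇ f xs) ≡ 2 → filterᵇ (not ∘ f) xs ≡ total (filterᵇ f xs) ∷ []
schur-miss f xs s two with schur⇒¬slack xs s
... | tight , three with tight-misses f xs tight two
... | inj₂ e = e
... | inj₁ e with () ← trans (sym three) (trans (sym (length-split f xs)) (cong₂ (λ k l → k ℕ.+ length l) two e))

module Core {n N : ℕ} (P : Vec (Point n) N) (P-unique : Unique (toList P))
  (p q : ℚ) (q-eq : q * (1ℚ - p) ≡ p) (0≤p : 0ℚ ≤ℚ p) (p≤1-p : p ≤ℚ 1ℚ - p) (0≤q : 0ℚ ≤ℚ q) (q≤1 : q ≤ℚ 1ℚ)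
  (comp : Bool → Bool → Bool) (comp-tf : comp true false ≡ true) (comp-ft : comp false true ≡ true)
  (comp-ff : comp false false ≡ true ⊎ q ≡ 1ℚ)
  (F : Vec Bool N → Bool)
  (orth : ∀ w S T → F S ≡ true → Compat comp (map (hit w) P) S T → F T ≡ false) where

  open Fourier p q q-eq
  open Spectrum {n} q 0≤q q≤1 using (D; A; B; g; 0≤1-q)
  open Eigenvalues {n} q 0≤q q≤1

  0≤1-p : 0ℚ ≤ℚ 1ℚ - p
  0≤1-p = ℚ.≤-trans 0≤p p≤1-p

  𝔼-mono : ∀ {f g : Vec Bool N → ℚ} → (∀ S → f S ≤ℚ g S) → 𝔼 f ≤ℚ 𝔼 g
  𝔼-mono = wsum-mono 0≤1-p 0≤p

  f : Vec Bool N → ℚ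
  f S = 𝟙 (F S)

  mean : ℚ
  mean = 𝔼 f

  w₂ : Vec Bool N → ℚ
  w₂ = W f

  0≤v : 0ℚ ≤ℚ v
  0≤v = 0≤p ⊠ 0≤1-p

  0≤W : ∀ R → 0ℚ ≤ℚ w₂ R
  0≤W R = pow-nonneg 0≤v R ⊠ square-nonneg (ft f R)

  pts : Vec Bool N → List (Point n)
  pts R = sel R P

  mask : Point n → Vec Bool N
  mask w = map (hit w) P

  f·op≡0 : ∀ w Y S → f S * op (mask w) Y f S ≡ 0ℚ
  f·op≡0 w Y S with F S in e
  ... | false = ℚ.*-zeroˡ (op (mask w) Y f S)
  ... | true = trans (cong (1ℚ *_) (op-vanish comp-tf comp-ft comp-ff (mask w) Y S f (λ T c → cong 𝟙 (orth w S T e c)))) (ℚ.*-zeroʳ 1ℚ)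

  -- There is one vanishing relation for each Y, so the profile may be chosen freely. Two different
  -- profiles are used, for `hoffman` and for `schur-weight`.
  eigen-identity : ∀ D A B g → Σᵥ (λ R → (- q) ^ℚ length (pts R) * Λ⁰ D A B g (pts R) * w₂ R) ≡ 0ℚ
  eigen-identity D A B g = begin
    Σᵥ (λ R → (- q) ^ℚ length (pts R) * Λ⁰ D A B g (pts R) * w₂ R)
      ≡⟨ wsum-cong (λ R → trans (cong (λ x → x * Λ⁰ D A B g (pts R) * w₂ R) (sym (pow-sel (- q) R P)))
           (trans (e (pow (- q) R) (Λ⁰ D A B g (pts R)) (w₂ R)) (sym (wsum-* (pow (- q) R * w₂ R) (λ w → G (filterᵇ (hit w) (pts R))))))) ⟩
    Σᵥ (λ R → 𝔼ᵤ (λ w → pow (- q) R * w₂ R * G (filterᵇ (hit w) (pts R))))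
      ≡⟨ wsum-swap (λ R w → pow (- q) R * w₂ R * G (filterᵇ (hit w) (pts R))) ⟩
    𝔼ᵤ (λ w → Σᵥ (λ R → pow (- q) R * w₂ R * G (filterᵇ (hit w) (pts R))))
      ≡⟨ wsum-cong (λ w → trans (wsum-cong (λ R → trans (cong (λ X → pow (- q) R * w₂ R * G X) (sym (sel-∩ (hit w) R P))) (e′ (pow (- q) R) (w₂ R) (G (pts (R ∩ mask w))))))
           (Σ-op f (mask w) (f·op≡0 w) (G ∘ pts))) ⟩
    𝔼ᵤ {n} (λ w → 0ℚ)
      ≡⟨ wsum-0 {N = n} ⟩
    0ℚ ∎
    where
    open ≡-Reasoning
    G : List (Point n) → ℚ
    G X = if hasZero X then 0ℚ else γ D A B g X
    e : ∀ a l w → a * l * w ≡ a * w * l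
    e = solve-∀ ring
    e′ : ∀ a w x → a * w * x ≡ a * x * w
    e′ = solve-∀ ring

  ΣW≡mean : Σᵥ w₂ ≡ mean
  ΣW≡mean = trans (sym (parseval (ft f) (ft f))) (wsum-cong (λ S → trans (cong₂ _*_ (ft-inv f S) (ft-inv f S)) (𝟙-idem (F S))))

  pow-∅ : ∀ x {N} → pow x (∅ {N}) ≡ 1ℚ
  pow-∅ x {zero} = refl
  pow-∅ x {suc N} = pow-∅ x {N}

  W∅ : w₂ ∅ ≡ mean * mean
  W∅ = trans (cong₂ (λ a b → a * (b * b)) (pow-∅ v {N}) (ft-∅ f)) (ℚ.*-identityˡ _)

  Wₛ W₃ : ℚ
  Wₛ = Σᵥ (λ R → 𝟙 (slack (pts R)) * w₂ R)
  W₃ = Σᵥ (λ R → 𝟙 (schur (pts R)) * w₂ R)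

  0≤Wₛ : 0ℚ ≤ℚ Wₛ
  0≤Wₛ = Σᵥ-nonneg (λ R → 𝟙-nonneg (slack (pts R)) ⊠ 0≤W R)

  0≤W₃ : 0ℚ ≤ℚ W₃
  0≤W₃ = Σᵥ-nonneg (λ R → 𝟙-nonneg (schur (pts R)) ⊠ 0≤W R)

  pts-unique : ∀ R → Unique (pts R)
  pts-unique R = sel-Unique R P P-unique

  hoffman : - q³ * mean + (D + q³) * (mean * mean) + + 1 / 128 * q³ * Wₛ ≤ℚ 0ℚ
  hoffman = subst₂ _≤ℚ_ sums (eigen-identity D A B g) (Σᵥ-mono (λ R → *-monoʳ (0≤W R) (eigenvalue-bound (pts R) (pts-unique R))))
    where
    e : ∀ a b c x y w → (a + x * b + y * c) * w ≡ 1ℚ * (a * w + b * (x * w)) + c * (y * w)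
    e = solve-∀ ring
    sums : Σᵥ (λ R → (- q³ + 𝟙 (null (pts R)) * (D + q³) + 𝟙 (slack (pts R)) * (+ 1 / 128 * q³)) * w₂ R)
      ≡ - q³ * mean + (D + q³) * (mean * mean) + + 1 / 128 * q³ * Wₛ
    sums = trans (wsum-cong (λ R → e (- q³) (D + q³) (+ 1 / 128 * q³) (𝟙 (null (pts R))) (𝟙 (slack (pts R))) (w₂ R)))
      (trans (wsum-lin 1ℚ (+ 1 / 128 * q³) (λ R → - q³ * w₂ R + (D + q³) * (𝟙 (null (pts R)) * w₂ R)) (λ R → 𝟙 (slack (pts R)) * w₂ R))
      (cong (_+ + 1 / 128 * q³ * Wₛ) (trans (ℚ.*-identityˡ _) (trans (wsum-lin (- q³) (D + q³) w₂ (λ R → 𝟙 (null (pts R)) * w₂ R))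
        (cong₂ (λ s t → - q³ * s + (D + q³) * t) ΣW≡mean (trans (Σᵥ-null P w₂) W∅))))))

  -- A family of large mean must put weight on Schur triples: under the second profile only they and
  -- the slack sets can balance the positive contribution of the empty frequency.
  schur-weight : mean * mean ≤ℚ q³ * W₃ + Wₛ
  schur-weight = by-diff (diff bound) (e (mean * mean) (q³ * W₃) Wₛ)
    where
    e : ∀ m a b → a + b - m ≡ 0ℚ - (m + - a + - b)
    e = solve-∀ ring
    e′ : ∀ r x y z w → (x + - (y * r) + - z) * w ≡ 1ℚ * (1ℚ * (x * w) + - r * (y * w)) + - 1ℚ * (z * w)
    e′ = solve-∀ ring
    e″ : ∀ m r a b → 1ℚ * (1ℚ * m + - r * a) + - 1ℚ * b ≡ m + - (r * a) + - b
    e″ = solve-∀ ring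
    sums : Σᵥ (λ R → (𝟙 (null (pts R)) + - (𝟙 (schur (pts R)) * q³) + - 𝟙 (slack (pts R))) * w₂ R) ≡ mean * mean + - (q³ * W₃) + - Wₛ
    sums = trans (wsum-cong (λ R → e′ q³ (𝟙 (null (pts R))) (𝟙 (schur (pts R))) (𝟙 (slack (pts R))) (w₂ R)))
      (trans (wsum-lin 1ℚ (- 1ℚ) (λ R → 1ℚ * (𝟙 (null (pts R)) * w₂ R) + - q³ * (𝟙 (schur (pts R)) * w₂ R)) (λ R → 𝟙 (slack (pts R)) * w₂ R))
      (trans (cong (λ x → 1ℚ * x + - 1ℚ * Wₛ) (trans (wsum-lin 1ℚ (- q³) (λ R → 𝟙 (null (pts R)) * w₂ R) (λ R → 𝟙 (schur (pts R)) * w₂ R))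
        (cong (λ s → 1ℚ * s + - q³ * W₃) (trans (Σᵥ-null P w₂) W∅)))) (e″ (mean * mean) q³ W₃ Wₛ)))
    bound : mean * mean + - (q³ * W₃) + - Wₛ ≤ℚ 0ℚ
    bound = subst₂ _≤ℚ_ sums (eigen-identity 1ℚ (- 1ℚ) 1ℚ 0ℚ) (Σᵥ-mono (λ R → *-monoʳ (0≤W R) (schur-eigenvalue (pts R) (pts-unique R))))

  -- Coordinates on which the family is nearly constant

  μ₁ μ₀ θ : Point n → ℚ
  μ₁ z = 𝔼 (λ S → f S * 𝟙 (at P S z))
  μ₀ z = 𝔼 (λ S → f S * 𝟙 (not (at P S z)))
  -- The least measure of members to discard before all remaining ones agree at `z`.
  θ z = μ₁ z ⊓ μ₀ z

  0≤θ : ∀ z → 0ℚ ≤ℚ θ z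
  0≤θ z = ℚ.⊓-glb (wsum-nonneg 0≤1-p 0≤p (λ S → 𝟙-nonneg (F S) ⊠ 𝟙-nonneg (at P S z))) (wsum-nonneg 0≤1-p 0≤p (λ S → 𝟙-nonneg (F S) ⊠ 𝟙-nonneg (not (at P S z))))

  Θ : List (Point n) → ℚ
  Θ [] = 0ℚ
  Θ (x ∷ xs) = θ x + Θ xs

  ift-δ : ∀ {N} (c : Vec Bool N → ℚ) X S → ift (λ R → 𝟙 (R == X) * c R) S ≡ c X * χ X S
  ift-δ c [] [] = trans (ℚ.*-identityˡ (c [])) (sym (ℚ.*-identityʳ (c [])))
  ift-δ c (false ∷ X) (s ∷ S) = trans (cong₂ (λ a b → a + ψ s * b) (ift-δ (c ∘ (false ∷_)) X S) (ift-* 0ℚ (c ∘ (true ∷_)) S))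
    (e (c (false ∷ X) * χ X S) (ψ s) (ift (c ∘ (true ∷_)) S))
    where
    e : ∀ a b c → a + b * (0ℚ * c) ≡ a
    e = solve-∀ ring
  ift-δ c (true ∷ X) (s ∷ S) = trans (cong₂ (λ a b → a + ψ s * b) (ift-* 0ℚ (c ∘ (false ∷_)) S) (ift-δ (c ∘ (true ∷_)) X S))
    (e (ift (c ∘ (false ∷_)) S) (ψ s) (c (true ∷ X)) (χ X S))
    where
    e : ∀ a b c d → 0ℚ * a + b * (c * d) ≡ c * (b * d)
    e = solve-∀ ring

  κ-part : ∀ {N} (h R : Vec Bool N) → κ h (R ∩ h) (R ∩ h) ≡ 1ℚ
  κ-part [] [] = refl
  κ-part (true ∷ h) (true ∷ R) = trans (ℚ.*-identityˡ _) (κ-part h R)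
  κ-part (true ∷ h) (false ∷ R) = trans (ℚ.*-identityˡ _) (κ-part h R)
  κ-part (false ∷ h) (true ∷ R) = trans (ℚ.*-identityˡ _) (κ-part h R)
  κ-part (false ∷ h) (false ∷ R) = trans (ℚ.*-identityˡ _) (κ-part h R)

  κ-whole : ∀ {N} (h R : Vec Bool N) → κ h (R ∩ h) R ≡ pow (- q) (R ∩ ∁ h)
  κ-whole [] [] = refl
  κ-whole (true ∷ h) (true ∷ R) = trans (ℚ.*-identityˡ _) (κ-whole h R)
  κ-whole (true ∷ h) (false ∷ R) = trans (ℚ.*-identityˡ _) (κ-whole h R)
  κ-whole (false ∷ h) (true ∷ R) = cong (- q *_) (κ-whole h R)
  κ-whole (false ∷ h) (false ∷ R) = trans (ℚ.*-identityˡ _) (κ-whole h R)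

  κ²-bound : ∀ {N} (h Y R : Vec Bool N) → κ h Y R * κ h Y R ≤ℚ 𝟙 ((R ∩ h) == Y)
  κ²-bound [] [] [] = ℚ.≤-refl
  κ²-bound (h ∷ hs) (y ∷ Y) (r ∷ R) = subst (_≤ℚ 𝟙 (((r ∷ R) ∩ (h ∷ hs)) == (y ∷ Y))) (e (κ₁ h y r) (κ hs Y R)) (step h y r)
    where
    e : ∀ a b → (a * a) * (b * b) ≡ (a * b) * (a * b)
    e = solve-∀ ring
    k² = κ hs Y R * κ hs Y R
    keep : 1ℚ * 1ℚ * k² ≤ℚ 𝟙 ((R ∩ hs) == Y)
    keep = subst (_≤ℚ 𝟙 ((R ∩ hs) == Y)) (sym (ℚ.*-identityˡ k²)) (κ²-bound hs Y R)
    kill : 0ℚ * 0ℚ * k² ≤ℚ 0ℚ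
    kill = ℚ.≤-reflexive (ℚ.*-zeroˡ k²)
    shrink : - q * - q * k² ≤ℚ 𝟙 ((R ∩ hs) == Y)
    shrink = ℚ.≤-trans (by-diff (0≤1-q ⊠ (nonneg 1ℚ ⊞ 0≤q) ⊠ square-nonneg (κ hs Y R)) (e′ q k²)) (κ²-bound hs Y R)
      where
      e′ : ∀ q k → k - - q * - q * k ≡ (1ℚ - q) * (1ℚ + q) * k
      e′ = solve-∀ ring
    step : ∀ h y r → κ₁ h y r * κ₁ h y r * k² ≤ℚ 𝟙 (not ((r ∧ h) xor y) ∧ ((R ∩ hs) == Y))
    step true true true = keep
    step true true false = kill
    step true false true = kill
    step true false false = keep
    step false true true = kill
    step false true false = kill
    step false false true = shrink
    step false false false = keep

  χ-split : ∀ {N} (h R S : Vec Bool N) → χ R S ≡ χ (R ∩ h) S * χ (R ∩ ∁ h) S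
  χ-split [] [] [] = refl
  χ-split (h ∷ hs) (false ∷ R) (s ∷ S) = χ-split hs R S
  χ-split (true ∷ hs) (true ∷ R) (s ∷ S) = trans (cong (ψ s *_) (χ-split hs R S)) (sym (ℚ.*-assoc (ψ s) _ _))
  χ-split (false ∷ hs) (true ∷ R) (s ∷ S) = trans (cong (ψ s *_) (χ-split hs R S)) (*-swap (ψ s) (χ (R ∩ hs) S) (χ (R ∩ ∁ hs) S))

  χ-nil : ∀ {N} (Q : Vec (Point n) N) Z S → sel Z Q ≡ [] → χ Z S ≡ 1ℚ
  χ-nil [] [] [] _ = refl
  χ-nil (x ∷ Q) (false ∷ Z) (s ∷ S) e = χ-nil Q Z S e

  χ-single : ∀ {N} (Q : Vec (Point n) N) → Unique (toList Q) → ∀ Z S {z} → sel Z Q ≡ z ∷ [] → χ Z S ≡ ψ (at Q S z)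
  χ-single [] _ [] [] ()
  χ-single (x ∷ Q) (x∉Q ∷ _) (true ∷ Z) (s ∷ S) e with List.∷-injective e
  ... | refl , e′ rewrite ⊕-self x | is0-0v {n} = trans (cong (ψ s *_) (χ-nil Q Z S e′)) (ℚ.*-identityʳ (ψ s))
  χ-single (x ∷ Q) (x∉Q ∷ u) (false ∷ Z) (s ∷ S) {z} e with subst (All (x ≢_)) e (sel-All Z Q x∉Q)
  ... | x≢z ∷ [] rewrite ≢0⇒is0-false (λ e′ → x≢z (⊕≡0⇒≡ x z e′)) = χ-single Q u Z S e

  -- Both values of ψ have modulus at least p, since p ≤ 1 - p.
  χ²-bound : ∀ {N} (R S : Vec Bool N) → pow (p * p) R ≤ℚ χ R S * χ R S
  χ²-bound [] [] = ℚ.≤-refl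
  χ²-bound (false ∷ R) (s ∷ S) = χ²-bound R S
  χ²-bound (true ∷ R) (s ∷ S) = ℚ.≤-trans (*-monoˡ (0≤p ⊠ 0≤p) (χ²-bound R S))
    (subst (p * p * (χ R S * χ R S) ≤ℚ_) (e (ψ s) (χ R S)) (*-monoʳ (square-nonneg (χ R S)) (ψ² s)))
    where
    e : ∀ a b → a * a * (b * b) ≡ a * b * (a * b)
    e = solve-∀ ring
    ψ² : ∀ s → p * p ≤ℚ ψ s * ψ s
    ψ² false = ℚ.≤-reflexive (sym (neg-neg p))
    ψ² true = by-diff (diff p≤1-p ⊠ (0≤1-p ⊞ 0≤p)) (e′ p)
      where
      e′ : ∀ p → (1ℚ - p) * (1ℚ - p) - p * p ≡ (1ℚ - p - p) * ((1ℚ - p) + p)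
      e′ = solve-∀ ring

  v≤1 : v ≤ℚ 1ℚ
  v≤1 = by-diff (square-nonneg (1ℚ - p) ⊞ 0≤p) (e p)
    where
    e : ∀ p → 1ℚ - p * (1ℚ - p) ≡ (1ℚ - p) * (1ℚ - p) + p
    e = solve-∀ ring

  pow-v≤1 : ∀ {N} (R : Vec Bool N) → pow v R ≤ℚ 1ℚ
  pow-v≤1 [] = ℚ.≤-refl
  pow-v≤1 (false ∷ R) = pow-v≤1 R
  pow-v≤1 (true ∷ R) = ℚ.≤-trans (*-monoˡ 0≤v (pow-v≤1 R)) (subst (_≤ℚ 1ℚ) (sym (ℚ.*-identityʳ v)) v≤1)

  -- The ½ comes from u² + t² ≥ (u - t)²/2, the p⁴ from the characters of the two hit points, and
  -- the q² from the chain acting on the missed point.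
  c₀ : ℚ
  c₀ = ½ * (p * p * (p * p)) * (q * q)

  missed : Point n → Vec Bool N → List (Point n)
  missed w R = filterᵇ (not ∘ hit w) (pts R)

  module Local (w : Point n) (R : Vec Bool N) (sch : schur (pts R) ≡ true) (two : length (filterᵇ (hit w) (pts R)) ≡ 2) where

    h Y Z : Vec Bool N
    h = mask w
    Y = R ∩ h
    Z = R ∩ ∁ h

    z : Point n
    z = total (filterᵇ (hit w) (pts R))

    pts-Y : pts Y ≡ filterᵇ (hit w) (pts R)
    pts-Y = sel-∩ (hit w) R P

    pts-Z : pts Z ≡ z ∷ []
    pts-Z = trans (sel-∩∁ (hit w) R P) (schur-miss (hit w) (pts R) sch two)

    a b : ℚ
    a = ft f Y
    b = - q * ft f R

    main e c : Vec Bool N → ℚ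
    c R′ = κ h Y R′ * ft f R′
    main S = χ Y S * (a + b * ψ (at P S z))
    e S = ift (λ R′ → 𝟙 (not ((R′ == Y) ∨ (R′ == R))) * c R′) S

    Y≢R : Y ≢ R
    Y≢R Y≡R with () ← trans (sym two) (trans (cong length (sym pts-Y)) (trans (cong (length ∘ pts) Y≡R) (proj₂ (schur⇒¬slack (pts R) sch))))

    op-split : ∀ S → op h Y f S ≡ main S + e S
    op-split S = trans (ift-cong (λ R′ → split R′) S)
      (trans (ift-+ (λ R′ → 𝟙 (R′ == Y) * c R′ + 𝟙 (R′ == R) * c R′) (λ R′ → 𝟙 (not ((R′ == Y) ∨ (R′ == R))) * c R′) S)
      (cong (_+ e S) (trans (ift-+ (λ R′ → 𝟙 (R′ == Y) * c R′) (λ R′ → 𝟙 (R′ == R) * c R′) S) (trans (cong₂ _+_ (ift-δ c Y S) (ift-δ c R S))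
        (trans (cong₂ (λ s t → s * ft f Y * χ Y S + t * ft f R * χ R S) (κ-part h R) (trans (κ-whole h R) (trans (pow-sel (- q) Z P) (cong (λ l → (- q) ^ℚ length l) pts-Z))))
        (trans (cong (λ s → 1ℚ * ft f Y * χ Y S + - q * 1ℚ * ft f R * s) (trans (χ-split h R S) (cong (χ Y S *_) (χ-single P P-unique Z S pts-Z))))
        (fin (ft f Y) (χ Y S) (- q) (ft f R) (ψ (at P S z)))))))))
      where
      fin : ∀ a x q r s → 1ℚ * a * x + q * 1ℚ * r * (x * s) ≡ x * (a + q * r * s)
      fin = solve-∀ ring
      e₁ : ∀ c → c ≡ 1ℚ * c + 0ℚ * c + 0ℚ * c
      e₁ = solve-∀ ring
      e₂ : ∀ c → c ≡ 0ℚ * c + 1ℚ * c + 0ℚ * c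
      e₂ = solve-∀ ring
      e₃ : ∀ c → c ≡ 0ℚ * c + 0ℚ * c + 1ℚ * c
      e₃ = solve-∀ ring
      split : ∀ R′ → c R′ ≡ 𝟙 (R′ == Y) * c R′ + 𝟙 (R′ == R) * c R′ + 𝟙 (not ((R′ == Y) ∨ (R′ == R))) * c R′
      split R′ with R′ == Y in eY | R′ == R in eR
      ... | true | true = ⊥-elim (Y≢R (trans (sym (==-sound R′ Y eY)) (==-sound R′ R eR)))
      ... | true | false = e₁ (c R′)
      ... | false | true = e₂ (c R′)
      ... | false | false = e₃ (c R′)

    rel : Vec Bool N → Bool
    rel R′ = slack (pts R′) ∧ ((R′ ∩ h) == Y)

    -- By `tight-misses`, a frequency without slack whose hit part is `Y` misses either nothing or
    -- exactly `z`, so it is `Y` or `R`. The error term therefore lives on slack frequencies.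
    others-slack : ∀ R′ → R′ ∩ h ≡ Y → R′ ≢ Y → R′ ≢ R → slack (pts R′) ≡ true
    others-slack R′ same R′≢Y R′≢R with slack (pts R′) in s
    ... | true = refl
    ... | false = ⊥-elim (absurd (tight-misses (hit w) (pts R′) s (trans (cong length same-hits) two)))
      where
      same-hits : filterᵇ (hit w) (pts R′) ≡ filterᵇ (hit w) (pts R)
      same-hits = trans (sym (sel-∩ (hit w) R′ P)) (trans (cong pts same) pts-Y)
      Y∩h : ∀ {N} (R h : Vec Bool N) → (R ∩ h) ∩ h ≡ R ∩ h
      Y∩h [] [] = refl
      Y∩h (r ∷ R) (h ∷ hs) = cong₂ _∷_ (trans (Bool.∧-assoc r h h) (cong (r ∧_) (Bool.∧-idem h))) (Y∩h R hs)
      Y∩∁h : ∀ {N} (R h : Vec Bool N) → (R ∩ h) ∩ ∁ h ≡ ∅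
      Y∩∁h [] [] = refl
      Y∩∁h (r ∷ R) (h ∷ hs) = cong₂ _∷_ (trans (Bool.∧-assoc r h (not h)) (trans (cong (r ∧_) (Bool.∧-inverseʳ h)) (Bool.∧-zeroʳ r))) (Y∩∁h R hs)
      sel-∅ : ∀ {N} (Q : Vec (Point n) N) → sel ∅ Q ≡ []
      sel-∅ [] = refl
      sel-∅ (_ ∷ Q) = sel-∅ Q
      absurd : filterᵇ (not ∘ hit w) (pts R′) ≡ [] ⊎ filterᵇ (not ∘ hit w) (pts R′) ≡ total (filterᵇ (hit w) (pts R′)) ∷ [] → ⊥
      absurd (inj₁ none) = R′≢Y (∩-glue h R′ Y (trans same (sym (Y∩h R h)))
        (trans (sel-injective (R′ ∩ ∁ h) ∅ P P-unique (trans (sel-∩∁ (hit w) R′ P) (trans none (sym (sel-∅ P))))) (sym (Y∩∁h R h))))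
      absurd (inj₂ one) = R′≢R (∩-glue h R′ R same
        (sel-injective (R′ ∩ ∁ h) Z P P-unique (trans (sel-∩∁ (hit w) R′ P) (trans one (trans (cong (λ l → total l ∷ []) same-hits) (sym pts-Z))))))

    error : ℚ
    error = Σᵥ (λ R′ → 𝟙 (rel R′) * w₂ R′)

    𝔼e²≤error : 𝔼 (λ S → e S * e S) ≤ℚ error
    𝔼e²≤error = subst (_≤ℚ error) (sym (parseval c₂ c₂)) (Σᵥ-mono bound)
      where
      c₂ : Vec Bool N → ℚ
      c₂ R′ = 𝟙 (not ((R′ == Y) ∨ (R′ == R))) * c R′
      e₁ : ∀ x κ f → (x * (κ * f)) * (x * (κ * f)) ≡ x * x * (κ * κ) * (f * f)
      e₁ = solve-∀ ring
      e₂ : ∀ x v f → v * (x * f) ≡ x * (v * f)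
      e₂ = solve-∀ ring
      coeff : ∀ R′ → 𝟙 (not ((R′ == Y) ∨ (R′ == R))) * 𝟙 (not ((R′ == Y) ∨ (R′ == R))) * (κ h Y R′ * κ h Y R′) ≤ℚ 𝟙 (rel R′)
      coeff R′ with R′ == Y in eY | R′ == R in eR
      ... | true | _ = subst (_≤ℚ 𝟙 (rel R′)) (sym (ℚ.*-zeroˡ (κ h Y R′ * κ h Y R′))) (𝟙-nonneg (rel R′))
      ... | false | true = subst (_≤ℚ 𝟙 (rel R′)) (sym (ℚ.*-zeroˡ (κ h Y R′ * κ h Y R′))) (𝟙-nonneg (rel R′))
      ... | false | false = subst (_≤ℚ 𝟙 (rel R′)) (sym (ℚ.*-identityˡ (κ h Y R′ * κ h Y R′))) (ℚ.≤-trans (κ²-bound h Y R′) (ℚ.≤-reflexive (cong 𝟙 (imp ((R′ ∩ h) == Y) refl))))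
        where
        ≢-from : ∀ X → (R′ == X) ≡ false → R′ ≢ X
        ≢-from X e refl with () ← trans (sym e) (==-refl R′)
        imp : ∀ d → (R′ ∩ h) == Y ≡ d → d ≡ slack (pts R′) ∧ d
        imp false _ = sym (Bool.∧-zeroʳ (slack (pts R′)))
        imp true d rewrite others-slack R′ (==-sound (R′ ∩ h) Y d) (≢-from Y eY) (≢-from R eR) = refl
      bound : ∀ R′ → pow v R′ * (c₂ R′ * c₂ R′) ≤ℚ 𝟙 (rel R′) * w₂ R′
      bound R′ = subst₂ _≤ℚ_ (cong (pow v R′ *_) (sym (e₁ (𝟙 (not ((R′ == Y) ∨ (R′ == R)))) (κ h Y R′) (ft f R′)))) (e₂ (𝟙 (rel R′)) (pow v R′) (ft f R′ * ft f R′))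
        (*-monoˡ (pow-nonneg 0≤v R′) (*-monoʳ (square-nonneg (ft f R′)) (coeff R′)))

    p⁴ : ℚ
    p⁴ = p * p * (p * p)

    -- On the family `main` + `e` vanishes; multiply by `main` - `e`.
    fm²≡fe² : ∀ S → f S * (main S * main S) ≡ f S * (e S * e S)
    fm²≡fe² S = trans (e₁ (f S) (main S) (e S)) (trans (cong (λ x → f S * (e S * e S) + x * (main S - e S)) (trans (cong (f S *_) (sym (op-split S))) (f·op≡0 w Y S))) (e₂ (f S * (e S * e S)) (main S - e S)))
      where
      e₁ : ∀ f m e → f * (m * m) ≡ f * (e * e) + f * (m + e) * (m - e)
      e₁ = solve-∀ ring
      e₂ : ∀ x y → x + 0ℚ * y ≡ x
      e₂ = solve-∀ ring

    -- `u` and `t` are the values of the second factor of `main` for z in S and z not in S. They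
    -- differ by `b`, so whatever `a` is they cannot both be small.
    lower : p⁴ * (½ * (b * b) * θ z) ≤ℚ 𝔼 (λ S → f S * (main S * main S))
    lower = ℚ.≤-trans (*-monoˡ 0≤p⁴ quadratic) (subst (_≤ℚ 𝔼 (λ S → f S * (main S * main S))) (trans (wsum-* p⁴ (λ S → u * u * (f S * 𝟙 (at P S z)) + t * t * (f S * 𝟙 (not (at P S z))))) (cong (p⁴ *_) (wsum-lin (u * u) (t * t) (λ S → f S * 𝟙 (at P S z)) (λ S → f S * 𝟙 (not (at P S z)))))) (𝔼-mono pointwise))
      where
      0≤p⁴ : 0ℚ ≤ℚ p⁴
      0≤p⁴ = 0≤p ⊠ 0≤p ⊠ (0≤p ⊠ 0≤p)
      u t : ℚ
      u = a + b * (1ℚ - p)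
      t = a + b * - p
      quadratic : ½ * (b * b) * θ z ≤ℚ u * u * μ₁ z + t * t * μ₀ z
      quadratic = by-diff (square-nonneg u ⊠ diff (ℚ.p⊓q≤p (μ₁ z) (μ₀ z)) ⊞ square-nonneg t ⊠ diff (ℚ.p⊓q≤q (μ₁ z) (μ₀ z)) ⊞ nonneg ½ ⊠ square-nonneg (u + t) ⊠ 0≤θ z) (e₁ a b p (μ₁ z) (μ₀ z) (θ z))
        where
        e₁ : ∀ a b p m n h → let u = a + b * (1ℚ - p) ; t = a + b * - p in
          u * u * m + t * t * n - ½ * (b * b) * h ≡ u * u * (m - h) + t * t * (n - h) + ½ * ((u + t) * (u + t)) * h
        e₁ = solve-∀ ring
      pow-Y : pow (p * p) Y ≡ p⁴
      pow-Y = trans (pow-sel (p * p) Y P) (trans (cong (λ l → (p * p) ^ℚ l) (trans (cong length pts-Y) two)) (cong (p * p *_) (ℚ.*-identityʳ (p * p))))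
      cases : ∀ s → (a + b * ψ s) * (a + b * ψ s) ≡ u * u * 𝟙 s + t * t * 𝟙 (not s)
      cases true = e₂ (u * u) (t * t)
        where
        e₂ : ∀ x y → x ≡ x * 1ℚ + y * 0ℚ
        e₂ = solve-∀ ring
      cases false = e₂ (u * u) (t * t)
        where
        e₂ : ∀ x y → y ≡ x * 0ℚ + y * 1ℚ
        e₂ = solve-∀ ring
      pointwise : ∀ S → p⁴ * (u * u * (f S * 𝟙 (at P S z)) + t * t * (f S * 𝟙 (not (at P S z)))) ≤ℚ f S * (main S * main S)
      pointwise S = subst₂ _≤ℚ_
        (trans (cong (λ x → f S * (p⁴ * x)) (cases (at P S z))) (e₃ (f S) p⁴ (u * u) (t * t) (𝟙 (at P S z)) (𝟙 (not (at P S z)))))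
        (cong (f S *_) (e₄ (χ Y S) (a + b * ψ (at P S z))))
        (*-monoˡ (𝟙-nonneg (F S)) (*-monoʳ (square-nonneg (a + b * ψ (at P S z))) (subst (_≤ℚ χ Y S * χ Y S) pow-Y (χ²-bound Y S))))
        where
        e₃ : ∀ f p u t x y → f * (p * (u * x + t * y)) ≡ p * (u * (f * x) + t * (f * y))
        e₃ = solve-∀ ring
        e₄ : ∀ x y → x * x * (y * y) ≡ x * y * (x * y)
        e₄ = solve-∀ ring

    local-bound : c₀ * w₂ R * Θ (missed w R) ≤ℚ error
    local-bound = ℚ.≤-trans step (ℚ.≤-trans lower (ℚ.≤-trans (ℚ.≤-reflexive (wsum-cong fm²≡fe²)) (ℚ.≤-trans (𝔼-mono drop-f) 𝔼e²≤error)))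
      where
      drop-f : ∀ S → f S * (e S * e S) ≤ℚ e S * e S
      drop-f S with F S
      ... | true = ℚ.≤-reflexive (ℚ.*-identityˡ _)
      ... | false = subst (_≤ℚ e S * e S) (sym (ℚ.*-zeroˡ (e S * e S))) (square-nonneg (e S))
      e₁ : ∀ p q v r h → p * p * (p * p) * (½ * (- q * r * (- q * r)) * h) - ½ * (p * p * (p * p)) * (q * q) * (v * (r * r)) * (h + 0ℚ)
        ≡ ½ * (p * p * (p * p)) * (q * q) * (r * r) * h * (1ℚ - v)
      e₁ = solve-∀ ring
      step : c₀ * w₂ R * Θ (missed w R) ≤ℚ p⁴ * (½ * (b * b) * θ z)
      step = subst (λ l → c₀ * w₂ R * Θ l ≤ℚ p⁴ * (½ * (b * b) * θ z)) (sym (schur-miss (hit w) (pts R) sch two))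
        (by-diff (nonneg ½ ⊠ (0≤p ⊠ 0≤p ⊠ (0≤p ⊠ 0≤p)) ⊠ (0≤q ⊠ 0≤q) ⊠ square-nonneg (ft f R) ⊠ 0≤θ z ⊠ diff (pow-v≤1 R)) (e₁ p q (pow v R) (ft f R) (θ z)))

  twoᵇ : Point n → List (Point n) → Bool
  twoᵇ w xs = length (filterᵇ (hit w) xs) ℕ.≡ᵇ 2

  ∧-true : ∀ {a b} → a ∧ b ≡ true → a ≡ true × b ≡ true
  ∧-true {true} {true} _ = refl , refl

  -- For a fixed functional each slack frequency is charged to at most one triple: the two hit
  -- points determine the third as their sum. Summing the local errors therefore costs no
  -- multiplicity.
  per-functional : ∀ w → Σᵥ (λ R → 𝟙 (schur (pts R) ∧ twoᵇ w (pts R)) * (c₀ * w₂ R * Θ (missed w R))) ≤ℚ Wₛ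
  per-functional w = begin
    Σᵥ (λ R → 𝟙 (s R) * (c₀ * w₂ R * Θ (missed w R)))
      ≤⟨ Σᵥ-mono local ⟩
    Σᵥ (λ R → 𝟙 (s R) * Σᵥ (err R))
      ≡⟨ wsum-cong (λ R → sym (wsum-* (𝟙 (s R)) (err R))) ⟩
    Σᵥ (λ R → Σᵥ (λ R′ → 𝟙 (s R) * err R R′))
      ≡⟨ wsum-swap (λ R R′ → 𝟙 (s R) * err R R′) ⟩
    Σᵥ (λ R′ → Σᵥ (λ R → 𝟙 (s R) * err R R′))
      ≤⟨ Σᵥ-mono once ⟩
    Wₛ ∎
    where
    open ℚ.≤-Reasoning
    h = mask w
    s : Vec Bool N → Bool
    s R = schur (pts R) ∧ twoᵇ w (pts R)
    err : Vec Bool N → Vec Bool N → ℚ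
    err R R′ = 𝟙 (slack (pts R′) ∧ ((R′ ∩ h) == (R ∩ h))) * w₂ R′
    local : ∀ R → 𝟙 (s R) * (c₀ * w₂ R * Θ (missed w R)) ≤ℚ 𝟙 (s R) * Σᵥ (err R)
    local R with s R in sR
    ... | false = ℚ.≤-reflexive (trans (ℚ.*-zeroˡ (c₀ * w₂ R * Θ (missed w R))) (sym (ℚ.*-zeroˡ (Σᵥ (err R)))))
    ... | true with ∧-true {schur (pts R)} sR
    ... | sch , two = *-monoˡ (nonneg 1ℚ) (Local.local-bound w R sch (≡ᵇ-sound _ 2 two))
    unique : ∀ R₁ R₂ → s R₁ ≡ true → s R₂ ≡ true → R₁ ∩ h ≡ R₂ ∩ h → R₁ ≡ R₂
    unique R₁ R₂ s₁ s₂ same with ∧-true {schur (pts R₁)} s₁ | ∧-true {schur (pts R₂)} s₂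
    ... | sch₁ , two₁ | sch₂ , two₂ = ∩-glue h R₁ R₂ same (sel-injective (R₁ ∩ ∁ h) (R₂ ∩ ∁ h) P P-unique
      (trans (Local.pts-Z w R₁ sch₁ (≡ᵇ-sound _ 2 two₁)) (trans (cong (λ l → total l ∷ []) (trans (sym (sel-∩ (hit w) R₁ P)) (trans (cong pts same) (sel-∩ (hit w) R₂ P))))
        (sym (Local.pts-Z w R₂ sch₂ (≡ᵇ-sound _ 2 two₂))))))
    once : ∀ R′ → Σᵥ (λ R → 𝟙 (s R) * err R R′) ≤ℚ 𝟙 (slack (pts R′)) * w₂ R′
    once R′ = subst₂ _≤ℚ_
      (trans (sym (wsum-* (𝟙 (slack (pts R′)) * w₂ R′) (λ R → 𝟙 (s R ∧ ((R′ ∩ h) == (R ∩ h)))))) (wsum-cong (λ R → rearrange (s R) (slack (pts R′)) ((R′ ∩ h) == (R ∩ h)) (w₂ R′))))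
      (ℚ.*-identityʳ (𝟙 (slack (pts R′)) * w₂ R′))
      (*-monoˡ (𝟙-nonneg (slack (pts R′)) ⊠ 0≤W R′) (Σᵥ-unique (λ R → s R ∧ ((R′ ∩ h) == (R ∩ h))) (λ R₁ R₂ b₁ b₂ → same R₁ R₂ (∧-true {s R₁} b₁) (∧-true {s R₂} b₂))))
      where
      same : ∀ R₁ R₂ → s R₁ ≡ true × ((R′ ∩ h) == (R₁ ∩ h)) ≡ true → s R₂ ≡ true × ((R′ ∩ h) == (R₂ ∩ h)) ≡ true → R₁ ≡ R₂
      same R₁ R₂ (s₁ , e₁) (s₂ , e₂) = unique R₁ R₂ s₁ s₂ (trans (sym (==-sound (R′ ∩ h) (R₁ ∩ h) e₁)) (==-sound (R′ ∩ h) (R₂ ∩ h) e₂))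
      z₁ : ∀ x w → x * w * 0ℚ ≡ 0ℚ
      z₁ = solve-∀ ring
      z₂ : ∀ w → 1ℚ * w * 1ℚ ≡ 1ℚ * (1ℚ * w)
      z₂ = solve-∀ ring
      z₃ : ∀ w x → 0ℚ * w * x ≡ 1ℚ * (0ℚ * w)
      z₃ = solve-∀ ring
      rearrange : ∀ a b c w → 𝟙 b * w * 𝟙 (a ∧ c) ≡ 𝟙 a * (𝟙 (b ∧ c) * w)
      rearrange false b c w = trans (z₁ (𝟙 b) w) (sym (ℚ.*-zeroˡ (𝟙 (b ∧ c) * w)))
      rearrange true true true w = z₂ w
      rearrange true true false w = trans (z₁ 1ℚ w) (sym (trans (ℚ.*-identityˡ (0ℚ * w)) (ℚ.*-zeroˡ w)))
      rearrange true false c w = z₃ w (𝟙 c)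

  -- A functional either vanishes on the whole triple or is 1 on exactly two of its points, and each
  -- point is the missed one with probability 1/4.
  average-miss : ∀ xs → Unique xs → schur xs ≡ true → 𝔼ᵤ (λ w → 𝟙 (twoᵇ w xs) * Θ (filterᵇ (not ∘ hit w) xs)) ≡ + 1 / 4 * Θ xs
  average-miss xs@(x ∷ y ∷ z ∷ []) u sch with ∨-false {hasZero xs} (proj₁ (schur⇒¬slack xs sch))
  ... | hz , wd = trans (wsum-cong pick) (trans (uniform (x ∷ y ∷ []) (ind nz u) Φ) (fin (θ x) (θ y) (θ z)))
    where
    vs : Vec (Point n) 3
    vs = x ∷ y ∷ z ∷ []
    nz : All (_≢ 0v) xs
    nz = hasZero-false xs hz
    ind : All (_≢ 0v) xs → Unique xs → Indep (x ∷ y ∷ [])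
    ind (x≢0 ∷ y≢0 ∷ _) ((x≢y ∷ _) ∷ _) = distinct⇒indep x y x≢0 y≢0 x≢y
    z≡ : z ≡ x ⊕ y
    z≡ = schur-eq x y z (trans (sym (Bool.not-involutive _)) (cong not wd))
    Φ : Vec Bool 2 → ℚ
    Φ (a ∷ b ∷ []) = 𝟙 (length (sel (a ∷ b ∷ (a xor b) ∷ []) vs) ℕ.≡ᵇ 2) * Θ (sel (not a ∷ not b ∷ not (a xor b) ∷ []) vs)
    dot-z : ∀ w → dot w z ≡ dot w x xor dot w y
    dot-z w = trans (cong (dot w) z≡) (dot-⊕ʳ w x y)
    hit-dot : ∀ {v} w → v ≢ 0v → hit w v ≡ dot w v
    hit-dot w v≢0 rewrite ≢0⇒is0-false v≢0 = refl
    hit-bits : ∀ w → map (hit w) vs ≡ dot w x ∷ dot w y ∷ (dot w x xor dot w y) ∷ []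
    hit-bits w with nz
    ... | x≢0 ∷ y≢0 ∷ z≢0 ∷ [] = cong₂ _∷_ (hit-dot w x≢0) (cong₂ _∷_ (hit-dot w y≢0) (cong (_∷ []) (trans (hit-dot w z≢0) (dot-z w))))
    pick : ∀ w → 𝟙 (twoᵇ w xs) * Θ (filterᵇ (not ∘ hit w) xs) ≡ Φ (dots w (x ∷ y ∷ []))
    pick w = cong₂ (λ l m → 𝟙 (length l ℕ.≡ᵇ 2) * Θ m) (trans (filterᵇ-sel (hit w) vs) (cong (λ bs → sel bs vs) (hit-bits w)))
      (trans (filterᵇ-sel (not ∘ hit w) vs) (trans (cong (λ bs → sel bs vs) (sym (∁-map (hit w) vs))) (cong (λ bs → sel (∁ bs) vs) (hit-bits w))))
    fin : ∀ x y z → ½ * (½ * (0ℚ * (x + (y + (z + 0ℚ)))) + ½ * (1ℚ * (x + 0ℚ))) + ½ * (½ * (1ℚ * (y + 0ℚ)) + ½ * (1ℚ * (z + 0ℚ))) ≡ + 1 / 4 * (x + (y + (z + 0ℚ)))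
    fin = solve-∀ ring

  Schur-Θ-bound : c₀ * (+ 1 / 4) * Σᵥ (λ R → 𝟙 (schur (pts R)) * w₂ R * Θ (pts R)) ≤ℚ Wₛ
  Schur-Θ-bound = subst₂ _≤ℚ_
    (trans (sym (wsum-swap (λ R w → 𝟙 (schur (pts R) ∧ twoᵇ w (pts R)) * (c₀ * w₂ R * Θ (missed w R)))))
      (trans (wsum-cong average) (wsum-* (c₀ * (+ 1 / 4)) (λ R → 𝟙 (schur (pts R)) * w₂ R * Θ (pts R)))))
    (wsum-const {N = n} refl Wₛ) (𝔼ᵤ-mono per-functional)
    where
    average : ∀ R → 𝔼ᵤ (λ w → 𝟙 (schur (pts R) ∧ twoᵇ w (pts R)) * (c₀ * w₂ R * Θ (missed w R))) ≡ c₀ * (+ 1 / 4) * (𝟙 (schur (pts R)) * w₂ R * Θ (pts R))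
    average R with schur (pts R) in sch
    ... | false = trans (wsum-cong (λ w → ℚ.*-zeroˡ (c₀ * w₂ R * Θ (missed w R)))) (trans (wsum-0 {N = n}) (e c₀ (w₂ R) (Θ (pts R))))
      where
      e : ∀ c w t → 0ℚ ≡ c * (+ 1 / 4) * (0ℚ * w * t)
      e = solve-∀ ring
    ... | true = trans (wsum-cong (λ w → *-swap (𝟙 (twoᵇ w (pts R))) (c₀ * w₂ R) (Θ (missed w R))))
        (trans (wsum-* (c₀ * w₂ R) (λ w → 𝟙 (twoᵇ w (pts R)) * Θ (missed w R)))
        (trans (cong (c₀ * w₂ R *_) (average-miss (pts R) (pts-unique R) sch)) (e₂ c₀ (w₂ R) (Θ (pts R)))))
      where
      e₂ : ∀ c w t → c * w * (+ 1 / 4 * t) ≡ c * (+ 1 / 4) * (1ℚ * w * t)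
      e₂ = solve-∀ ring

  private
    1+q : (1ℚ + q) * (1ℚ - p) ≡ 1ℚ
    1+q = trans (e q p) (trans (cong (λ x → 1ℚ - p + x) q-eq) (e′ p))
      where
      e : ∀ q p → (1ℚ + q) * (1ℚ - p) ≡ 1ℚ - p + q * (1ℚ - p)
      e = solve-∀ ring
      e′ : ∀ p → 1ℚ - p + p ≡ 1ℚ
      e′ = solve-∀ ring

  p³ : ℚ
  p³ = p * (p * p)

  0≤p³ : 0ℚ ≤ℚ p³
  0≤p³ = 0≤p ⊠ (0≤p ⊠ 0≤p)

  -- Multiplication by (1 - p)³ turns q³ into p³, and turns D + q³ = (1 + q)³ into 1.
  hoffman′ : mean * mean + + 1 / 128 * p³ * Wₛ ≤ℚ p³ * mean
  hoffman′ = by-diff (diff scaled) (trans (e p mean Wₛ) (sym (trans (e₁ q (1ℚ - p) mean Wₛ) (cong₂ (λ x y → 0ℚ - (- (x * (x * x)) * mean + y * (y * y) * (mean * mean) + + 1 / 128 * (x * (x * x)) * Wₛ)) q-eq 1+q))))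
    where
    s³ : ℚ
    s³ = (1ℚ - p) * ((1ℚ - p) * (1ℚ - p))
    scaled : s³ * (- q³ * mean + (D + q³) * (mean * mean) + + 1 / 128 * q³ * Wₛ) ≤ℚ 0ℚ
    scaled = subst (s³ * (- q³ * mean + (D + q³) * (mean * mean) + + 1 / 128 * q³ * Wₛ) ≤ℚ_) (ℚ.*-zeroʳ s³) (*-monoˡ (0≤1-p ⊠ (0≤1-p ⊠ 0≤1-p)) hoffman)
    e : ∀ p m w → p * (p * p) * m - (m * m + + 1 / 128 * (p * (p * p)) * w) ≡ 0ℚ - (- (p * (p * p)) * m + 1ℚ * (1ℚ * 1ℚ) * (m * m) + + 1 / 128 * (p * (p * p)) * w)
    e = solve-∀ ring
    e₁ : ∀ q s m w → 0ℚ - s * (s * s) * (- (q * (q * q)) * m + (1ℚ + 3ℚ * q + 3ℚ * (q * q) + q * (q * q)) * (m * m) + + 1 / 128 * (q * (q * q)) * w)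
      ≡ 0ℚ - (- (q * s * (q * s * (q * s))) * m + (1ℚ + q) * s * ((1ℚ + q) * s * ((1ℚ + q) * s)) * (m * m) + + 1 / 128 * (q * s * (q * s * (q * s))) * w)
    e₁ = solve-∀ ring

  0≤mean : 0ℚ ≤ℚ mean
  0≤mean = wsum-nonneg 0≤1-p 0≤p (λ S → 𝟙-nonneg (F S))

  cancelˡ : ∀ {a x y} → 0ℚ <ℚ a → a * x ≤ℚ a * y → x ≤ℚ y
  cancelˡ {a} 0<a = ℚ.*-cancelˡ-≤-pos a {{ℚ.positive 0<a}}

  mean≤p³ : mean ≤ℚ p³
  mean≤p³ with mean ℚ.≤? p³
  ... | yes m≤ = m≤
  ... | no m≰ = cancelˡ (ℚ.≤-<-trans 0≤p³ (ℚ.≰⇒> m≰)) (ℚ.≤-trans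
    (by-diff (nonneg (+ 1 / 128) ⊠ 0≤p³ ⊠ 0≤Wₛ) (e (mean * mean) (+ 1 / 128 * p³ * Wₛ))) (ℚ.≤-trans hoffman′ (ℚ.≤-reflexive (ℚ.*-comm p³ mean))))
    where
    e : ∀ x y → x + y - x ≡ y
    e = solve-∀ ring

  p⁶ p¹² : ℚ
  p⁶ = p³ * p³
  p¹² = p⁶ * p⁶

  Triple : ℚ → Set
  Triple τ = ∃ λ x → ∃ λ y → ∃ λ z → SchurTriple x y z × θ x ≤ℚ τ × θ y ≤ℚ τ × θ z ≤ℚ τ

  schur⇒Triple : ∀ xs → Unique xs → schur xs ≡ true → ∀ {τ} → Θ xs ≤ℚ τ → Triple τ
  schur⇒Triple xs@(x ∷ y ∷ z ∷ []) ((x≢y ∷ x≢z ∷ []) ∷ (y≢z ∷ []) ∷ _) sch {τ} Θ≤ with ∨-false {hasZero xs} (proj₁ (schur⇒¬slack xs sch))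
  ... | hz , wd with hasZero-false xs hz
  ... | x≢0 ∷ y≢0 ∷ z≢0 ∷ [] = x , y , z ,
    (x≢0 , y≢0 , z≢0 , x≢y , x≢z , y≢z , schur-eq x y z (trans (sym (Bool.not-involutive _)) (cong not wd))) ,
    ℚ.≤-trans (by-diff (0≤θ y ⊞ 0≤θ z) (e₁ (θ x) (θ y) (θ z))) Θ≤ ,
    ℚ.≤-trans (by-diff (0≤θ x ⊞ 0≤θ z) (e₂ (θ x) (θ y) (θ z))) Θ≤ ,
    ℚ.≤-trans (by-diff (0≤θ x ⊞ 0≤θ y) (e₃ (θ x) (θ y) (θ z))) Θ≤
    where
    e₁ : ∀ x y z → x + (y + (z + 0ℚ)) - x ≡ y + z
    e₁ = solve-∀ ring
    e₂ : ∀ x y z → x + (y + (z + 0ℚ)) - y ≡ x + z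
    e₂ = solve-∀ ring
    e₃ : ∀ x y z → x + (y + (z + 0ℚ)) - z ≡ x + y
    e₃ = solve-∀ ring

  -- Finding one Schur triple by averaging

  module Stability (0<p : 0ℚ <ℚ p) (ε : ℚ) (0<ε : 0ℚ <ℚ ε) (large : p³ - ε ≤ℚ mean) (small : + 1024 / 1 * ε ≤ℚ p⁶) where

    0<p³ : 0ℚ <ℚ p³
    0<p³ = 0<*0< 0<p (0<*0< 0<p 0<p)

    0≤1-p³ : 0ℚ ≤ℚ 1ℚ - p³
    0≤1-p³ = 1-x³-nonneg 0≤p 0≤1-p

    -- In `hoffman′` the slack weight is paid for by the deficit: p³ Wₛ/128 is at most mean · (p³ -
    -- mean), hence at most p³ε.
    Wₛ≤128ε : Wₛ ≤ℚ + 128 / 1 * ε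
    Wₛ≤128ε = cancelˡ 0<p³ (by-diff
      (nonneg (+ 128 / 1) ⊠ (diff hoffman′ ⊞ 0≤mean ⊠ diff large ⊞ diff mean≤p³ ⊠ ℚ.<⇒≤ 0<ε)) (e p³ mean ε Wₛ))
      where
      e : ∀ p m e w → p * (+ 128 / 1 * e) - p * w ≡ + 128 / 1 * ((p * m - (m * m + + 1 / 128 * p * w)) + m * (m - (p - e)) + (p - m) * e)
      e = solve-∀ ring

    mean≥ : ½ * p³ ≤ℚ mean
    mean≥ = by-diff (diff large ⊞ nonneg (+ 1 / 1024) ⊠ (diff small ⊞ 0≤p³ ⊠ (0≤1-p³ ⊞ nonneg (+ 511 / 1)))) (e p³ mean ε)
      where
      e : ∀ p m e → m - ½ * p ≡ (m - (p - e)) + + 1 / 1024 * ((p * p - + 1024 / 1 * e) + p * ((1ℚ - p) + + 511 / 1))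
      e = solve-∀ ring

    -- The squared mean is at least p⁶/4. The hypothesis 1024ε ≤ p⁶ is what makes the slack weight
    -- 128ε at most half of that.
    W₃≥ : + 1 / 8 * p⁶ ≤ℚ W₃
    W₃≥ = by-diff (1-x³-nonneg 0≤q 0≤1-q ⊠ 0≤W₃ ⊞ diff schur-weight ⊞ diff Wₛ≤128ε ⊞ diff mean≥ ⊠ (0≤mean ⊞ nonneg ½ ⊠ 0≤p³) ⊞ nonneg (+ 1 / 8) ⊠ diff small) (e q³ W₃ Wₛ mean p³ ε)
      where
      e : ∀ q w s m p e → w - + 1 / 8 * (p * p) ≡
        (1ℚ - q) * w + (q * w + s - m * m) + (+ 128 / 1 * e - s) + (m - ½ * p) * (m + ½ * p) + + 1 / 8 * (p * p - + 1024 / 1 * e)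
      e = solve-∀ ring

    X : ℚ
    X = Σᵥ (λ R → 𝟙 (schur (pts R)) * w₂ R * Θ (pts R))

    0≤Θ : ∀ xs → 0ℚ ≤ℚ Θ xs
    0≤Θ [] = nonneg 0ℚ
    0≤Θ (x ∷ xs) = 0≤θ x ⊞ 0≤Θ xs

    0≤X : 0ℚ ≤ℚ X
    0≤X = Σᵥ-nonneg (λ R → 𝟙-nonneg (schur (pts R)) ⊠ 0≤W R ⊠ 0≤Θ (pts R))

    -- As q ≥ p, the factor c₀/4 is at least p⁶/8.
    X≤ : p⁶ * X ≤ℚ + 1024 / 1 * ε
    X≤ = by-diff (nonneg (+ 8 / 1) ⊠ (diff Schur-Θ-bound ⊞ diff Wₛ≤128ε ⊞ nonneg (+ 1 / 8) ⊠ (0≤p ⊠ 0≤p ⊠ (0≤p ⊠ 0≤p)) ⊠ (0≤q-p ⊠ (0≤q ⊞ 0≤p)) ⊠ 0≤X)) (e p q X Wₛ ε)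
      where
      0≤q-p : 0ℚ ≤ℚ q - p
      0≤q-p = subst (0ℚ ≤ℚ_) (trans (e₁ p q) (cong (λ x → q - x) q-eq)) (0≤q ⊠ 0≤p)
        where
        e₁ : ∀ p q → q * p ≡ q - q * (1ℚ - p)
        e₁ = solve-∀ ring
      e : ∀ p q x w e → + 1024 / 1 * e - p * (p * p) * (p * (p * p)) * x ≡
        + 8 / 1 * ((w - ½ * (p * p * (p * p)) * (q * q) * (+ 1 / 4) * x) + (+ 128 / 1 * e - w) + + 1 / 8 * (p * p * (p * p)) * ((q - p) * (q + p)) * x)
      e = solve-∀ ring

    -- If no triple had Θ at most τ, then X would be at least τ W₃ ≥ τp⁶/8, against p⁶X ≤ 1024ε;
    -- hence 8192 = 8 · 1024.
    find : ∀ τ → 0ℚ ≤ℚ τ → + 8192 / 1 * ε <ℚ p¹² * τ → Triple τ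
    find τ 0≤τ big = conclude (search close)
      where
      close : Vec Bool N → Bool
      close R = schur (pts R) ∧ (Θ (pts R) ≤ᵇ τ)
      extract : ∀ R → schur (pts R) ≡ true × (Θ (pts R) ≤ᵇ τ) ≡ true → Triple τ
      extract R (sch , le) = schur⇒Triple (pts R) (pts-unique R) sch (≤ᵇ-true (Θ (pts R)) τ le)
      conclude : (∃ λ R → close R ≡ true) ⊎ (∀ R → close R ≡ false) → Triple τ
      conclude (inj₁ (R , found)) = extract R (∧-true {schur (pts R)} found)
      conclude (inj₂ none) = ⊥-elim (ℚ.<-irrefl {x = + 8192 / 1 * ε} refl (ℚ.<-≤-trans big contra))
        where
        p⁶≥0 : 0ℚ ≤ℚ p⁶
        p⁶≥0 = 0≤p³ ⊠ 0≤p³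
        e : ∀ p e t x w → + 8192 / 1 * e - p * p * (p * p) * t ≡ + 8 / 1 * ((+ 1024 / 1 * e - p * p * x) + p * p * (x - t * w) + p * p * (t * (w - + 1 / 8 * (p * p))))
        e = solve-∀ ring
        X≥ : τ * W₃ ≤ℚ X
        X≥ = subst (_≤ℚ X) (wsum-* τ (λ R → 𝟙 (schur (pts R)) * w₂ R)) (Σᵥ-mono each)
          where
          each : ∀ R → τ * (𝟙 (schur (pts R)) * w₂ R) ≤ℚ 𝟙 (schur (pts R)) * w₂ R * Θ (pts R)
          each R with schur (pts R) | none R
          ... | false | _ = ℚ.≤-reflexive (e₁ τ (w₂ R) (Θ (pts R)))
            where
            e₁ : ∀ t w h → t * (0ℚ * w) ≡ 0ℚ * w * h
            e₁ = solve-∀ ring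
          ... | true | gt = subst (_≤ℚ 1ℚ * w₂ R * Θ (pts R)) (ℚ.*-comm (1ℚ * w₂ R) τ) (*-monoˡ (nonneg 1ℚ ⊠ 0≤W R) (≤ᵇ-false (Θ (pts R)) τ gt))
        contra : p¹² * τ ≤ℚ + 8192 / 1 * ε
        contra = by-diff (nonneg (+ 8 / 1) ⊠ (diff X≤ ⊞ p⁶≥0 ⊠ diff X≥ ⊞ p⁶≥0 ⊠ (0≤τ ⊠ diff W₃≥))) (e p³ ε τ X W₃)

-- Transfer to families of subsets of ℤ₂ⁿ

-- The order, and the empty block appended because 2 ^ suc n unfolds to 2 ^ n + (2 ^ n + 0), are
-- those of `idx`.
points : ∀ n → Vec (Point n) (2 ℕ.^ n)
points zero = [] ∷ []
points (suc n) = map (false ∷_) (points n) Vec.++ (map (true ∷_) (points n) Vec.++ [])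

lookup-points : ∀ {n} (x : Point n) → lookup (points n) (idx x) ≡ x
lookup-points [] = refl
lookup-points {suc n} (false ∷ x) = trans (Vec.lookup-++ˡ (map (false ∷_) (points n)) _ (idx x))
  (trans (Vec.lookup-map (idx x) (false ∷_) (points n)) (cong (false ∷_) (lookup-points x)))
lookup-points {suc n} (true ∷ x) = trans (Vec.lookup-++ʳ (map (false ∷_) (points n)) _ _)
  (trans (Vec.lookup-++ˡ (map (true ∷_) (points n)) [] (idx x)) (trans (Vec.lookup-map (idx x) (true ∷_) (points n)) (cong (true ∷_) (lookup-points x))))

points-unique : ∀ n → Unique (toList (points n))
points-unique zero = [] ∷ []
points-unique (suc n) = subst Unique (sym list) (AllPairs.++⁺ (Unique.map⁺ (cong Vec.tail) u) (Unique.map⁺ (cong Vec.tail) u)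
  (All.map⁺ (All.universal (λ x → All.map⁺ (All.universal (λ y ()) (toList (points n)))) (toList (points n)))))
  where
  u = points-unique n
  list : toList (points (suc n)) ≡ List.map (false ∷_) (toList (points n)) ++ List.map (true ∷_) (toList (points n))
  list = trans (Vec.toList-++ (map (false ∷_) (points n)) _) (cong₂ _++_ (Vec.toList-map (false ∷_) (points n))
    (trans (Vec.toList-++ (map (true ∷_) (points n)) []) (trans (List.++-identityʳ _) (Vec.toList-map (true ∷_) (points n)))))

idx-injective : ∀ {n} {x y : Point n} → idx x ≡ idx y → x ≡ y
idx-injective {n} {x} {y} e = trans (sym (lookup-points x)) (trans (cong (lookup (points n)) e) (lookup-points y))

lookup-≢ : ∀ {A : Set} {N} {y x : A} (Q : Vec A N) i → All (y ≢_) (toList Q) → lookup Q i ≡ x → y ≢ x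
lookup-≢ (q ∷ Q) zero (y≢q ∷ _) refl = y≢q
lookup-≢ (q ∷ Q) (suc i) (_ ∷ a) e = lookup-≢ Q i a e

at-lookup : ∀ {n N} (P : Vec (Point n) N) → Unique (toList P) → ∀ S i {x} → lookup P i ≡ x → at P S x ≡ lookup S i
at-lookup {n} (y ∷ P) u (s ∷ S) zero refl rewrite ⊕-self y | is0-0v {n} = refl
at-lookup (y ∷ P) (y∉P ∷ u) (s ∷ S) (suc i) {x} e rewrite ≢0⇒is0-false (λ z → lookup-≢ P i y∉P e (⊕≡0⇒≡ y x z)) = at-lookup P u S i e

Compat-lookup : ∀ {comp N} {h S T : Vec Bool N} → Compat comp h S T → ∀ i → lookup h i ≡ true ⊎ comp (lookup S i) (lookup T i) ≡ true
Compat-lookup (c ∷ _) zero = c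
Compat-lookup (_ ∷ cs) (suc i) = Compat-lookup cs i

odd : ℕ → Bool
odd zero = false
odd (suc k) = not (odd k)

odd-2+1 : ∀ l → odd (suc (2 ℕ.* l)) ≡ true
odd-2+1 zero = refl
odd-2+1 (suc l) = trans (cong (not ∘ odd) (cong suc (ℕ.+-suc l (l ℕ.+ 0)))) (trans (cong not (Bool.not-involutive _)) (odd-2+1 l))

dot-vsum : ∀ {n k} (w : Point n) (vs : Vec (Point n) k) → VecAll.All (λ x → dot w x ≡ true) vs → dot w (vsum vs) ≡ odd k
dot-vsum w [] _ = dot-0 w
dot-vsum w (x ∷ vs) (e VecAll.∷ es) = trans (dot-⊕ʳ w x (vsum vs)) (cong₂ _xor_ e (dot-vsum w vs es))

-- An odd dependency cannot lie in the complement of a hyperplane.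
OddDep⇒orth : ∀ {n} (comp : Bool → Bool → Bool) (w : Point n) (S T : Vec Bool (2 ℕ.^ n)) →
  OddDep (λ x → comp (x ∈ₛ sub S) (x ∈ₛ sub T) ≡ false) → ¬ Compat comp (map (hit w) (points n)) S T
OddDep⇒orth {n} comp w S T (l , vs , all , sum≡0) compat = absurd (trans (sym (odd-2+1 l)) (trans (sym (dot-vsum w vs (VecAll.map on-hyperplane all))) (trans (cong (dot w) sum≡0) (dot-0 w))))
  where
  absurd : true ≡ false → ⊥
  absurd ()
  on-hyperplane : ∀ {x} → x ≢ 0v × comp (x ∈ₛ sub S) (x ∈ₛ sub T) ≡ false → dot w x ≡ true
  on-hyperplane {x} (x≢0 , c) with Compat-lookup compat (idx x)
  ... | inj₂ c′ with () ← trans (sym c) c′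
  ... | inj₁ h = trans (cong (_∨ dot w x) (sym (≢0⇒is0-false x≢0))) (trans (cong (hit w) (sym (lookup-points x))) (trans (sym (Vec.lookup-map (idx x) (hit w) (points n))) h))

module Measure (p : ℚ) where

  𝔼ₚ : ∀ {N} → (Vec Bool N → ℚ) → ℚ
  𝔼ₚ = wsum (1ℚ - p) p

  1-p+p : 1ℚ - p + p ≡ 1ℚ
  1-p+p = e p
    where
    e : ∀ p → 1ℚ - p + p ≡ 1ℚ
    e = solve-∀ ring

  private
    ones : ∀ {N} → Vec Bool N → ℕ
    ones = Vec.count (λ b → b Bool.≟ true)

    ones≤ : ∀ {N} (b : Vec Bool N) → ones b ≤ N
    ones≤ [] = z≤n
    ones≤ (true ∷ b) = s≤s (ones≤ b)
    ones≤ (false ∷ b) = ℕ.m≤n⇒m≤1+n (ones≤ b)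

    weight : ∀ {N} → Vec Bool N → ℚ
    weight {N} b = (p ^ℚ ones b) * ((1ℚ - p) ^ℚ (N ℕ.∸ ones b))

    sumᴸ : List ℚ → ℚ
    sumᴸ = List.foldr _+_ 0ℚ

    sum-++ : ∀ xs ys → sumᴸ (xs ++ ys) ≡ sumᴸ xs + sumᴸ ys
    sum-++ [] ys = sym (ℚ.+-identityˡ (sumᴸ ys))
    sum-++ (x ∷ xs) ys = trans (cong (λ s → x + s) (sum-++ xs ys)) (sym (ℚ.+-assoc x (sumᴸ xs) (sumᴸ ys)))

    sum-* : ∀ {A : Set} c (h : A → ℚ) xs → sumᴸ (List.map (λ x → c * h x) xs) ≡ c * sumᴸ (List.map h xs)
    sum-* c h [] = sym (ℚ.*-zeroʳ c)
    sum-* c h (x ∷ xs) = trans (cong (λ s → c * h x + s) (sum-* c h xs)) (sym (ℚ.*-distribˡ-+ c (h x) (sumᴸ (List.map h xs))))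

    sum≡𝔼 : ∀ N (g : Vec Bool N → Bool) → sumᴸ (List.map (λ b → if g b then weight b else 0ℚ) (allVecs N)) ≡ 𝔼ₚ (𝟙 ∘ g)
    sum≡𝔼 zero g with g []
    ... | true = refl
    ... | false = refl
    sum≡𝔼 (suc N) g = begin
      sumᴸ (List.map t (List.map (false ∷_) (allVecs N) ++ List.map (true ∷_) (allVecs N)))
        ≡⟨ cong sumᴸ (List.map-++ t (List.map (false ∷_) (allVecs N)) (List.map (true ∷_) (allVecs N))) ⟩
      sumᴸ (List.map t (List.map (false ∷_) (allVecs N)) ++ List.map t (List.map (true ∷_) (allVecs N)))
        ≡⟨ sum-++ (List.map t (List.map (false ∷_) (allVecs N))) (List.map t (List.map (true ∷_) (allVecs N))) ⟩
      sumᴸ (List.map t (List.map (false ∷_) (allVecs N))) + sumᴸ (List.map t (List.map (true ∷_) (allVecs N)))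
        ≡⟨ cong₂ _+_ (half false (1ℚ - p) low) (half true p high) ⟩
      𝔼ₚ (𝟙 ∘ g) ∎
      where
      open ≡-Reasoning
      t : Vec Bool (suc N) → ℚ
      t b = if g b then weight b else 0ℚ
      low : ∀ b → weight (false ∷ b) ≡ (1ℚ - p) * weight b
      low b rewrite ℕ.+-∸-assoc 1 (ones≤ b) = *-swap (p ^ℚ ones b) (1ℚ - p) ((1ℚ - p) ^ℚ (N ℕ.∸ ones b))
      high : ∀ b → weight (true ∷ b) ≡ p * weight b
      high b = ℚ.*-assoc p (p ^ℚ ones b) ((1ℚ - p) ^ℚ (N ℕ.∸ ones b))
      half : ∀ s c → (∀ b → weight (s ∷ b) ≡ c * weight b) → sumᴸ (List.map t (List.map (s ∷_) (allVecs N))) ≡ c * 𝔼ₚ (𝟙 ∘ g ∘ (s ∷_))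
      half s c wt = trans (cong sumᴸ (sym (List.map-∘ (allVecs N)))) (trans (cong sumᴸ (List.map-cong scale (allVecs N)))
        (trans (sum-* c (λ b → if g (s ∷ b) then weight b else 0ℚ) (allVecs N)) (cong (c *_) (sum≡𝔼 N (g ∘ (s ∷_))))))
        where
        scale : ∀ b → t (s ∷ b) ≡ c * (if g (s ∷ b) then weight b else 0ℚ)
        scale b with g (s ∷ b)
        ... | true = wt b
        ... | false = sym (ℚ.*-zeroʳ c)

  μ≡𝔼 : ∀ {n} (F : Family n) → μ p F ≡ 𝔼ₚ (λ b → 𝟙 (F (sub b)))
  μ≡𝔼 {n} F = trans (cong sumᴸ (sym (List.map-∘ (allVecs (2 ℕ.^ n))))) (sum≡𝔼 (2 ℕ.^ n) (F ∘ sub))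

  condition : ∀ {N} (i : Fin N) (f : Vec Bool N → ℚ) → 𝔼ₚ f ≡ (1ℚ - p) * 𝔼ₚ (λ S → f (S [ i ]≔ false)) + p * 𝔼ₚ (λ S → f (S [ i ]≔ true))
  condition {suc N} zero f = cong₂ (λ s t → (1ℚ - p) * s + p * t) (const (𝔼ₚ (f ∘ (false ∷_)))) (const (𝔼ₚ (f ∘ (true ∷_))))
    where
    const : ∀ x → x ≡ (1ℚ - p) * x + p * x
    const x = e p x
      where
      e : ∀ p x → x ≡ (1ℚ - p) * x + p * x
      e = solve-∀ ring
  condition {suc N} (suc i) f = trans (cong₂ (λ s t → (1ℚ - p) * s + p * t) (condition i (f ∘ (false ∷_))) (condition i (f ∘ (true ∷_))))
    (e p (𝔼ₚ (λ S → f (false ∷ (S [ i ]≔ false)))) (𝔼ₚ (λ S → f (false ∷ (S [ i ]≔ true)))) (𝔼ₚ (λ S → f (true ∷ (S [ i ]≔ false)))) (𝔼ₚ (λ S → f (true ∷ (S [ i ]≔ true)))))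
    where
    e : ∀ p a b c d → (1ℚ - p) * ((1ℚ - p) * a + p * b) + p * ((1ℚ - p) * c + p * d) ≡ (1ℚ - p) * ((1ℚ - p) * a + p * c) + p * ((1ℚ - p) * b + p * d)
    e = solve-∀ ring

  agree : Bool → Bool → Bool
  agree a b = not (a xor b)

  pr : Bool → ℚ
  pr true = p
  pr false = 1ℚ - p

  independent-bit : ∀ {N} (i : Fin N) α (g : Vec Bool N → ℚ) → (∀ S b → g (S [ i ]≔ b) ≡ g S) → 𝔼ₚ (λ S → 𝟙 (agree (lookup S i) α) * g S) ≡ pr α * 𝔼ₚ g
  independent-bit {N} i α g inv = trans (condition i _) (trans (cong₂ (λ s t → (1ℚ - p) * s + p * t) (fix false) (fix true)) (value α))
    where
    fix : ∀ b → 𝔼ₚ (λ S → 𝟙 (agree (lookup (S [ i ]≔ b) i) α) * g (S [ i ]≔ b)) ≡ 𝟙 (agree b α) * 𝔼ₚ g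
    fix b = trans (wsum-cong (λ S → cong₂ (λ c x → 𝟙 (agree c α) * x) (Vec.lookup∘update i S b) (inv S b))) (wsum-* (𝟙 (agree b α)) g)
    value : ∀ α → (1ℚ - p) * (𝟙 (agree false α) * 𝔼ₚ g) + p * (𝟙 (agree true α) * 𝔼ₚ g) ≡ pr α * 𝔼ₚ g
    value true = e p (𝔼ₚ g)
      where
      e : ∀ p x → (1ℚ - p) * (0ℚ * x) + p * (1ℚ * x) ≡ p * x
      e = solve-∀ ring
    value false = e p (𝔼ₚ g)
      where
      e : ∀ p x → (1ℚ - p) * (1ℚ * x) + p * (0ℚ * x) ≡ (1ℚ - p) * x
      e = solve-∀ ring

  cylinder : ∀ {n} → Point n → Point n → Point n → Bool → Bool → Bool → Family n
  cylinder x y z α β δ S = agree (x ∈ₛ S) α ∧ (agree (y ∈ₛ S) β ∧ agree (z ∈ₛ S) δ)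

  𝟙-∧ : ∀ a b → 𝟙 (a ∧ b) ≡ 𝟙 a * 𝟙 b
  𝟙-∧ true b = sym (ℚ.*-identityˡ (𝟙 b))
  𝟙-∧ false b = sym (ℚ.*-zeroˡ (𝟙 b))

  cylinder-measure : ∀ {n} {x y z : Point n} → x ≢ y → x ≢ z → y ≢ z → ∀ α β δ → μ p (cylinder x y z α β δ) ≡ pr α * (pr β * pr δ)
  cylinder-measure {n} {x} {y} {z} x≢y x≢z y≢z α β δ = trans (μ≡𝔼 (cylinder x y z α β δ))
    (trans (wsum-cong (λ S → trans (𝟙-∧ (bit S x α) (bit S y β ∧ bit S z δ)) (cong (𝟙 (bit S x α) *_) (𝟙-∧ (bit S y β) (bit S z δ)))))
    (trans (independent-bit (idx x) α (λ S → 𝟙 (bit S y β) * 𝟙 (bit S z δ)) (λ S b → cong₂ (λ c d → 𝟙 (agree c β) * 𝟙 (agree d δ)) (skip x≢y S b) (skip x≢z S b)))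
    (cong (pr α *_) (trans (independent-bit (idx y) β (λ S → 𝟙 (bit S z δ)) (λ S b → cong (λ c → 𝟙 (agree c δ)) (skip y≢z S b)))
    (cong (pr β *_) (trans (wsum-cong (λ S → sym (ℚ.*-identityʳ (𝟙 (bit S z δ))))) (trans (independent-bit (idx z) δ (λ _ → 1ℚ) (λ _ _ → refl))
      (trans (cong (pr δ *_) (wsum-const {N = 2 ℕ.^ n} 1-p+p 1ℚ)) (ℚ.*-identityʳ (pr δ))))))))))
    where
    bit : Vec Bool (2 ℕ.^ n) → Point n → Bool → Bool
    bit S x α = agree (lookup S (idx x)) α
    skip : ∀ {x y : Point n} → x ≢ y → ∀ S b → lookup (S [ idx x ]≔ b) (idx y) ≡ lookup S (idx y)
    skip x≢y S b = Vec.lookup∘update′ (λ e → x≢y (sym (idx-injective e))) S b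

  module _ (0≤p : 0ℚ ≤ℚ p) (p≤1-p : p ≤ℚ 1ℚ - p) where

    -- As p ≤ 1 - p, no single set weighs less than p^N. A family of smaller measure is therefore
    -- empty, which turns stability into exact equality.
    atom : ∀ {N} (G : Vec Bool N → Bool) b → G b ≡ true → p ^ℚ N ≤ℚ 𝔼ₚ (𝟙 ∘ G)
    atom {zero} G [] e rewrite e = ℚ.≤-refl
    atom {suc N} G (false ∷ b) e = by-diff (diff p≤1-p ⊠ 0≤E₀ ⊞ 0≤p ⊠ diff (atom (G ∘ (false ∷_)) b e) ⊞ 0≤p ⊠ 0≤E₁) (e′ p (p ^ℚ N) (𝔼ₚ (𝟙 ∘ G ∘ (false ∷_))) (𝔼ₚ (𝟙 ∘ G ∘ (true ∷_))))
      where
      0≤E₀ = wsum-nonneg (ℚ.≤-trans 0≤p p≤1-p) 0≤p (λ S → 𝟙-nonneg (G (false ∷ S)))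
      0≤E₁ = wsum-nonneg (ℚ.≤-trans 0≤p p≤1-p) 0≤p (λ S → 𝟙-nonneg (G (true ∷ S)))
      e′ : ∀ p k x y → (1ℚ - p) * x + p * y - p * k ≡ (1ℚ - p - p) * x + p * (x - k) + p * y
      e′ = solve-∀ ring
    atom {suc N} G (true ∷ b) e = by-diff (ℚ.≤-trans 0≤p p≤1-p ⊠ 0≤E₀ ⊞ 0≤p ⊠ diff (atom (G ∘ (true ∷_)) b e)) (e′ p (p ^ℚ N) (𝔼ₚ (𝟙 ∘ G ∘ (false ∷_))) (𝔼ₚ (𝟙 ∘ G ∘ (true ∷_))))
      where
      0≤E₀ = wsum-nonneg (ℚ.≤-trans 0≤p p≤1-p) 0≤p (λ S → 𝟙-nonneg (G (false ∷ S)))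
      e′ : ∀ p k x y → (1ℚ - p) * x + p * y - p * k ≡ (1ℚ - p) * x + p * (y - k)
      e′ = solve-∀ ring

    μ≤1 : ∀ {n} (F : Family n) → μ p F ≤ℚ 1ℚ
    μ≤1 {n} F = subst₂ _≤ℚ_ (sym (μ≡𝔼 F)) (wsum-const {N = 2 ℕ.^ n} 1-p+p 1ℚ) (wsum-mono (ℚ.≤-trans 0≤p p≤1-p) 0≤p (λ b → 𝟙≤1 (F (sub b))))
      where
      𝟙≤1 : ∀ b → 𝟙 b ≤ℚ 1ℚ
      𝟙≤1 true = ℚ.≤-refl
      𝟙≤1 false = nonneg 1ℚ

    miss : ∀ {n} → Family n → Point n → Bool → ℚ
    miss F x α = 𝔼ₚ (λ S → 𝟙 (F (sub S)) * 𝟙 (not (agree (x ∈ₛ sub S) α)))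

    -- The distance is μ(T) - μ(F) plus twice the measure of F outside T, and that part is covered
    -- by the three missed parts.
    cylinder-distance : ∀ {n} (F : Family n) x y z α β δ {τ} → miss F x α ≤ℚ τ → miss F y β ≤ℚ τ → miss F z δ ≤ℚ τ →
      μ p (cylinder x y z α β δ Δ F) ≤ℚ μ p (cylinder x y z α β δ) - μ p F + 6ℚ * τ
    cylinder-distance {n} F x y z α β δ {τ} mx my mz = ℚ.≤-trans
      (subst₂ _≤ℚ_ (sym (μ≡𝔼 (T Δ F))) expand (wsum-mono (ℚ.≤-trans 0≤p p≤1-p) 0≤p pointwise))
      (by-diff (nonneg 2ℚ ⊠ (diff mx ⊞ diff my ⊞ diff mz)) (e (μ p T) (μ p F) (miss F x α) (miss F y β) (miss F z δ) τ))
      where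
      T = cylinder x y z α β δ
      M : Vec Bool (2 ℕ.^ n) → ℚ
      M S = 𝟙 (F (sub S)) * 𝟙 (not (agree (x ∈ₛ sub S) α)) + (𝟙 (F (sub S)) * 𝟙 (not (agree (y ∈ₛ sub S) β)) + 𝟙 (F (sub S)) * 𝟙 (not (agree (z ∈ₛ sub S) δ)))
      e : ∀ t f a b c τ → t - f + 6ℚ * τ - (1ℚ * (1ℚ * t + - 1ℚ * f) + 2ℚ * (a + (b + c))) ≡ 2ℚ * ((τ - a) + (τ - b) + (τ - c))
      e = solve-∀ ring
      expand : 𝔼ₚ (λ S → 1ℚ * (1ℚ * 𝟙 (T (sub S)) + - 1ℚ * 𝟙 (F (sub S))) + 2ℚ * M S) ≡ 1ℚ * (1ℚ * μ p T + - 1ℚ * μ p F) + 2ℚ * (miss F x α + (miss F y β + miss F z δ))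
      expand = trans (wsum-lin 1ℚ 2ℚ (λ S → 1ℚ * 𝟙 (T (sub S)) + - 1ℚ * 𝟙 (F (sub S))) M) (cong₂ (λ s t → 1ℚ * s + 2ℚ * t)
        (trans (wsum-lin 1ℚ (- 1ℚ) (λ S → 𝟙 (T (sub S))) (λ S → 𝟙 (F (sub S)))) (cong₂ (λ s t → 1ℚ * s + - 1ℚ * t) (sym (μ≡𝔼 T)) (sym (μ≡𝔼 F))))
        (trans (wsum-+ (λ S → 𝟙 (F (sub S)) * 𝟙 (not (agree (x ∈ₛ sub S) α))) _) (cong (λ s → miss F x α + s) (wsum-+ (λ S → 𝟙 (F (sub S)) * 𝟙 (not (agree (y ∈ₛ sub S) β))) (λ S → 𝟙 (F (sub S)) * 𝟙 (not (agree (z ∈ₛ sub S) δ)))))))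
      table : ∀ f a b c → 𝟙 ((a ∧ (b ∧ c)) xor f) ≤ℚ 1ℚ * (1ℚ * 𝟙 (a ∧ (b ∧ c)) + - 1ℚ * 𝟙 f) + 2ℚ * (𝟙 f * 𝟙 (not a) + (𝟙 f * 𝟙 (not b) + 𝟙 f * 𝟙 (not c)))
      table false a b c = ℚ.≤-reflexive (trans (cong 𝟙 (Bool.xor-identityʳ (a ∧ (b ∧ c)))) (e₀ (𝟙 (a ∧ (b ∧ c))) (𝟙 (not a)) (𝟙 (not b)) (𝟙 (not c))))
        where
        e₀ : ∀ t a b c → t ≡ 1ℚ * (1ℚ * t + - 1ℚ * 0ℚ) + 2ℚ * (0ℚ * a + (0ℚ * b + 0ℚ * c))
        e₀ = solve-∀ ring
      table true false false false = dec≤ _ _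
      table true false false true = dec≤ _ _
      table true false true false = dec≤ _ _
      table true false true true = dec≤ _ _
      table true true false false = dec≤ _ _
      table true true false true = dec≤ _ _
      table true true true false = dec≤ _ _
      table true true true true = dec≤ _ _
      pointwise : ∀ S → 𝟙 (T (sub S) xor F (sub S)) ≤ℚ 1ℚ * (1ℚ * 𝟙 (T (sub S)) + - 1ℚ * 𝟙 (F (sub S))) + 2ℚ * M S
      pointwise S = table (F (sub S)) (agree (x ∈ₛ sub S) α) (agree (y ∈ₛ sub S) β) (agree (z ∈ₛ sub S) δ)

-- The stability constant

inv : ℚ → ℚ
inv a with a ℚ.≟ 0ℚ
... | yes _ = 0ℚ
... | no a≢0 = ℚ.1/_ a {{ℚ.≢-nonZero a≢0}}

inv-inverse : ∀ {a} → 0ℚ <ℚ a → a * inv a ≡ 1ℚ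
inv-inverse {a} 0<a with a ℚ.≟ 0ℚ
... | yes a≡0 = ⊥-elim (ℚ.<-irrefl (sym a≡0) 0<a)
... | no a≢0 = ℚ.*-inverseʳ a {{ℚ.≢-nonZero a≢0}}

inv-nonneg : ∀ {a} → 0ℚ <ℚ a → 0ℚ ≤ℚ inv a
inv-nonneg {a} 0<a = subst (0ℚ ≤ℚ_) (trans (e a (inv a)) (trans (cong (_* inv a) (inv-inverse 0<a)) (ℚ.*-identityˡ (inv a)))) (ℚ.<⇒≤ 0<a ⊠ square-nonneg (inv a))
  where
  e : ∀ a i → a * (i * i) ≡ a * i * i
  e = solve-∀ ring

inv-antitone : ∀ {a b} → 0ℚ <ℚ a → a ≤ℚ b → inv b ≤ℚ inv a
inv-antitone {a} {b} 0<a a≤b = by-diff (inv-nonneg 0<a ⊠ inv-nonneg 0<b ⊠ diff a≤b)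
  (trans (e₁ (inv a) (inv b)) (trans (cong₂ (λ s t → inv a * s - inv b * t) (sym (inv-inverse 0<b)) (sym (inv-inverse 0<a))) (e₂ a b (inv a) (inv b))))
  where
  0<b = ℚ.<-≤-trans 0<a a≤b
  e₁ : ∀ x y → x - y ≡ x * 1ℚ - y * 1ℚ
  e₁ = solve-∀ ring
  e₂ : ∀ a b x y → x * (b * y) - y * (a * x) ≡ x * y * (b - a)
  e₂ = solve-∀ ring

*-mono₂ : ∀ {a b c d} → 0ℚ ≤ℚ a → a ≤ℚ b → 0ℚ ≤ℚ c → c ≤ℚ d → a * c ≤ℚ b * d
*-mono₂ 0≤a a≤b 0≤c c≤d = ℚ.≤-trans (*-monoʳ 0≤c a≤b) (*-monoˡ (ℚ.≤-trans 0≤a a≤b) c≤d)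

sixth : ℚ → ℚ
sixth x = x * (x * x) * (x * (x * x))

-- This is 2^17/p^18. With τ = 16384ε/p^12 the distance is at most ε + 6τ, which fits below it. If
-- 32768ε ≥ p^18 it makes the bound at least 1; otherwise 2τ ≤ p⁶, which is the smallness that the
-- choice of sides relies on.
constant : ℚ → ℚ
constant p = + 131072 / 1 * (sixth (inv p) * sixth (inv p) * sixth (inv p))

sixth-nonneg : ∀ {x} → 0ℚ ≤ℚ x → 0ℚ ≤ℚ sixth x
sixth-nonneg 0≤x = 0≤x ⊠ (0≤x ⊠ 0≤x) ⊠ (0≤x ⊠ (0≤x ⊠ 0≤x))

sixth-mono : ∀ {x y} → 0ℚ ≤ℚ x → x ≤ℚ y → sixth x ≤ℚ sixth y
sixth-mono 0≤x x≤y = *-mono₂ (0≤x ⊠ (0≤x ⊠ 0≤x)) cube (0≤x ⊠ (0≤x ⊠ 0≤x)) cube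
  where
  cube = *-mono₂ 0≤x x≤y (0≤x ⊠ 0≤x) (*-mono₂ 0≤x x≤y 0≤x x≤y)

constant-antitone : ∀ {a b} → 0ℚ <ℚ a → a ≤ℚ b → constant b ≤ℚ constant a
constant-antitone {a} {b} 0<a a≤b = *-monoˡ (nonneg (+ 131072 / 1)) (*-mono₂ (0≤s ⊠ 0≤s) (*-mono₂ 0≤s s≤ 0≤s s≤) 0≤s s≤)
  where
  0≤i = inv-nonneg (ℚ.<-≤-trans 0<a a≤b)
  0≤s = sixth-nonneg 0≤i
  s≤ = sixth-mono 0≤i (inv-antitone 0<a a≤b)

OddDep-map : ∀ {n} {P Q : Point n → Set} → (∀ x → P x → Q x) → OddDep P → OddDep Q
OddDep-map f (l , vs , all , s) = l , vs , VecAll.map (λ { {x} (x≢0 , px) → x≢0 , f x px }) all , s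

basis-triple : ∀ n → 2 ≤ n → ∃ λ (x : Point n) → ∃ λ y → ∃ λ z → SchurTriple x y z
basis-triple (suc (suc n)) _ = (true ∷ false ∷ 0v) , (false ∷ true ∷ 0v) , (true ∷ true ∷ 0v) ,
  (λ ()) , (λ ()) , (λ ()) , (λ ()) , (λ ()) , (λ ()) , cong (λ v → true ∷ true ∷ v) (sym (⊕-self 0v))
basis-triple (suc zero) (s≤s ())

agree-sound : ∀ p {a b} → Measure.agree p a b ≡ true → a ≡ b
agree-sound p {true} {true} _ = refl
agree-sound p {false} {false} _ = refl

agree-refl : ∀ p a → Measure.agree p a a ≡ true
agree-refl p true = refl
agree-refl p false = refl

p≤1-p : ∀ {p} → p ≤ℚ ½ → p ≤ℚ 1ℚ - p
p≤1-p {p} p≤½ = by-diff (nonneg (+ 2 / 1) ⊠ diff p≤½) (e p)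
  where
  e : ∀ p → 1ℚ - p - p ≡ + 2 / 1 * (½ - p)
  e = solve-∀ ring

-- Bound, stability and extremal case for one family

module Bounds {n : ℕ} (p : ℚ) (0<p : 0ℚ <ℚ p) (p≤½ : p ≤ℚ ½)
  (comp : Bool → Bool → Bool) (comp-tf : comp true false ≡ true) (comp-ft : comp false true ≡ true)
  (comp-ff : comp false false ≡ true ⊎ p ≡ ½) (F : Family n)
  (dep : ∀ S T → F S ≡ true → F T ≡ true → OddDep (λ x → comp (x ∈ₛ S) (x ∈ₛ T) ≡ false)) where

  open Measure p

  private
    0≤p = ℚ.<⇒≤ 0<p
    p≤1-p′ = p≤1-p p≤½
    0<1-p = ℚ.<-≤-trans 0<p p≤1-p′
    i = inv (1ℚ - p)
    i-eq : (1ℚ - p) * i ≡ 1ℚ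
    i-eq = inv-inverse 0<1-p
    0≤i : 0ℚ ≤ℚ i
    0≤i = inv-nonneg 0<1-p

  q : ℚ
  q = p * i

  private
    q-eq : q * (1ℚ - p) ≡ p
    q-eq = trans (e p i) (trans (cong (p *_) i-eq) (ℚ.*-identityʳ p))
      where
      e : ∀ p i → p * i * (1ℚ - p) ≡ p * ((1ℚ - p) * i)
      e = solve-∀ ring
    q≤1 : q ≤ℚ 1ℚ
    q≤1 = by-diff (diff p≤1-p′ ⊠ 0≤i) (trans (cong (λ x → x - q) (sym i-eq)) (e p i))
      where
      e : ∀ p i → (1ℚ - p) * i - p * i ≡ (1ℚ - p - p) * i
      e = solve-∀ ring
    q-half : comp false false ≡ true ⊎ p ≡ ½ → comp false false ≡ true ⊎ q ≡ 1ℚ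
    q-half (inj₁ e) = inj₁ e
    q-half (inj₂ p≡½) = inj₂ (trans (cong (_* i) (trans p≡½ (sym (cong (λ x → 1ℚ - x) p≡½)))) i-eq)
    orth : ∀ w S T → F (sub S) ≡ true → Compat comp (map (hit w) (points n)) S T → F (sub T) ≡ false
    orth w S T FS c with F (sub T) in FT
    ... | false = refl
    ... | true = ⊥-elim (OddDep⇒orth comp w S T (dep (sub S) (sub T) FS FT) c)

  open Core (points n) (points-unique n) p q q-eq 0≤p p≤1-p′ (0≤p ⊠ 0≤i) q≤1 comp comp-tf comp-ft (q-half comp-ff) (F ∘ sub) orth
    using (mean; mean≤p³; μ₁; μ₀; θ; Triple; module Stability)

  μ≡mean : μ p F ≡ mean
  μ≡mean = μ≡𝔼 F

  μ≤p³ : μ p F ≤ℚ p * (p * p)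
  μ≤p³ = subst (_≤ℚ p * (p * p)) (sym μ≡mean) mean≤p³

  at-∈ : ∀ S x → at (points n) S x ≡ x ∈ₛ sub S
  at-∈ S x = at-lookup (points n) (points-unique n) S (idx x) (lookup-points x)

  missₚ : Point n → Bool → ℚ
  missₚ = miss 0≤p p≤1-p′ F

  θ⇒miss : ∀ z {τ} → θ z ≤ℚ τ → missₚ z true ≤ℚ τ ⊎ missₚ z false ≤ℚ τ
  θ⇒miss z {τ} θ≤ with ℚ.⊓-sel (μ₁ z) (μ₀ z)
  ... | inj₁ e = inj₂ (subst (_≤ℚ τ) (trans e (wsum-cong (λ S → cong (λ b → 𝟙 (F (sub S)) * 𝟙 b) (trans (at-∈ S z) (flip (z ∈ₛ sub S)))))) θ≤)
    where
    flip : ∀ a → a ≡ not (agree a false)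
    flip true = refl
    flip false = refl
  ... | inj₂ e = inj₁ (subst (_≤ℚ τ) (trans e (wsum-cong (λ S → cong (λ b → 𝟙 (F (sub S)) * 𝟙 b) (trans (cong not (at-∈ S z)) (flip (z ∈ₛ sub S)))))) θ≤)
    where
    flip : ∀ a → not a ≡ not (agree a true)
    flip true = refl
    flip false = refl

  -- `A` singles out the admissible prescribed bits: only `true` for umvirates, both for juntas.
  -- `pick` must settle for an admissible side from the knowledge that some side is nearly missed.
  module Cylinders (A : Bool → Set) (A-true : A true) (A⇒pr : ∀ α → A α → pr α ≡ p)
    (pick : ∀ z {ε τ} → p * (p * p) - ε ≤ℚ μ p F → ε + τ <ℚ p * (p * (p * p)) →
      missₚ z true ≤ℚ τ ⊎ missₚ z false ≤ℚ τ → ∃ λ α → A α × missₚ z α ≤ℚ τ) where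

    Near : ℚ → Set
    Near η = ∃ λ x → ∃ λ y → ∃ λ z → SchurTriple x y z × ∃ λ α → ∃ λ β → ∃ λ δ → A α × A β × A δ × μ p (cylinder x y z α β δ Δ F) ≤ℚ η

    private
      r = inv p
      y = sixth p
      R = sixth r
      0<y : 0ℚ <ℚ y
      0<y = 0<*0< (0<*0< 0<p (0<*0< 0<p 0<p)) (0<*0< 0<p (0<*0< 0<p 0<p))
      0≤y : 0ℚ ≤ℚ y
      0≤y = ℚ.<⇒≤ 0<y
      0≤R : 0ℚ ≤ℚ R
      0≤R = sixth-nonneg (inv-nonneg 0<p)
      yR : y * R ≡ 1ℚ
      yR = trans (e p r) (cong sixth (inv-inverse 0<p))
        where
        e : ∀ p r → p * (p * p) * (p * (p * p)) * (r * (r * r) * (r * (r * r))) ≡ p * r * (p * r * (p * r)) * (p * r * (p * r * (p * r)))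
        e = solve-∀ ring
      0≤1-p : 0ℚ ≤ℚ 1ℚ - p
      0≤1-p = ℚ.<⇒≤ 0<1-p
      p≤1 : p ≤ℚ 1ℚ
      p≤1 = by-diff 0≤1-p refl
      y≤1 : y ≤ℚ 1ℚ
      y≤1 = sixth-mono 0≤p p≤1
      0≤1-y : 0ℚ ≤ℚ 1ℚ - y
      0≤1-y = diff y≤1
      1≤R : 1ℚ ≤ℚ R
      1≤R = by-diff (0≤R ⊠ 0≤1-y) (trans (cong (λ x → R - x) (sym yR)) (e R y))
        where
        e : ∀ R y → R - y * R ≡ R * (1ℚ - y)
        e = solve-∀ ring

    1≤constant*ε : ∀ ε → y * y * y ≤ℚ + 32768 / 1 * ε → 1ℚ ≤ℚ constant p * ε
    1≤constant*ε ε big = by-diff (nonneg (+ 3 / 1) ⊞ nonneg (+ 4 / 1) ⊠ (0≤R ⊠ 0≤R ⊠ 0≤R ⊠ diff big))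
      (trans (e₁ R ε) (trans (cong (λ x → + 3 / 1 + + 4 / 1 * (R * R * R * (+ 32768 / 1 * ε) - x * (x * x))) (sym yR)) (e₂ y R ε)))
      where
      e₁ : ∀ R ε → + 131072 / 1 * (R * R * R) * ε - 1ℚ ≡ + 3 / 1 + + 4 / 1 * (R * R * R * (+ 32768 / 1 * ε) - 1ℚ * (1ℚ * 1ℚ))
      e₁ = solve-∀ ring
      e₂ : ∀ y R ε → + 3 / 1 + + 4 / 1 * (R * R * R * (+ 32768 / 1 * ε) - y * R * (y * R * (y * R))) ≡ + 3 / 1 + + 4 / 1 * (R * R * R * (+ 32768 / 1 * ε - y * y * y))
      e₂ = solve-∀ ring

    -- For large ε any cylinder over any Schur triple will do, as distances are at most 1. A triple
    -- exists because n ≥ 2.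
    far : ∀ ε → 2 ≤ n → y * y * y ≤ℚ + 32768 / 1 * ε → Near (constant p * ε)
    far ε 2≤n big = build (basis-triple n 2≤n)
      where
      build : (∃ λ x → ∃ λ y → ∃ λ z → SchurTriple x y z) → Near (constant p * ε)
      build (a , b , c , triple) = a , b , c , triple , true , true , true , A-true , A-true , A-true ,
        ℚ.≤-trans (μ≤1 0≤p p≤1-p′ (cylinder a b c true true true Δ F)) (1≤constant*ε ε big)

    near : ∀ ε → 0ℚ <ℚ ε → p * (p * p) - ε ≤ℚ μ p F → + 32768 / 1 * ε ≤ℚ y * y * y → Near (constant p * ε)
    near ε 0<ε large small = build (St.find τ 0≤τ big)
      where
      0≤ε = ℚ.<⇒≤ 0<ε
      -- Twice the threshold of `find`, so that its strict inequality holds.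
      τ : ℚ
      τ = + 16384 / 1 * (R * R * ε)
      0≤τ : 0ℚ ≤ℚ τ
      0≤τ = nonneg (+ 16384 / 1) ⊠ (0≤R ⊠ 0≤R ⊠ 0≤ε)
      small′ : + 1024 / 1 * ε ≤ℚ y
      small′ = by-diff (nonneg (+ 1 / 32) ⊠ (diff small ⊞ 0≤y ⊠ (0≤1-y ⊠ (nonneg 1ℚ ⊞ 0≤y)) ⊞ nonneg (+ 31 / 1) ⊠ 0≤y)) (e y ε)
        where
        e : ∀ y ε → y - + 1024 / 1 * ε ≡ + 1 / 32 * ((y * y * y - + 32768 / 1 * ε) + y * ((1ℚ - y) * (1ℚ + y)) + + 31 / 1 * y)
        e = solve-∀ ring
      module St = Stability 0<p ε 0<ε (subst (p * (p * p) - ε ≤ℚ_) μ≡mean large) small′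
      big : + 8192 / 1 * ε <ℚ y * y * τ
      big = subst (+ 8192 / 1 * ε <ℚ_) (trans (e₁ ε) (trans (cong (λ x → + 16384 / 1 * (x * x * ε)) (sym yR)) (e₂ y R ε)))
        (subst (_<ℚ + 8192 / 1 * ε + + 8192 / 1 * ε) (ℚ.+-identityʳ (+ 8192 / 1 * ε)) (ℚ.+-monoʳ-< (+ 8192 / 1 * ε) (0<*0< (ℚ.positive⁻¹ (+ 8192 / 1)) 0<ε)))
        where
        e₁ : ∀ ε → + 8192 / 1 * ε + + 8192 / 1 * ε ≡ + 16384 / 1 * (1ℚ * 1ℚ * ε)
        e₁ = solve-∀ ring
        e₂ : ∀ y R ε → + 16384 / 1 * (y * R * (y * R) * ε) ≡ y * y * (+ 16384 / 1 * (R * R * ε))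
        e₂ = solve-∀ ring
      2τ≤y : + 2 / 1 * τ ≤ℚ y
      2τ≤y = by-diff (0≤R ⊠ 0≤R ⊠ diff small) (trans (e₁ y R ε) (trans (cong (λ x → y * (x * x) - + 2 / 1 * (+ 16384 / 1 * (R * R * ε))) (sym yR)) (e₂ y R ε)))
        where
        e₁ : ∀ y R ε → y - + 2 / 1 * (+ 16384 / 1 * (R * R * ε)) ≡ y * (1ℚ * 1ℚ) - + 2 / 1 * (+ 16384 / 1 * (R * R * ε))
        e₁ = solve-∀ ring
        e₂ : ∀ y R ε → y * (y * R * (y * R)) - + 2 / 1 * (+ 16384 / 1 * (R * R * ε)) ≡ R * R * (y * y * y - + 32768 / 1 * ε)
        e₂ = solve-∀ ring
      ε+τ<p⁴ : ε + τ <ℚ p * (p * (p * p))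
      ε+τ<p⁴ = ℚ.≤-<-trans (by-diff (nonneg ½ ⊠ diff 2τ≤y ⊞ nonneg (+ 1 / 1024) ⊠ diff small′ ⊞ nonneg (+ 255 / 1024) ⊠ 0≤y) (e₁ y ε τ))
        (ℚ.<-≤-trans (subst (+ 3 / 4 * y <ℚ_) (ℚ.*-identityˡ y) (ℚ.*-monoˡ-<-pos y {{ℚ.positive 0<y}} (toWitness {a? = (+ 3 / 4) ℚ.<? 1ℚ} tt)))
          (by-diff (0≤p ⊠ (0≤p ⊠ (0≤p ⊠ 0≤p)) ⊠ (0≤1-p ⊠ (nonneg 1ℚ ⊞ 0≤p))) (e₂ p)))
        where
        e₁ : ∀ y ε τ → + 3 / 4 * y - (ε + τ) ≡ ½ * (y - + 2 / 1 * τ) + + 1 / 1024 * (y - + 1024 / 1 * ε) + + 255 / 1024 * y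
        e₁ = solve-∀ ring
        e₂ : ∀ p → p * (p * (p * p)) - p * (p * p) * (p * (p * p)) ≡ p * (p * (p * p)) * ((1ℚ - p) * (1ℚ + p))
        e₂ = solve-∀ ring
      budget : ∀ m → p * (p * p) - ε ≤ℚ m → p * (p * p) - m + + 6 / 1 * τ ≤ℚ constant p * ε
      budget m large = by-diff (diff large ⊞ 0≤ε ⊠ (nonneg (+ 98304 / 1) ⊠ (0≤R ⊠ 0≤R) ⊠ diff 1≤R ⊞ (nonneg (+ 32767 / 1) ⊞ nonneg (+ 32768 / 1) ⊠ (diff 1≤R ⊠ (nonneg 1ℚ ⊞ 0≤R ⊞ 0≤R ⊠ 0≤R)))))
        (e p m R ε)
        where
        e : ∀ p m R ε → + 131072 / 1 * (R * R * R) * ε - (p * (p * p) - m + + 6 / 1 * (+ 16384 / 1 * (R * R * ε))) ≡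
          (m - (p * (p * p) - ε)) + ε * (+ 98304 / 1 * (R * R) * (R - 1ℚ) + (+ 32767 / 1 + + 32768 / 1 * ((R - 1ℚ) * (1ℚ + R + R * R))))
        e = solve-∀ ring
      Choice : Point n → Set
      Choice z = ∃ λ α → A α × missₚ z α ≤ℚ τ
      choose : ∀ z → θ z ≤ℚ τ → Choice z
      choose z θ≤ = pick z large ε+τ<p⁴ (θ⇒miss z θ≤)
      assemble : ∀ a b c → SchurTriple a b c → Choice a → Choice b → Choice c → Near (constant p * ε)
      assemble a b c triple@(_ , _ , _ , a≢b , a≢c , b≢c , _) (α , Aα , mα) (β , Aβ , mβ) (δ , Aδ , mδ) = a , b , c , triple , α , β , δ , Aα , Aβ , Aδ ,
        ℚ.≤-trans (cylinder-distance 0≤p p≤1-p′ F a b c α β δ mα mβ mδ)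
          (subst (λ x → x - μ p F + + 6 / 1 * τ ≤ℚ constant p * ε)
            (sym (trans (cylinder-measure a≢b a≢c b≢c α β δ) (cong₂ _*_ (A⇒pr α Aα) (cong₂ _*_ (A⇒pr β Aβ) (A⇒pr δ Aδ)))))
            (budget (μ p F) large))
      build : Triple τ → Near (constant p * ε)
      build (a , b , c , triple , θa , θb , θc) = assemble a b c triple (choose a θa) (choose b θb) (choose c θc)

    stability : 2 ≤ n → ∀ ε → 0ℚ <ℚ ε → p * (p * p) - ε ≤ℚ μ p F → Near (constant p * ε)
    stability 2≤n ε 0<ε large = [ far ε 2≤n , near ε 0<ε large ]′ (ℚ.≤-total (y * y * y) (+ 32768 / 1 * ε))

    extremal : 2 ≤ n → μ p F ≡ p * (p * p) →
      ∃ λ x → ∃ λ y → ∃ λ z → SchurTriple x y z × ∃ λ α → ∃ λ β → ∃ λ δ → A α × A β × A δ × (∀ S → F S ≡ cylinder x y z α β δ S)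
    extremal 2≤n eq = conclude (stability 2≤n ε 0<ε large)
      where
      κ ε : ℚ
      κ = p ^ℚ (2 ℕ.^ n)
      -- Chosen so that `constant p * ε` is κ/2. This lies below the least measure κ of a nonempty
      -- family, so the symmetric difference is empty.
      ε = ½ * κ * (+ 1 / 131072 * (y * y * y))
      power-pos : ∀ m → 0ℚ <ℚ p ^ℚ m
      power-pos zero = ℚ.positive⁻¹ 1ℚ
      power-pos (suc m) = 0<*0< 0<p (power-pos m)
      0<ε : 0ℚ <ℚ ε
      0<ε = 0<*0< (0<*0< (ℚ.positive⁻¹ ½) (power-pos (2 ℕ.^ n))) (0<*0< (ℚ.positive⁻¹ (+ 1 / 131072)) (0<*0< (0<*0< 0<y 0<y) 0<y))
      large : p * (p * p) - ε ≤ℚ μ p F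
      large = subst (p * (p * p) - ε ≤ℚ_) (sym eq) (by-diff (ℚ.<⇒≤ 0<ε) (e (p * (p * p)) ε))
        where
        e : ∀ a b → a - (a - b) ≡ b
        e = solve-∀ ring
      half : constant p * ε ≡ ½ * κ
      half = trans (e₁ R κ y) (trans (cong (λ x → ½ * κ * (x * (x * x))) yR) (ℚ.*-identityʳ (½ * κ)))
        where
        e₁ : ∀ R κ y → + 131072 / 1 * (R * R * R) * (½ * κ * (+ 1 / 131072 * (y * y * y))) ≡ ½ * κ * (y * R * (y * R * (y * R)))
        e₁ = solve-∀ ring
      half<κ : ½ * κ <ℚ κ
      half<κ = subst (½ * κ <ℚ_) (ℚ.*-identityˡ κ) (ℚ.*-monoˡ-<-pos κ {{ℚ.positive (power-pos (2 ℕ.^ n))}} (toWitness {a? = ½ ℚ.<? 1ℚ} tt))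
      xor-false : ∀ a b → a xor b ≡ false → b ≡ a
      xor-false true true _ = refl
      xor-false false false _ = refl
      conclude : Near (constant p * ε) → _
      conclude (a , b , c , triple , α , β , δ , Aα , Aβ , Aδ , dist) = a , b , c , triple , α , β , δ , Aα , Aβ , Aδ , same
        where
        G = cylinder a b c α β δ Δ F
        empty : ∀ S → G S ≢ true
        empty S e = ℚ.<-irrefl {x = κ} refl (ℚ.≤-<-trans (ℚ.≤-trans (subst (κ ≤ℚ_) (sym (μ≡𝔼 G)) (atom 0≤p p≤1-p′ (G ∘ sub) (bits S) e)) (subst (μ p G ≤ℚ_) half dist)) half<κ)
        same : ∀ S → F S ≡ cylinder a b c α β δ S
        same S = xor-false (cylinder a b c α β δ S) (F S) (Bool.¬-not (empty S))

-- Umvirates and juntas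

cylinder-⇔ : ∀ {n} p (x y z : Point n) α β δ S → (Measure.cylinder p x y z α β δ S ≡ true) ⇔ ((x ∈ₛ S) ≡ α × (y ∈ₛ S) ≡ β × (z ∈ₛ S) ≡ δ)
cylinder-⇔ p x y z α β δ S = mk⇔ to from
  where
  to : Measure.cylinder p x y z α β δ S ≡ true → (x ∈ₛ S) ≡ α × (y ∈ₛ S) ≡ β × (z ∈ₛ S) ≡ δ
  to e with Measure.agree p (x ∈ₛ S) α in a | Measure.agree p (y ∈ₛ S) β in b | Measure.agree p (z ∈ₛ S) δ in c
  ... | true | true | true = agree-sound p a , agree-sound p b , agree-sound p c
  from : (x ∈ₛ S) ≡ α × (y ∈ₛ S) ≡ β × (z ∈ₛ S) ≡ δ → Measure.cylinder p x y z α β δ S ≡ true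
  from (refl , refl , refl) rewrite agree-refl p (x ∈ₛ S) | agree-refl p (y ∈ₛ S) | agree-refl p (z ∈ₛ S) = refl

⇔-rebase : ∀ {A : Set} {a b : Bool} → a ≡ b → (b ≡ true) ⇔ A → (a ≡ true) ⇔ A
⇔-rebase refl e = e

⇔⇒≡ : ∀ {A : Set} (a b : Bool) → (a ≡ true) ⇔ A → (b ≡ true) ⇔ A → a ≡ b
⇔⇒≡ true b f g = sym (Equivalence.from g (Equivalence.to f refl))
⇔⇒≡ false true f g = Equivalence.from f (Equivalence.to g refl)
⇔⇒≡ false false f g = refl

μ-cong : ∀ {n} p {F G : Family n} → (∀ S → F S ≡ G S) → μ p F ≡ μ p G
μ-cong p {F} {G} e = trans (Measure.μ≡𝔼 p F) (trans (wsum-cong (λ b → cong 𝟙 (e (sub b)))) (sym (Measure.μ≡𝔼 p G)))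

cube : ∀ p → p ^ℚ 3 ≡ p * (p * p)
cube p = cong (λ x → p * (p * x)) (ℚ.*-identityʳ p)

pr-½ : ∀ α → Measure.pr ½ α ≡ ½
pr-½ true = refl
pr-½ false = refl

umvirate-measure : ∀ {n} p (F : Family n) → SchurUmvirate F → μ p F ≡ p * (p * p)
umvirate-measure p F (x , y , z , (_ , _ , _ , x≢y , x≢z , y≢z , _) , iff) = trans
  (μ-cong p (λ S → ⇔⇒≡ (F S) _ (iff S) (cylinder-⇔ p x y z true true true S)))
  (Measure.cylinder-measure p x≢y x≢z y≢z true true true)

junta-measure : ∀ {n} (F : Family n) → SchurJunta F → μ ½ F ≡ ½ * (½ * ½)
junta-measure F (x , y , z , (_ , _ , _ , x≢y , x≢z , y≢z , _) , α , β , δ , iff) = trans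
  (μ-cong ½ (λ S → ⇔⇒≡ (F S) _ (iff S) (cylinder-⇔ ½ x y z α β δ S)))
  (trans (Measure.cylinder-measure ½ x≢y x≢z y≢z α β δ) (cong₂ _*_ (pr-½ α) (cong₂ _*_ (pr-½ β) (pr-½ δ))))

module Intersecting {n : ℕ} (p : ℚ) (0<p : 0ℚ <ℚ p) (p≤½ : p ≤ℚ ½) where

  nand : Bool → Bool → Bool
  nand s t = not (s ∧ t)

  nand-dep : ∀ {F : Family n} → OddIntersecting F → ∀ S T → F S ≡ true → F T ≡ true → OddDep (λ x → nand (x ∈ₛ S) (x ∈ₛ T) ≡ false)
  nand-dep oi S T FS FT = OddDep-map (λ { x (s , t) → cong₂ nand s t }) (oi S T FS FT)

  module B (F : Family n) (oi : OddIntersecting F) = Bounds p 0<p p≤½ nand refl refl (inj₁ refl) F (nand-dep oi)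

  module _ (F : Family n) (oi : OddIntersecting F) where

    open Measure p
    open B F oi

    -- Adding z freely to the members that avoid it keeps the family intersecting, so these members have measure at most (1 − p)p³.
    miss-true≤ : ∀ z → missₚ z true ≤ℚ (1ℚ - p) * (p * (p * p))
    miss-true≤ z = subst (_≤ℚ (1ℚ - p) * (p * (p * p))) (sym split) (*-monoˡ (ℚ.≤-trans (ℚ.<⇒≤ 0<p) (p≤1-p p≤½)) (B.μ≤p³ F′ oi′))
      where
      i = idx z
      F′ : Family n
      F′ S = F (sub (bits S [ i ]≔ false))
      shrink : ∀ (S : Vec Bool (2 ℕ.^ n)) j → lookup (S [ i ]≔ false) j ≡ true → lookup S j ≡ true
      shrink S j e with j Fin.≟ i
      ... | yes refl with () ← trans (sym e) (Vec.lookup∘update i S false)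
      ... | no j≢i = trans (sym (Vec.lookup∘update′ j≢i S false)) e
      oi′ : OddIntersecting F′
      oi′ S T FS FT = OddDep-map (λ x (s , t) → shrink (bits S) (idx x) s , shrink (bits T) (idx x) t) (oi (sub (bits S [ i ]≔ false)) (sub (bits T [ i ]≔ false)) FS FT)
      e₁ : ∀ p a → (1ℚ - p) * a + p * 0ℚ ≡ (1ℚ - p) * a
      e₁ = solve-∀ ring
      split : missₚ z true ≡ (1ℚ - p) * μ p F′
      split = trans (condition i (λ S → 𝟙 (F (sub S)) * 𝟙 (not (agree (lookup S i) true))))
        (trans (cong₂ (λ s t → (1ℚ - p) * s + p * t)
          (trans (wsum-cong (λ S → trans (cong (λ b → 𝟙 (F (sub (S [ i ]≔ false))) * 𝟙 (not (agree b true))) (Vec.lookup∘update i S false)) (ℚ.*-identityʳ _))) (sym (μ≡𝔼 F′)))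
          (trans (wsum-cong (λ S → trans (cong (λ b → 𝟙 (F (sub (S [ i ]≔ true))) * 𝟙 (not (agree b true))) (Vec.lookup∘update i S true)) (ℚ.*-zeroʳ (𝟙 (F (sub (S [ i ]≔ true))))))) (wsum-0 {N = 2 ℕ.^ n})))
          (e₁ p (μ p F′)))

    μ-split : ∀ z → μ p F ≡ missₚ z true + missₚ z false
    μ-split z = trans (μ≡𝔼 F) (trans (wsum-cong (λ S → table (F (sub S)) (z ∈ₛ sub S))) (wsum-+ (λ S → 𝟙 (F (sub S)) * 𝟙 (not (agree (z ∈ₛ sub S) true))) (λ S → 𝟙 (F (sub S)) * 𝟙 (not (agree (z ∈ₛ sub S) false)))))
      where
      table : ∀ f s → 𝟙 f ≡ 𝟙 f * 𝟙 (not (agree s true)) + 𝟙 f * 𝟙 (not (agree s false))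
      table true true = refl
      table true false = refl
      table false true = refl
      table false false = refl

    -- If nearly all members avoided `z`, the measure would be at most (1 - p)p³ + τ = p³ - p⁴ + τ,
    -- which is below p³ - ε when ε + τ < p⁴.
    pick : ∀ z {ε τ} → p * (p * p) - ε ≤ℚ μ p F → ε + τ <ℚ p * (p * (p * p)) → missₚ z true ≤ℚ τ ⊎ missₚ z false ≤ℚ τ → ∃ λ α → α ≡ true × missₚ z α ≤ℚ τ
    pick z large small (inj₁ m) = true , refl , m
    pick z {ε} {τ} large small (inj₂ m) = ⊥-elim (ℚ.<-irrefl {x = ε + τ} refl (ℚ.<-≤-trans small
      (by-diff (diff (subst (p * (p * p) - ε ≤ℚ_) (μ-split z) large) ⊞ diff m ⊞ diff (miss-true≤ z)) (e p ε τ (missₚ z true) (missₚ z false)))))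
      where
      e : ∀ p ε τ a b → ε + τ - p * (p * (p * p)) ≡ (a + b - (p * (p * p) - ε)) + (τ - b) + ((1ℚ - p) * (p * (p * p)) - a)
      e = solve-∀ ring

    true⇒pr : ∀ α → α ≡ true → pr α ≡ p
    true⇒pr .true refl = refl

    open Cylinders (_≡ true) refl true⇒pr pick

    exact : 2 ≤ n → (μ p F ≤ℚ p ^ℚ 3) × ((μ p F ≡ p ^ℚ 3) ⇔ SchurUmvirate F)
    exact 2≤n = subst (μ p F ≤ℚ_) (sym (cube p)) μ≤p³ ,
      mk⇔ (λ eq → umvirate (extremal 2≤n (trans eq (cube p)))) (λ u → trans (umvirate-measure p F u) (sym (cube p)))
      where
      umvirate : _ → SchurUmvirate F
      umvirate (x , y , z , triple , .true , .true , .true , refl , refl , refl , same) =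
        x , y , z , triple , λ S → ⇔-rebase (same S) (cylinder-⇔ p x y z true true true S)

    stable : 2 ≤ n → ∀ ε → 0ℚ <ℚ ε → p ^ℚ 3 - ε ≤ℚ μ p F → ∃ λ T → SchurUmvirate T × μ p (T Δ F) ≤ℚ constant p * ε
    stable 2≤n ε 0<ε large = umvirate (stability 2≤n ε 0<ε (subst (λ x → x - ε ≤ℚ μ p F) (cube p) large))
      where
      umvirate : Near (constant p * ε) → ∃ λ T → SchurUmvirate T × μ p (T Δ F) ≤ℚ constant p * ε
      umvirate (x , y , z , triple , .true , .true , .true , refl , refl , refl , dist) =
        cylinder x y z true true true , (x , y , z , triple , cylinder-⇔ p x y z true true true) , dist

module Agreeing {n : ℕ} (F : Family n) (oa : OddAgreeing F) where

  open Measure ½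

  xor-dep : ∀ S T → F S ≡ true → F T ≡ true → OddDep (λ x → (x ∈ₛ S) xor (x ∈ₛ T) ≡ false)
  xor-dep S T FS FT = OddDep-map (λ x e → trans (cong (λ b → b xor (x ∈ₛ T)) e) (Bool.xor-same (x ∈ₛ T))) (oa S T FS FT)

  open Bounds ½ (ℚ.positive⁻¹ ½) ℚ.≤-refl _xor_ refl refl (inj₂ refl) F xor-dep

  Any : Bool → Set
  Any _ = ⊤

  Any⇒pr : ∀ α → Any α → pr α ≡ ½
  Any⇒pr α _ = pr-½ α

  pick : ∀ z {ε τ} → ½ * (½ * ½) - ε ≤ℚ μ ½ F → ε + τ <ℚ ½ * (½ * (½ * ½)) → missₚ z true ≤ℚ τ ⊎ missₚ z false ≤ℚ τ → ∃ λ α → Any α × missₚ z α ≤ℚ τ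
  pick z _ _ (inj₁ m) = true , tt , m
  pick z _ _ (inj₂ m) = false , tt , m

  open Cylinders Any tt Any⇒pr pick

  exact : 2 ≤ n → (μ ½ F ≤ℚ ½ ^ℚ 3) × ((μ ½ F ≡ ½ ^ℚ 3) ⇔ SchurJunta F)
  exact 2≤n = μ≤p³ , mk⇔ (λ eq → junta (extremal 2≤n eq)) (junta-measure F)
    where
    junta : _ → SchurJunta F
    junta (x , y , z , triple , α , β , δ , _ , _ , _ , same) =
      x , y , z , triple , α , β , δ , λ S → ⇔-rebase (same S) (cylinder-⇔ ½ x y z α β δ S)

  stable : 2 ≤ n → ∀ ε → 0ℚ <ℚ ε → ½ ^ℚ 3 - ε ≤ℚ μ ½ F → ∃ λ T → SchurJunta T × μ ½ (T Δ F) ≤ℚ constant ½ * ε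
  stable 2≤n ε 0<ε large = junta (stability 2≤n ε 0<ε large)
    where
    junta : Near (constant ½ * ε) → ∃ λ T → SchurJunta T × μ ½ (T Δ F) ≤ℚ constant ½ * ε
    junta (x , y , z , triple , α , β , δ , _ , _ , _ , dist) =
      cylinder x y z α β δ , (x , y , z , triple , α , β , δ , cylinder-⇔ ½ x y z α β δ) , dist

theorem1p3 : (∀ (n : ℕ) → 2 ≤ n → ∀ (p : ℚ) → 0ℚ <ℚ p → p ≤ℚ ½ →
    ∀ (F : Family n) → OddIntersecting F →
    (μ p F ≤ℚ p ^ℚ 3) × ((μ p F ≡ p ^ℚ 3) ⇔ SchurUmvirate F))
    ×
    (∀ (n : ℕ) → 2 ≤ n → ∀ (F : Family n) → OddAgreeing F →
    (μ ½ F ≤ℚ ½ ^ℚ 3) × ((μ ½ F ≡ ½ ^ℚ 3) ⇔ SchurJunta F))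
    ×
    (∃ λ (c : ℚ → ℚ) →
    (∀ (δ : ℚ) → 0ℚ <ℚ δ → ∃ λ (M : ℚ) → ∀ (p : ℚ) → δ ≤ℚ p → p ≤ℚ ½ → c p ≤ℚ M)
    ×
    (∀ (n : ℕ) → 2 ≤ n → ∀ (p : ℚ) → 0ℚ <ℚ p → p ≤ℚ ½ →
    ∀ (F : Family n) → OddIntersecting F →
    ∀ (ε : ℚ) → 0ℚ <ℚ ε → p ^ℚ 3 - ε ≤ℚ μ p F →
    ∃ λ (T : Family n) → SchurUmvirate T × (μ p (T Δ F) ≤ℚ c p * ε))
    ×
    (∀ (n : ℕ) → 2 ≤ n → ∀ (F : Family n) → OddAgreeing F →
    ∀ (ε : ℚ) → 0ℚ <ℚ ε → ½ ^ℚ 3 - ε ≤ℚ μ ½ F →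
    ∃ λ (T : Family n) → SchurJunta T × (μ ½ (T Δ F) ≤ℚ c ½ * ε)))
theorem1p3 =
  (λ n 2≤n p 0<p p≤½ F oi → Intersecting.exact p 0<p p≤½ F oi 2≤n) ,
  (λ n 2≤n F oa → Agreeing.exact F oa 2≤n) ,
  constant ,
  (λ δ 0<δ → constant δ , λ p δ≤p _ → constant-antitone 0<δ δ≤p) ,
  (λ n 2≤n p 0<p p≤½ F oi → Intersecting.stable p 0<p p≤½ F oi 2≤n) ,
  (λ n 2≤n F oa → Agreeing.stable F oa 2≤n)
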